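{- Assume $\mathrm{cov}(\mathcal{N})=\mathfrak{c}$. Then there exists a maximal $\mathsf{d}$-independent family $\mathcal{A}$ of cardinality $\mathfrak{c}$ which is not Lebesgue measurable.
   Context: Let $\omega=\{0,1,2,\ldots\}$ and identify $n\in\omega$ with $\{0,\ldots,n-1\}$. $\mathcal{D}$ is the family of all $A\subseteq\omega$ for which the asymptotic density $\mathsf{d}(A):=\lim_{n\to\infty}|A\cap n|/n$ exists. For $\mathcal{A}\subseteq\mathcal{P}(\omega)$, $\langle\mathcal{A}\rangle$ denotes the field of subsets of $\omega$ generated by $\mathcal{A}$. A nonempty family $\mathcal{A}\subseteq\mathcal{D}$ is $\mathsf{d}$-independent if: (1) $\mathsf{d}(A)\in(0,1)$ for all $A\in\mathcal{A}$; (2) $\langle\mathcal{A}\rangle\subseteq\mathcal{D}$; (3) $\mathsf{d}(\bigcap\mathcal{F})=\prod_{A\in\mathcal{F}}\mathsf{d}(A)$ for every nonempty finite $\mathcal{F}\subseteq\mathcal{A}$. It is a maximal $\mathsf{d}$-independent family if it is $\mathsf{d}$-independent and not properly contained in another $\mathsf{d}$-independent family. Subsets of $\omega$ are identified with their characteristic functions in $2^\omega$ (equivalently for this purpose, an infinite $A\subseteq\omega$ is identified with the real $\sum_{n\in A}2^{ -n-1}\in(0,1]$, with Lebesgue measure there). $\lambda$ denotes the completion of the usual product probability measure on $2^\omega$, and "Lebesgue measurable" means $\lambda$-measurable. $\mathcal{N}$ is the family of subsets of $2^\omega$ that are $\lambda$-null; $\mathrm{cov}(\mathcal{N})$ is the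 least cardinality of a family $\mathcal{S}\subseteq\mathcal{N}$ with $\bigcup\mathcal{S}=2^\omega$. $\mathfrak{c}=2^{\aleph_0}$. -}

module Defs where

open import Agda.Primitive using (Setω)
open import Axiom.ExcludedMiddle using (ExcludedMiddle)
open import Axiom.Extensionality.Propositional using (Extensionality)
open import Level using (0ℓ; _⊔_) renaming (suc to lsuc)
open import Data.Bool using (Bool; true; false; _∧_; _∨_; not; if_then_else_)
open import Data.Nat as ℕ using (ℕ; zero; suc)
import Data.Nat.Properties as ℕₚ
import Data.Integer as ℤ
open import Data.Rational hiding (truncate; _⊔_)
import Data.Rational.Properties as ℚ
open import Data.Rational.Solver using (module +-*-Solver)
open import Data.List using (List; []; _∷_; foldr)
open import Data.List.Relation.Unary.All using (All; reduce)
open import Data.List.Relation.Unary.Unique.Propositional using (Unique)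
open import Data.Product using (∃; _×_; _,_; proj₁; proj₂)
open import Data.Unit using (⊤)
open import Function using (_∘_)
open import Function.Bundles using (Injection; Bijection)
open import Relation.Binary.Bundles using (Setoid)
import Relation.Binary.Construct.On as On
open import Relation.Binary.PropositionalEquality
  using (_≡_; _≢_; refl; sym; trans; cong; cong₂; subst; setoid)
open import Relation.Nullary using (¬_)
open import Relation.Unary
  using (Pred; _∈_; _⊆_; _⊂_; _≐_; _∪_; _∖_; ∁; ⋃; Satisfiable)
open import Relation.Unary.Properties using (≐-refl; ≐-sym; ≐-trans)

------------------------------------------------------------------------
-- Real numbers as Cauchy sequences of rationals.  Two sequences may
-- denote the same real; all relations below depend only on that real.

IsCauchy : (ℕ → ℚ) → Set
IsCauchy x = ∀ ε → 0ℚ < ε →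
  ∃ λ N → ∀ m n → N ℕ.≤ m → N ℕ.≤ n → ∣ x m - x n ∣ < ε

record ℝ : Set where
  constructor mkℝ
  field
    seq      : ℕ → ℚ
    isCauchy : IsCauchy seq

open ℝ public

fromℚ : ℚ → ℝ
fromℚ q = mkℝ (λ _ → q)
  λ ε 0<ε → 0 , λ _ _ _ _ → subst (_< ε) (cong ∣_∣ (sym (ℚ.+-inverseʳ q))) 0<ε

infix 4 _<ℝ_

_<ℝ_ : ℝ → ℝ → Set
x <ℝ y = ∃ λ ε → 0ℚ < ε × ∃ λ N → ∀ n → N ℕ.≤ n → seq x n + ε ≤ seq y n

eventuallyBounded : ∀ x → IsCauchy x →
  ∃ λ N → ∃ λ B → 0ℚ < B × (∀ n → N ℕ.≤ n → ∣ x n ∣ ≤ B)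
eventuallyBounded x c with c 1ℚ (ℚ.positive⁻¹ 1ℚ)
... | N , close = N , 1ℚ + ∣ x N ∣ , 0<B , bound
  where
  open ℚ.≤-Reasoning
  0<B : 0ℚ < 1ℚ + ∣ x N ∣
  0<B = ℚ.+-mono-<-≤ (ℚ.positive⁻¹ 1ℚ) (ℚ.0≤∣p∣ (x N))

  split : ∀ a b → a ≡ (a - b) + b
  split = solve 2 (λ a b → a := (a :- b) :+ b) refl
    where open +-*-Solver

  bound : ∀ n → N ℕ.≤ n → ∣ x n ∣ ≤ 1ℚ + ∣ x N ∣
  bound n N≤n = begin
    ∣ x n ∣                   ≡⟨ cong ∣_∣ (split (x n) (x N)) ⟩
    ∣ (x n - x N) + x N ∣     ≤⟨ ℚ.∣p+q∣≤∣p∣+∣q∣ (x n - x N) (x N) ⟩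
    ∣ x n - x N ∣ + ∣ x N ∣   ≤⟨ ℚ.+-monoˡ-≤ ∣ x N ∣
                                  (ℚ.<⇒≤ (close n N N≤n ℕₚ.≤-refl)) ⟩
    1ℚ + ∣ x N ∣              ∎

shrink : ∀ B C ε → 0ℚ < B → 0ℚ < C → 0ℚ < ε →
  ∃ λ δ → 0ℚ < δ × B * δ + δ * C ≡ ε
shrink B C ε 0<B 0<C 0<ε = shrink′ (B + C) {{ℚ.pos+pos⇒pos B C}} refl
  where
  instance
    B-pos : Positive B
    B-pos = positive 0<B
    C-pos : Positive C
    C-pos = positive 0<C
    ε-pos : Positive ε
    ε-pos = positive 0<ε

  shrink′ : ∀ K {{_ : Positive K}} → B + C ≡ K →
    ∃ λ δ → 0ℚ < δ × B * δ + δ * C ≡ ε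
  shrink′ K B+C≡K =
    K⁻¹ * ε , ℚ.positive⁻¹ (K⁻¹ * ε) {{ℚ.pos*pos⇒pos K⁻¹ {{ℚ.1/pos⇒pos K}} ε}} ,
    trans (cong (λ z → B * (K⁻¹ * ε) + z) (ℚ.*-comm (K⁻¹ * ε) C))
    (trans (sym (ℚ.*-distribʳ-+ (K⁻¹ * ε) B C))
    (trans (cong (_* (K⁻¹ * ε)) B+C≡K)
    (trans (sym (ℚ.*-assoc K K⁻¹ ε))
    (trans (cong (_* ε) (ℚ.*-inverseʳ K {{ℚ.pos⇒nonZero K}})) (ℚ.*-identityˡ ε)))))
    where
    K⁻¹ : ℚ
    K⁻¹ = (1/ K) {{ℚ.pos⇒nonZero K}}

∣ab-cd∣< : ∀ {a b c d B C δ} → 0ℚ < B → 0ℚ < C → ∣ a ∣ ≤ B → ∣ d ∣ ≤ C →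
  ∣ b - d ∣ < δ → ∣ a - c ∣ < δ → ∣ a * b - c * d ∣ < B * δ + δ * C
∣ab-cd∣< {a} {b} {c} {d} {B} {C} {δ} 0<B 0<C a≤B d≤C b-d<δ a-c<δ = begin-strict
  ∣ a * b - c * d ∣
    ≡⟨ cong ∣_∣ (split a b c d) ⟩
  ∣ a * (b - d) + (a - c) * d ∣
    ≤⟨ ℚ.∣p+q∣≤∣p∣+∣q∣ (a * (b - d)) ((a - c) * d) ⟩
  ∣ a * (b - d) ∣ + ∣ (a - c) * d ∣
    ≡⟨ cong₂ _+_ (ℚ.∣p*q∣≡∣p∣*∣q∣ a (b - d)) (ℚ.∣p*q∣≡∣p∣*∣q∣ (a - c) d) ⟩
  ∣ a ∣ * ∣ b - d ∣ + ∣ a - c ∣ * ∣ d ∣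
    ≤⟨ ℚ.+-mono-≤
         (ℚ.*-monoʳ-≤-nonNeg ∣ b - d ∣ {{ℚ.∣-∣-nonNeg (b - d)}} a≤B)
         (ℚ.*-monoˡ-≤-nonNeg ∣ a - c ∣ {{ℚ.∣-∣-nonNeg (a - c)}} d≤C) ⟩
  B * ∣ b - d ∣ + ∣ a - c ∣ * C
    <⟨ ℚ.+-mono-<
         (ℚ.*-monoʳ-<-pos B {{positive 0<B}} b-d<δ)
         (ℚ.*-monoˡ-<-pos C {{positive 0<C}} a-c<δ) ⟩
  B * δ + δ * C ∎
  where
  open ℚ.≤-Reasoning
  split : ∀ a b c d → a * b - c * d ≡ a * (b - d) + (a - c) * d
  split = solve 4 (λ a b c d →
    a :* b :- c :* d := a :* (b :- d) :+ (a :- c) :* d) refl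
    where open +-*-Solver

abstract
  *-isCauchy : ∀ x y → IsCauchy x → IsCauchy y → IsCauchy (λ n → x n * y n)
  *-isCauchy x y cx cy ε 0<ε = bounds (eventuallyBounded x cx) (eventuallyBounded y cy)
    where
    Goal : Set
    Goal = ∃ λ N → ∀ m n → N ℕ.≤ m → N ℕ.≤ n → ∣ x m * y m - x n * y n ∣ < ε

    combine : ∀ {B C δ N₁ N₂ N₃ N₄} → 0ℚ < B → 0ℚ < C → B * δ + δ * C ≡ ε →
      (∀ n → N₁ ℕ.≤ n → ∣ x n ∣ ≤ B) → (∀ n → N₂ ℕ.≤ n → ∣ y n ∣ ≤ C) →
      (∀ m n → N₃ ℕ.≤ m → N₃ ℕ.≤ n → ∣ x m - x n ∣ < δ) →
      (∀ m n → N₄ ℕ.≤ m → N₄ ℕ.≤ n → ∣ y m - y n ∣ < δ) → Goal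
    combine {B} {C} {δ} {N₁} {N₂} {N₃} {N₄} 0<B 0<C Bδ+δC≡ε x≤B y≤C x-close y-close =
      M₁ ℕ.⊔ M₂ , λ m n N≤m N≤n →
        subst (∣ x m * y m - x n * y n ∣ <_) Bδ+δC≡ε
          (∣ab-cd∣< {x m} {y m} {x n} {y n} {B} {C} {δ} 0<B 0<C
            (x≤B m (ℕₚ.m⊔n≤o⇒m≤o N₁ N₂ (ℕₚ.m⊔n≤o⇒m≤o M₁ M₂ N≤m)))
            (y≤C n (ℕₚ.m⊔n≤o⇒n≤o N₁ N₂ (ℕₚ.m⊔n≤o⇒m≤o M₁ M₂ N≤n)))
            (y-close m n (ℕₚ.m⊔n≤o⇒n≤o N₃ N₄ (ℕₚ.m⊔n≤o⇒n≤o M₁ M₂ N≤m))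
                         (ℕₚ.m⊔n≤o⇒n≤o N₃ N₄ (ℕₚ.m⊔n≤o⇒n≤o M₁ M₂ N≤n)))
            (x-close m n (ℕₚ.m⊔n≤o⇒m≤o N₃ N₄ (ℕₚ.m⊔n≤o⇒n≤o M₁ M₂ N≤m))
                         (ℕₚ.m⊔n≤o⇒m≤o N₃ N₄ (ℕₚ.m⊔n≤o⇒n≤o M₁ M₂ N≤n))))
      where
      M₁ M₂ : ℕ
      M₁ = N₁ ℕ.⊔ N₂
      M₂ = N₃ ℕ.⊔ N₄

    bounds : (∃ λ N → ∃ λ B → 0ℚ < B × (∀ n → N ℕ.≤ n → ∣ x n ∣ ≤ B)) →
             (∃ λ N → ∃ λ C → 0ℚ < C × (∀ n → N ℕ.≤ n → ∣ y n ∣ ≤ C)) → Goal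
    bounds (_ , B , 0<B , x≤B) (_ , C , 0<C , y≤C) = moduli (shrink B C ε 0<B 0<C 0<ε)
      where
      moduli : (∃ λ δ → 0ℚ < δ × B * δ + δ * C ≡ ε) → Goal
      moduli (δ , 0<δ , Bδ+δC≡ε) =
        combine 0<B 0<C Bδ+δC≡ε x≤B y≤C (proj₂ (cx δ 0<δ)) (proj₂ (cy δ 0<δ))

infixl 7 _*ℝ_

_*ℝ_ : ℝ → ℝ → ℝ
x *ℝ y = mkℝ (λ n → seq x n * seq y n) (*-isCauchy (seq x) (seq y) (isCauchy x) (isCauchy y))

∏ : List ℝ → ℝ
∏ = foldr _*ℝ_ (fromℚ 1ℚ)

infix 4 _⟶_

-- Convergence, with ∣ q n - x ∣ < ε written as q n - ε < x < q n + ε.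
_⟶_ : (ℕ → ℚ) → ℝ → Set
q ⟶ x = ∀ ε → 0ℚ < ε → ∃ λ N → ∀ n → N ℕ.≤ n →
  fromℚ (q n - ε) <ℝ x × x <ℝ fromℚ (q n + ε)

------------------------------------------------------------------------
-- Subsets of ω are their characteristic functions.

2^ω : Set
2^ω = ℕ → Bool

compl : 2^ω → 2^ω
compl A n = not (A n)

_∪ω_ _∩ω_ : 2^ω → 2^ω → 2^ω
(A ∪ω B) n = A n ∨ B n
(A ∩ω B) n = A n ∧ B n

∅ω ω : 2^ω
∅ω _ = false
ω  _ = true

⋂ω : List 2^ω → 2^ω
⋂ω = foldr _∩ω_ ω

-- ∣ A ∩ n ∣
count : 2^ω → ℕ → ℕ
count A zero    = 0
count A (suc n) = count A n ℕ.+ (if A n then 1 else 0)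

infix 4 _HasDensity_

-- The sequence ∣ A ∩ n ∣ / n is indexed from n = 1.
_HasDensity_ : 2^ω → ℝ → Set
A HasDensity x = (λ n → ℤ.+ count A (suc n) / suc n) ⟶ x

𝒟 : Pred 2^ω 0ℓ
𝒟 A = ∃ λ x → A HasDensity x

d : ∀ {A} → A ∈ 𝒟 → ℝ
d = proj₁

data ⟨_⟩ (𝒜 : Pred 2^ω 0ℓ) : Pred 2^ω 0ℓ where
  gen   : ∀ {A} → A ∈ 𝒜 → A ∈ ⟨ 𝒜 ⟩
  empty : ∅ω ∈ ⟨ 𝒜 ⟩
  comp  : ∀ {A} → A ∈ ⟨ 𝒜 ⟩ → compl A ∈ ⟨ 𝒜 ⟩
  union : ∀ {A B} → A ∈ ⟨ 𝒜 ⟩ → B ∈ ⟨ 𝒜 ⟩ → (A ∪ω B) ∈ ⟨ 𝒜 ⟩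

-- A finite subfamily is a list without repetitions, so that each member
-- contributes exactly one factor to the product.
record DIndependent (𝒜 : Pred 2^ω 0ℓ) : Set where
  field
    nonempty     : Satisfiable 𝒜
    ⊆𝒟           : 𝒜 ⊆ 𝒟
    d∈⟨0,1⟩      : ∀ {A} (A∈𝒜 : A ∈ 𝒜) →
                   fromℚ 0ℚ <ℝ d (⊆𝒟 A∈𝒜) × d (⊆𝒟 A∈𝒜) <ℝ fromℚ 1ℚ
    field⊆𝒟      : ⟨ 𝒜 ⟩ ⊆ 𝒟
    independence : ∀ F → F ≢ [] → Unique F → (F⊆𝒜 : All 𝒜 F) →
                   ⋂ω F HasDensity ∏ (reduce (λ A∈𝒜 → d (⊆𝒟 A∈𝒜)) F⊆𝒜)

MaximalDIndependent : Pred 2^ω 0ℓ → Set₁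
MaximalDIndependent 𝒜 =
  DIndependent 𝒜 × ¬ (∃ λ ℬ → DIndependent ℬ × 𝒜 ⊂ ℬ)

------------------------------------------------------------------------
-- Measure on 2^ω

[_] : List Bool → Pred 2^ω 0ℓ
[ []    ] x = ⊤
[ b ∷ s ] x = x 0 ≡ b × x ∘ suc ∈ [ s ]

-- The product measure 2^-∣s∣ of the cylinder [ s ].
μ : List Bool → ℚ
μ []      = 1ℚ
μ (_ ∷ s) = ½ * μ s

partialSum : (ℕ → ℚ) → ℕ → ℚ
partialSum f zero    = 0ℚ
partialSum f (suc n) = partialSum f n + f n

-- λ-null: the outer measure obtained from cylinders (the infimum of the
-- total measures of countable covers) is zero.  These are exactly the
-- subsets of Borel sets of product measure zero.
𝒩 : Pred (Pred 2^ω 0ℓ) 0ℓ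
𝒩 E = ∀ ε → 0ℚ < ε → ∃ λ (s : ℕ → List Bool) →
  E ⊆ ⋃ ℕ (λ i → [ s i ]) × (∀ n → partialSum (μ ∘ s) n ≤ ε)

data Borel : Pred (Pred 2^ω 0ℓ) (lsuc 0ℓ) where
  cylinder : ∀ s → Borel [ s ]
  comp     : ∀ {B} → Borel B → Borel (∁ B)
  union    : ∀ {B : ℕ → Pred 2^ω 0ℓ} → (∀ i → Borel (B i)) → Borel (⋃ ℕ B)

-- Measurability for the completion: equal to a Borel set modulo a null set.
LebesgueMeasurable : Pred (Pred 2^ω 0ℓ) (lsuc 0ℓ)
LebesgueMeasurable E = ∃ λ B → Borel B × ((E ∖ B) ∪ (B ∖ E)) ∈ 𝒩

------------------------------------------------------------------------
-- Cardinalities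

-- A subfamily as a setoid: membership proofs are ignored, so that a
-- member is counted once however many proofs of membership it has.
Members : ∀ {a ℓ p} (S : Setoid a ℓ) → Pred (Setoid.Carrier S) p →
          Setoid (a ⊔ p) ℓ
Members S P = On.setoid {B = ∃ P} S proj₁

𝔠 : Setoid 0ℓ 0ℓ
𝔠 = setoid 2^ω

𝒫2^ω : Setoid (lsuc 0ℓ) 0ℓ
𝒫2^ω = record
  { Carrier       = Pred 2^ω 0ℓ
  ; _≈_           = _≐_
  ; isEquivalence = record
    { refl  = λ {P} → ≐-refl {x = P}
    ; sym   = λ {P} {Q} → ≐-sym {x = P} {y = Q}
    ; trans = λ {P} {Q} {R} → ≐-trans {i = P} {j = Q} {k = R}
    }
  }

HasCardinality𝔠 : Pred 2^ω 0ℓ → Set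
HasCardinality𝔠 𝒜 = Bijection 𝔠 (Members (setoid 2^ω) 𝒜)

NullCover : Pred (Pred 2^ω 0ℓ) 0ℓ → Set₁
NullCover 𝒮 = 𝒮 ⊆ 𝒩 × (∀ x → ∃ λ N → N ∈ 𝒮 × x ∈ N)

-- 𝔠 is attained by some cover, and is at most the cardinality of any cover.
Cov𝒩≡𝔠 : Set₁
Cov𝒩≡𝔠 =
  (∃ λ 𝒮 → NullCover 𝒮 × Bijection 𝔠 (Members 𝒫2^ω 𝒮)) ×
  (∀ 𝒮 → NullCover 𝒮 → Injection 𝔠 (Members 𝒫2^ω 𝒮))

------------------------------------------------------------------------
-- Classical logic and choice, as ambient assumptions.  Excluded middle here
-- decides every type, not only propositions, so it returns an element of
-- each inhabited type.  Applied to subsets X → Bool, which extensionality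
-- makes equal when they have the same members, this gives a choice function.

record Classical : Setω where
  field
    excludedMiddle : ∀ {ℓ} → ExcludedMiddle ℓ
    extensionality : ∀ {a b} → Extensionality a b

{-# OPTIONS --safe #-}
module Submission where

-- Enumerate all codes of null sets in order type 𝔠 and pick x_t outside the
-- t-th null set and outside the null sets of those x for which the strong law
-- of large numbers fails along some member of the field generated by the earlier
-- choices.  There are fewer than 𝔠 sets to avoid, so cov(𝒩) = 𝔠 provides x_t, and
-- x_t splits every member of that field in half; hence {x_t} is d-independent.
-- By Zorn's lemma it extends to a maximal d-independent 𝒜, which has cardinality
-- 𝔠 and is not null.  But a measurable d-independent family is null: approximate
-- it by a clopen set C and flip a coordinate on which C does not depend.  A set A
-- and its flip never both belong to 𝒜, since d(A)² ≠ d(A), so 𝒜 is contained in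
-- the error of the approximation together with the flip of that error.

open import Defs
open import Level using (Level; 0ℓ)
open import Data.Bool using (Bool; true; false; _∧_; _∨_; not; if_then_else_)
open import Data.Bool.Properties using (∨-zeroʳ; ¬-not)
open import Data.Empty using (⊥; ⊥-elim)
open import Data.Fin using (Fin; fromℕ<; combine)
open import Data.Fin.Properties using (combine-injective; fromℕ<-injective; ℕ→Fin-notInjective)
open import Data.List using (List; []; _∷_; _++_; map; foldr; length; replicate)
import Data.List.Properties as List
open import Data.Maybe using (Maybe; just; nothing)
open import Data.Nat as ℕ using (ℕ; zero; suc)
import Data.Nat.Induction as ℕ
import Data.Nat.Properties as ℕ
open import Data.Product using (∃; _×_; _,_; proj₁; proj₂)
import Data.Product as Product
open import Data.Product.Relation.Binary.Lex.Strict using (×-Lex; ×-wellFounded)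
open import Data.Sum using (_⊎_; inj₁; inj₂; [_,_]′)
import Data.Sum as Sum
open import Data.Sum.Relation.Binary.LeftOrder using (_⊎-<_; ₁∼₁; ₁∼₂; ₂∼₂; ⊎-<-wellFounded; ⊎-<-transitive)
open import Data.Unit using (⊤; tt)
open import Function using (_∘_; id)
open import Function.Bundles using (Injection)
open import Function.Definitions using (Injective)
open import Induction.WellFounded using (WellFounded; Acc; acc)
open import Relation.Binary.Definitions using (tri<; tri≈; tri>)
import Relation.Binary.Construct.On as On
open import Relation.Binary.PropositionalEquality
  using (_≡_; _≢_; refl; sym; trans; cong; cong₂; subst; subst₂; module ≡-Reasoning)
open import Relation.Nullary using (¬_; Dec; yes; no; does; recompute)
open import Relation.Nullary.Decidable using (dec-true)
open import Relation.Unary using (Pred; _∈_; _∉_; _⊆_; _≐_; _∪_; _∖_; ∁; ⋃; Satisfiable)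

-- Stages of transfinite constructions

-- The hypothesis on cov(𝒩) provides injections only, so "fewer than 𝔠 sets" has to mean that 2^ω
-- does not inject into their index set. The field generated by the choices before t is indexed by
-- finite programs over ℕ and the segment below t. Hence 2^ω needs a well-order whose segments stay
-- too small even after finite lists over them are formed, and the arithmetic of squares of infinite
-- well-ordered sets is there to supply it. Halving the whole field, and not just the earlier
-- choices, is the condition that survives the adjunction of x: a set of the enlarged field is one
-- old set on x and another off x. The strong law rests on fourth moments, because second moments
-- bound the n-th bad event only by a multiple of 1/n, which does not sum. A single tower of stages,
-- in the manner of Zermelo, yields both the well-ordering theorem and the maximal family.
-- Measurability is handled through outer measure and averages over finitely many coordinates.

private
  variable
    ℓ ℓ′ : Level

module Logic (classical : Classical) where
  open Classical classical

  em : (P : Set ℓ) → Dec P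
  em P = excludedMiddle {P = P}

  ¬¬-elim : {P : Set ℓ} → ¬ ¬ P → P
  ¬¬-elim {P = P} ¬¬p with em P
  ... | yes p = p
  ... | no ¬p = ⊥-elim (¬¬p ¬p)

  ¬∀⇒∃¬ : {A : Set ℓ} {P : A → Set ℓ′} → ¬ (∀ x → P x) → ∃ λ x → ¬ P x
  ¬∀⇒∃¬ ¬all = ¬¬-elim λ ¬ex → ¬all λ x → ¬¬-elim λ ¬px → ¬ex (x , ¬px)

  -- Propositions of any level become Booleans, so subsets, families of subsets and their unions all
  -- stay at level 0.
  ⟦_⟧ : Set ℓ → Bool
  ⟦ P ⟧ = does (em P)

  ⟦⟧-intro : {P : Set ℓ} → P → ⟦ P ⟧ ≡ true
  ⟦⟧-intro {P = P} p with em P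
  ... | yes _ = refl
  ... | no ¬p = ⊥-elim (¬p p)

  ⟦⟧-elim : {P : Set ℓ} → ⟦ P ⟧ ≡ true → P
  ⟦⟧-elim {P = P} eq with em P
  ⟦⟧-elim _  | yes p = p
  ⟦⟧-elim () | no _

module Tower (classical : Classical) {X : Set} (pick : (X → Bool) → Maybe X)
  (pick-fresh : ∀ A {x} → pick A ≡ just x → A x ≡ false) where
  open Classical classical using (extensionality)
  open Logic classical

  infix 4 _⊆ᵇ_
  _⊆ᵇ_ : (X → Bool) → (X → Bool) → Set
  A ⊆ᵇ B = ∀ x → A x ≡ true → B x ≡ true

  ⊆ᵇ-antisym : ∀ {A B} → A ⊆ᵇ B → B ⊆ᵇ A → A ≡ B
  ⊆ᵇ-antisym {A} {B} A⊆B B⊆A = extensionality λ x → go x (A x) (B x) refl refl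
    where
    go : ∀ x p q → A x ≡ p → B x ≡ q → A x ≡ B x
    go x true  _     Ax _  = trans Ax (sym (A⊆B x Ax))
    go x false true  _  Bx = trans (B⊆A x Bx) (sym Bx)
    go x false false Ax Bx = trans Ax (sym Bx)

  ⋃ᵇ : ((X → Bool) → Bool) → X → Bool
  ⋃ᵇ 𝒫 x = ⟦ ∃ (λ A → 𝒫 A ≡ true × A x ≡ true) ⟧

  step : (X → Bool) → X → Bool
  step A x = A x ∨ ⟦ pick A ≡ just x ⟧

  -- Zermelo's tower: the least family closed under `step` and arbitrary unions. Unions are not
  -- restricted to chains; that the stages form a chain is the content of `comparable`.
  data Stage : (X → Bool) → Set where
    next : ∀ {A} → Stage A → Stage (step A)
    sup  : ∀ 𝒫 → (∀ A → 𝒫 A ≡ true → Stage A) → Stage (⋃ᵇ 𝒫)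

  ⊆-step : ∀ A → A ⊆ᵇ step A
  ⊆-step A x Ax rewrite Ax = refl

  step-pick : ∀ A x → pick A ≡ just x → step A x ≡ true
  step-pick A x eq rewrite ⟦⟧-intro eq = ∨-zeroʳ (A x)

  step-inv : ∀ A x → step A x ≡ true → A x ≡ true ⊎ pick A ≡ just x
  step-inv A x h with A x
  ... | true  = inj₁ refl
  ... | false = inj₂ (⟦⟧-elim h)

  Comparable : (X → Bool) → Set
  Comparable A = ∀ {B} → Stage B → B ⊆ᵇ A ⊎ A ⊆ᵇ B

  Dichotomy : (X → Bool) → Set
  Dichotomy A = ∀ {B} → Stage B → B ⊆ᵇ A ⊎ step A ⊆ᵇ B

  -- A step adds at most one point, so no stage fits strictly between A and `step A`.
  dichotomy : ∀ {A} → Comparable A → Dichotomy A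
  dichotomy {A} cmp (next {B} sB) with dichotomy cmp sB
  ... | inj₂ sA⊆B = inj₂ λ x h → ⊆-step B x (sA⊆B x h)
  ... | inj₁ B⊆A with cmp (next sB)
  ...   | inj₁ sB⊆A = inj₁ sB⊆A
  ...   | inj₂ A⊆sB with em (∃ λ x → pick B ≡ just x × A x ≡ true)
  -- The one point that `step B` may add to B already lies in A.
  ...     | yes (c , eq , Ac) = inj₁ λ x h → [ B⊆A x , (λ eq′ → subst (λ z → A z ≡ true) (just-inj (trans (sym eq) eq′)) Ac) ]′ (step-inv B x h)
    where
    just-inj : ∀ {x y : X} → just x ≡ just y → x ≡ y
    just-inj refl = refl
  -- Otherwise A is contained in B, so A = B and the two steps coincide.
  ...     | no ¬c = inj₂ λ x h → subst (λ C → step C x ≡ true) (⊆ᵇ-antisym A⊆B B⊆A) h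
    where
    A⊆B : A ⊆ᵇ B
    A⊆B x Ax = [ (λ h → h) , (λ eq → ⊥-elim (¬c (x , eq , Ax))) ]′ (step-inv B x (A⊆sB x Ax))
  dichotomy {A} cmp (sup 𝒫 s) with em (∃ λ B → 𝒫 B ≡ true × step A ⊆ᵇ B)
  ... | yes (B , 𝒫B , sA⊆B) = inj₂ λ x h → ⟦⟧-intro (B , 𝒫B , sA⊆B x h)
  ... | no ¬B = inj₁ λ x h → below x (⟦⟧-elim h)
    where
    below : ∀ x → ∃ (λ B → 𝒫 B ≡ true × B x ≡ true) → A x ≡ true
    below x (B , 𝒫B , Bx) with dichotomy cmp (s B 𝒫B)
    ... | inj₁ B⊆A  = B⊆A x Bx
    ... | inj₂ sA⊆B = ⊥-elim (¬B (B , 𝒫B , sA⊆B))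

  comparable : ∀ {A} → Stage A → Comparable A
  comparable (next {A} sA) sB with dichotomy (comparable sA) sB
  ... | inj₁ B⊆A  = inj₁ λ x h → ⊆-step A x (B⊆A x h)
  ... | inj₂ sA⊆B = inj₂ sA⊆B
  comparable (sup 𝒫 s) {B} sB with em (∃ λ A → 𝒫 A ≡ true × B ⊆ᵇ A)
  ... | yes (A , 𝒫A , B⊆A) = inj₁ λ x h → ⟦⟧-intro (A , 𝒫A , B⊆A x h)
  ... | no ¬A = inj₂ λ x h → below x (⟦⟧-elim h)
    where
    below : ∀ x → ∃ (λ A → 𝒫 A ≡ true × A x ≡ true) → B x ≡ true
    below x (A , 𝒫A , Ax) with comparable (s A 𝒫A) sB
    ... | inj₁ B⊆A = ⊥-elim (¬A (A , 𝒫A , B⊆A))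
    ... | inj₂ A⊆B = A⊆B x Ax

  top : X → Bool
  top = ⋃ᵇ (λ A → ⟦ Stage A ⟧)

  stage-top : Stage top
  stage-top = sup _ λ _ → ⟦⟧-elim

  top-greatest : ∀ {A} → Stage A → A ⊆ᵇ top
  top-greatest sA x Ax = ⟦⟧-intro (_ , ⟦⟧-intro sA , Ax)

  -- The step from `top` would be another stage, hence inside `top`, whereas a picked element is
  -- new.
  pick-top : ∀ x → pick top ≢ just x
  pick-top x eq with trans (sym (pick-fresh top eq)) (top-greatest (next stage-top) x (step-pick top x eq))
  ... | ()

  -- At a union the members may be assumed comparable; this is what makes the unions of independent
  -- families directed.
  stage-induction : (P : (X → Bool) → Set ℓ) →
    (∀ {A} → P A → P (step A)) →
    (∀ 𝒫 → (∀ A → 𝒫 A ≡ true → P A) →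
      (∀ A B → 𝒫 A ≡ true → 𝒫 B ≡ true → A ⊆ᵇ B ⊎ B ⊆ᵇ A) → P (⋃ᵇ 𝒫)) →
    ∀ {A} → Stage A → P A
  stage-induction P onStep onSup (next sA) = onStep (stage-induction P onStep onSup sA)
  stage-induction P onStep onSup (sup 𝒫 s) = onSup 𝒫
    (λ A 𝒫A → stage-induction P onStep onSup (s A 𝒫A))
    (λ A B 𝒫A 𝒫B → comparable (s B 𝒫B) (s A 𝒫A))

-- Well-orderings from the tower

Connex : {X : Set} → (X → X → Set) → Set
Connex _<_ = ∀ x y → x ≢ y → x < y ⊎ y < x

record WellOrder (X : Set) : Set₁ where
  field
    _<_    : X → X → Set
    wf     : WellFounded _<_
    connex : Connex _<_
    <-trans : ∀ {x y z} → x < y → y < z → x < z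

module _ (classical : Classical) where
  open Logic classical

  wellOrdering : (X : Set) → WellOrder X
  wellOrdering X = record
    { _<_ = _<_ ; wf = λ x → accessible stage-top x (full x) ; connex = connex ; <-trans = <-trans }
    where
    pick : (X → Bool) → Maybe X
    pick A with em (∃ λ x → A x ≡ false)
    ... | yes (x , _) = just x
    ... | no _        = nothing

    pick-fresh : ∀ A {x} → pick A ≡ just x → A x ≡ false
    pick-fresh A eq with em (∃ λ x → A x ≡ false)
    pick-fresh A refl | yes (_ , Ax) = Ax

    pick-just : ∀ A x → A x ≡ false → ∃ λ y → pick A ≡ just y
    pick-just A x Ax with em (∃ λ x → A x ≡ false)
    ... | yes (y , _) = y , refl
    ... | no none     = ⊥-elim (none (x , Ax))

    open Tower classical pick pick-fresh

    full : ∀ x → top x ≡ true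
    full x with em (top x ≡ true)
    ... | yes h = h
    ... | no ¬h with pick-just top x (¬-not ¬h)
    ...   | y , eq = ⊥-elim (pick-top y eq)

    -- The order in which the tower picks the elements.
    _<_ : X → X → Set
    x < y = ∃ λ A → Stage A × A x ≡ true × A y ≡ false

    clash : ∀ {p : Bool} → p ≡ true → p ≡ false → ⊥
    clash refl ()

    -- If y < x and x is in `step A`, the stage separating them omits a point of `step A`; it is
    -- therefore contained in A, and y belongs to A.
    accessible : ∀ {A} → Stage A → ∀ x → A x ≡ true → Acc _<_ x
    accessible (sup 𝒫 s) x h with ⟦⟧-elim {P = ∃ (λ A → 𝒫 A ≡ true × A x ≡ true)} h
    ... | A , 𝒫A , Ax = accessible (s A 𝒫A) x Ax
    accessible (next {A} sA) x h = acc below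
      where
      below : ∀ {y} → y < x → Acc _<_ y
      below {y} (B , sB , By , Bx) with dichotomy (comparable sA) sB
      ... | inj₁ B⊆A  = accessible sA y (B⊆A y By)
      ... | inj₂ sA⊆B = ⊥-elim (clash (sA⊆B x h) Bx)

    <-trans : ∀ {x y z} → x < y → y < z → x < z
    <-trans {x} {y} {z} (A , sA , Ax , Ay) (B , sB , By , Bz) with comparable sA sB
    ... | inj₁ B⊆A = ⊥-elim (clash (B⊆A y By) Ay)
    ... | inj₂ A⊆B = B , sB , A⊆B x Ax , Bz

    before : X → X → Bool
    before x = ⋃ᵇ (λ A → ⟦ Stage A × A x ≡ false ⟧)

    stage-before : ∀ x → Stage (before x)
    stage-before x = sup _ λ A h → proj₁ (⟦⟧-elim {P = Stage A × A x ≡ false} h)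

    before-misses : ∀ x → before x x ≡ false
    before-misses x = ¬-not λ h → miss (⟦⟧-elim h)
      where
      miss : ¬ ∃ λ A → ⟦ Stage A × A x ≡ false ⟧ ≡ true × A x ≡ true
      miss (A , h , Ax) = clash Ax (proj₂ (⟦⟧-elim {P = Stage A × A x ≡ false} h))

    before-greatest : ∀ {A} x → Stage A → A x ≡ false → A ⊆ᵇ before x
    before-greatest x sA Ax y Ay = ⟦⟧-intro (_ , ⟦⟧-intro (sA , Ax) , Ay)

    -- `before x` is the largest stage without x. Its step is strictly larger, so it contains x, and
    -- the only new point is the picked one.
    pick-before : ∀ x → pick (before x) ≡ just x
    pick-before x with pick-just (before x) x (before-misses x)
    ... | c , eq with em (step (before x) x ≡ true)
    ...   | yes h = [ (λ h′ → ⊥-elim (clash h′ (before-misses x))) , (λ h′ → h′) ]′ (step-inv (before x) x h)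
    ...   | no ¬h = ⊥-elim (clash
            (before-greatest x (next (stage-before x)) (¬-not ¬h) c (step-pick (before x) c eq))
            (pick-fresh (before x) eq))

    -- `pick` recovers x from `before x`, so distinct elements have distinct stages `before`, and
    -- comparing the stages compares the elements.
    connex : Connex _<_
    connex x y x≢y with dichotomy (comparable (stage-before x)) (stage-before y)
    ... | inj₂ s⊆ = inj₁ (before y , stage-before y , s⊆ x (step-pick (before x) x (pick-before x)) , before-misses y)
    ... | inj₁ y⊆x with dichotomy (comparable (stage-before y)) (stage-before x)
    ...   | inj₂ s⊆ = inj₂ (before x , stage-before x , s⊆ y (step-pick (before y) y (pick-before y)) , before-misses x)
    ...   | inj₁ x⊆y with trans (sym (pick-before x)) (trans (cong pick (⊆ᵇ-antisym x⊆y y⊆x)) (pick-before y))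
    ...     | refl = ⊥-elim (x≢y refl)

-- Cardinality

private
  variable
    A B A′ B′ : Set

infix 4 _≼_
_≼_ : Set → Set → Set
A ≼ B = ∃ λ (f : A → B) → Injective _≡_ _≡_ f

≼-refl : A ≼ A
≼-refl = id , id

≼-trans : A ≼ B → B ≼ A′ → A ≼ A′
≼-trans (f , f-inj) (g , g-inj) = g ∘ f , f-inj ∘ g-inj

infixr 6 _≼-×_ _≼-⊎_
_≼-×_ : A ≼ B → A′ ≼ B′ → (A × A′) ≼ (B × B′)
(f , f-inj) ≼-× (g , g-inj) = Product.map f g ,
  λ eq → cong₂ _,_ (f-inj (cong proj₁ eq)) (g-inj (cong proj₂ eq))

_≼-⊎_ : A ≼ B → A′ ≼ B′ → (A ⊎ A′) ≼ (B ⊎ B′)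
_≼-⊎_ {A} {B} {A′} {B′} (f , f-inj) (g , g-inj) = Sum.map f g , inj
  where
  inj : Injective _≡_ _≡_ (Sum.map f g)
  inj {inj₁ _} {inj₁ _} eq = cong inj₁ (f-inj (drop eq))
    where
    drop : ∀ {x y : B} → inj₁ {B = B′} x ≡ inj₁ y → x ≡ y
    drop refl = refl
  inj {inj₂ _} {inj₂ _} eq = cong inj₂ (g-inj (drop eq))
    where
    drop : ∀ {x y : B′} → inj₂ {A = B} x ≡ inj₂ y → x ≡ y
    drop refl = refl

≼-List : A ≼ B → List A ≼ List B
≼-List (f , f-inj) = map f , List.map-injective f-inj

-- The membership proof is irrelevant, so that members are equal as soon as
-- their values are.
record El {X : Set} (P : X → Set) : Set where
  constructor el
  field
    val  : X
    .prf : P val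
open El public using (val)

el-≡ : {X : Set} {P : X → Set} {u v : El P} → val u ≡ val v → u ≡ v
el-≡ {u = el _ _} {v = el _ _} refl = refl

module Cardinals (classical : Classical) where
  open Logic classical
  open Classical classical using (extensionality)

  -- Excluded middle decides P, which recovers the erased membership proof.
  member : {X : Set} {P : X → Set} (u : El P) → P (val u)
  member {P = P} (el x p) = recompute (em (P x)) p

  El-mono : {X : Set} {P Q : X → Set} → (∀ x → P x → Q x) → El P ≼ El Q
  El-mono P⇒Q = (λ u → el (val u) (P⇒Q _ (member u))) , λ eq → el-≡ (cong val eq)

  transfinite : {W A : Set} {_<_ : W → W → Set} → WellFounded _<_ →
    (Φ : ∀ w → (El (_< w) → A) → A → Set) → (∀ w g → ∃ (Φ w g)) →
    ∃ λ (f : W → A) → ∀ w → Φ w (f ∘ val) (f w)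
  transfinite {W} {A} {_<_} wf Φ choice = (λ w → rec w (wf w)) , λ w → spec w (wf w)
    where
    rec : ∀ w → Acc _<_ w → A
    rec w (acc rs) = proj₁ (choice w (λ u → rec (val u) (rs (member u))))
    -- Values do not depend on the accessibility proof, so the earlier values that `rec` consults
    -- are those of the resulting function.
    rec-irr : ∀ w (p q : Acc _<_ w) → rec w p ≡ rec w q
    rec-irr w (acc rs) (acc rs′) = cong (λ g → proj₁ (choice w g))
      (extensionality λ u → rec-irr (val u) (rs (member u)) (rs′ (member u)))
    spec : ∀ w (p : Acc _<_ w) → Φ w (λ u → rec (val u) (wf (val u))) (rec w p)
    spec w (acc rs) = subst (λ g → Φ w g (rec w (acc rs)))
      (extensionality λ u → rec-irr (val u) (rs (member u)) (wf (val u))) (proj₂ (choice w _))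

  -- A value different from all earlier ones fails to exist only if the values
  -- before w exhaust A.
  small-segments⇒≼ : {W A : Set} {_<_ : W → W → Set} → WellFounded _<_ → Connex _<_ →
    (∀ w → ¬ A ≼ El (_< w)) → W ≼ A
  small-segments⇒≼ {W} {A} {_<_} wf connex small = f , inj
    where
    Fresh : ∀ w → (El (_< w) → A) → A → Set
    Fresh w g a = ∀ u → g u ≢ a

    fresh : ∀ w g → ∃ (Fresh w g)
    fresh w g = ¬¬-elim λ stuck →
      let hit : ∀ a → ∃ λ u → g u ≡ a
          hit a = ¬¬-elim λ none → stuck (a , λ u eq → none (u , eq))
      in small w (proj₁ ∘ hit , λ {a} {b} eq →
           trans (sym (proj₂ (hit a))) (trans (cong g eq) (proj₂ (hit b))))

    recursion : ∃ λ (f : W → A) → ∀ w → Fresh w (f ∘ val) (f w)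
    recursion = transfinite wf Fresh fresh
    f : W → A
    f = proj₁ recursion

    inj : Injective _≡_ _≡_ f
    inj {v} {w} eq with em (v ≡ w)
    ... | yes v≡w = v≡w
    ... | no v≢w with connex v w v≢w
    ...   | inj₁ v<w = ⊥-elim (proj₂ recursion w (el v v<w) eq)
    ...   | inj₂ w<v = ⊥-elim (proj₂ recursion v (el w w<v) (sym eq))

  -- Squares and lists over infinite well-ordered sets

  ¬ℕ≼Fin² : ∀ n → ¬ ℕ ≼ (Fin n × Fin n)
  ¬ℕ≼Fin² n (f , f-inj) = ℕ→Fin-notInjective (λ k → combine (proj₁ (f k)) (proj₂ (f k)))
    λ {k} {l} eq → let i≡ , j≡ = combine-injective _ _ (proj₁ (f l)) _ eq in f-inj (cong₂ _,_ i≡ j≡)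

  -- Gödel's proof that an infinite well-ordered set K has K × K ≼ K, with ℕ
  -- added at the bottom so that finite segments need no separate treatment.
  module Squares {X : Set} (wo : WellOrder X) where
    open WellOrder wo

    Y : Set
    Y = ℕ ⊎ X

    _<Y_ : Y → Y → Set
    _<Y_ = ℕ._<_ ⊎-< _<_

    <Y-wf : WellFounded _<Y_
    <Y-wf = ⊎-<-wellFounded ℕ.<-wellFounded wf

    <Y-trans : ∀ {x y z} → x <Y y → y <Y z → x <Y z
    <Y-trans = ⊎-<-transitive ℕ.<-trans <-trans

    <Y-connex : Connex _<Y_
    <Y-connex (inj₁ m) (inj₁ n) ≢ with ℕ.<-cmp m n
    ... | tri< m<n _ _ = inj₁ (₁∼₁ m<n)
    ... | tri≈ _ refl _ = ⊥-elim (≢ refl)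
    ... | tri> _ _ n<m = inj₂ (₁∼₁ n<m)
    <Y-connex (inj₁ m) (inj₂ y) _ = inj₁ ₁∼₂
    <Y-connex (inj₂ x) (inj₁ n) _ = inj₂ ₁∼₂
    <Y-connex (inj₂ x) (inj₂ y) ≢ = Sum.map ₂∼₂ ₂∼₂ (connex x y (≢ ∘ cong inj₂))

    K : X → Set
    K α = ℕ ⊎ El (_< α)

    _≤Y_ : Y → Y → Set
    x ≤Y y = x <Y y ⊎ x ≡ y

    ≤Y-trans : ∀ {x y z} → x ≤Y y → y ≤Y z → x ≤Y z
    ≤Y-trans (inj₁ x<y) (inj₁ y<z) = inj₁ (<Y-trans x<y y<z)
    ≤Y-trans (inj₁ x<y) (inj₂ refl) = inj₁ x<y
    ≤Y-trans (inj₂ refl) y≤z = y≤z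

    max : Y → Y → Y
    max x y with em (x <Y y)
    ... | yes _ = y
    ... | no _  = x

    ≤maxˡ : ∀ x y → x ≤Y max x y
    ≤maxˡ x y with em (x <Y y)
    ... | yes x<y = inj₁ x<y
    ... | no _    = inj₂ refl

    ≤maxʳ : ∀ x y → y ≤Y max x y
    ≤maxʳ x y with em (x <Y y)
    ... | yes _ = inj₂ refl
    ... | no x≮y with em (x ≡ y)
    ...   | yes refl = inj₂ refl
    ...   | no x≢y with <Y-connex x y x≢y
    ...     | inj₁ x<y = ⊥-elim (x≮y x<y)
    ...     | inj₂ y<x = inj₁ y<x

    max∈ : ∀ x y → max x y ≡ x ⊎ max x y ≡ y
    max∈ x y with em (x <Y y)
    ... | yes _ = inj₂ refl
    ... | no _  = inj₁ refl

    -- Gödel's order, applied to the triples (max u v, u, v). The maximum is compared first, so all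
    -- pairs preceding (u, v) lie in the square of `Below (max u v)`.
    _<G_ : Y × (Y × Y) → Y × (Y × Y) → Set
    _<G_ = ×-Lex _≡_ _<Y_ (×-Lex _≡_ _<Y_ _<Y_)

    <G-connex : Connex _<G_
    <G-connex (m , u , v) (m′ , u′ , v′) ≢ with em (m ≡ m′)
    ... | no m≢ = Sum.map inj₁ inj₁ (<Y-connex m m′ m≢)
    ... | yes refl with em (u ≡ u′)
    ...   | no u≢ = Sum.map (λ lt → inj₂ (refl , inj₁ lt)) (λ lt → inj₂ (refl , inj₁ lt)) (<Y-connex u u′ u≢)
    ...   | yes refl = Sum.map (λ lt → inj₂ (refl , inj₂ (refl , lt))) (λ lt → inj₂ (refl , inj₂ (refl , lt)))
                         (<Y-connex v v′ λ { refl → ≢ refl })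

    ι : ∀ {α} → K α → Y
    ι = Sum.map₂ val

    ι-inj : ∀ {α} → Injective _≡_ _≡_ (ι {α})
    ι-inj {α} = proj₂ (_≼-⊎_ {A = ℕ} ≼-refl (val , el-≡))

    Below : Y → Set
    Below m = El (_≤Y m)

    Below-ℕ : ∀ n → Below (inj₁ n) ≼ Fin (suc n)
    Below-ℕ n = (λ u → fromℕ< (index<′ u)) , λ {u} {v} eq → el-≡
        (trans (index-spec u) (trans (cong inj₁ (fromℕ<-injective _ _ (index<′ u) (index<′ v) eq)) (sym (index-spec v))))
      where
      number : ∀ y → y ≤Y inj₁ n → ∃ λ k → y ≡ inj₁ k × k ℕ.< suc n
      number (inj₁ k) (inj₁ (₁∼₁ k<n)) = k , refl , ℕ.m≤n⇒m≤1+n k<n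
      number (inj₁ k) (inj₂ refl)      = k , refl , ℕ.≤-refl
      index : (u : Below (inj₁ n)) → ∃ λ k → val u ≡ inj₁ k × k ℕ.< suc n
      index u = number (val u) (member u)
      index<′ : (u : Below (inj₁ n)) → proj₁ (index u) ℕ.< suc n
      index<′ u = proj₂ (proj₂ (index u))
      index-spec : (u : Below (inj₁ n)) → val u ≡ inj₁ (proj₁ (index u))
      index-spec u = proj₁ (proj₂ (index u))

    -- Hilbert's hotel: the natural numbers move up by one and β takes the place 0.
    Below-X : ∀ β → Below (inj₂ β) ≼ K β
    Below-X β = (λ u → shift (val u) (member u)) , λ {u} {v} eq → el-≡ (shift-inj _ _ (member u) (member v) eq)
      where
      shift : ∀ y → y ≤Y inj₂ β → K β
      shift (inj₁ n) _              = inj₁ (suc n)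
      shift (inj₂ γ) (inj₁ (₂∼₂ γ<β)) = inj₂ (el γ γ<β)
      shift (inj₂ γ) (inj₂ _)       = inj₁ 0
      shift-inj : ∀ y z p q → shift y p ≡ shift z q → y ≡ z
      shift-inj (inj₁ m) (inj₁ n) p q refl = refl
      shift-inj (inj₂ γ) (inj₂ δ) (inj₁ (₂∼₂ _)) (inj₁ (₂∼₂ _)) refl = refl
      shift-inj (inj₂ γ) (inj₂ δ) (inj₂ refl) (inj₂ refl) _ = refl
      shift-inj (inj₁ m) (inj₂ γ) p (inj₁ (₂∼₂ _)) ()
      shift-inj (inj₁ m) (inj₂ γ) p (inj₂ _) ()
      shift-inj (inj₂ γ) (inj₁ n) (inj₁ (₂∼₂ _)) q ()
      shift-inj (inj₂ γ) (inj₁ n) (inj₂ _) q ()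
      shift-inj (inj₂ γ) (inj₂ δ) (inj₁ (₂∼₂ _)) (inj₂ _) ()
      shift-inj (inj₂ γ) (inj₂ δ) (inj₂ _) (inj₁ (₂∼₂ _)) ()

    -- Induction on α. Either `K α` injects into an earlier `K β` and inherits its square, or no
    -- segment of the Gödel order on pairs can receive `K α`, and then the pairs are placed one
    -- after another in `K α`.
    square : ∀ α → (K α × K α) ≼ K α
    square α = go α (wf α)
      where
      go : ∀ α → Acc _<_ α → (K α × K α) ≼ K α
      go α (acc rs) with em (∃ λ β → β < α × K α ≼ K β)
      ... | yes (β , β<α , Kα≼Kβ) =
        ≼-trans (Kα≼Kβ ≼-× Kα≼Kβ) (≼-trans (go β (rs β<α))
          (≼-refl {ℕ} ≼-⊎ El-mono λ γ γ<β → <-trans γ<β β<α))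
      ... | no initial = small-segments⇒≼ {_<_ = λ p q → key p <G key q}
        (On.wellFounded key (×-wellFounded <Y-wf (×-wellFounded <Y-wf <Y-wf)))
        (λ p q p≢q → <G-connex (key p) (key q) (p≢q ∘ key-inj))
        small
        where
        top : K α × K α → Y
        top (u , v) = max (ι u) (ι v)

        key : K α × K α → Y × (Y × Y)
        key (u , v) = max (ι u) (ι v) , ι u , ι v

        key-inj : ∀ {p q} → key p ≡ key q → p ≡ q
        key-inj eq = cong₂ _,_ (ι-inj (cong (proj₁ ∘ proj₂) eq)) (ι-inj (cong (proj₂ ∘ proj₂) eq))

        top-mono : ∀ p q → key p <G key q → top p ≤Y top q
        top-mono p q (inj₁ lt)       = inj₁ lt
        top-mono p q (inj₂ (eq , _)) = inj₂ eq

        segment : ∀ q → El (λ p → key p <G key q) ≼ (Below (top q) × Below (top q))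
        segment q =
          (λ p → el (ι (proj₁ (val p))) (≤Y-trans (≤maxˡ _ _) (top-mono (val p) q (member p))) ,
                 el (ι (proj₂ (val p))) (≤Y-trans (≤maxʳ (ι (proj₁ (val p))) _) (top-mono (val p) q (member p)))) ,
          λ eq → el-≡ (cong₂ _,_ (ι-inj (cong (val ∘ proj₁) eq)) (ι-inj (cong (val ∘ proj₂) eq)))

        -- A finite square cannot hold ℕ. A square below β < α injects into `K β` by the induction
        -- hypothesis, which `initial` forbids.
        bounded : ∀ m → (∀ {β} → m ≡ inj₂ β → β < α) → ¬ K α ≼ (Below m × Below m)
        bounded (inj₁ n) _ Kα≼ = ¬ℕ≼Fin² (suc n)
          (≼-trans (inj₁ , λ { refl → refl }) (≼-trans Kα≼ (Below-ℕ n ≼-× Below-ℕ n)))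
        bounded (inj₂ β) m< Kα≼ = initial (β , m< refl ,
          ≼-trans Kα≼ (≼-trans (Below-X β ≼-× Below-X β) (go β (rs (m< refl)))))

        ι< : ∀ (u : K α) {β} → ι u ≡ inj₂ β → β < α
        ι< (inj₂ u) refl = member u

        small : ∀ q → ¬ K α ≼ El (λ p → key p <G key q)
        small q@(u , v) Kα≼ = bounded (top q)
          (λ eq → [ (λ eq′ → ι< u (trans (sym eq′) eq)) , (λ eq′ → ι< v (trans (sym eq′) eq)) ]′ (max∈ (ι u) (ι v)))
          (≼-trans Kα≼ (segment q))

    ℕ⊎K≼K : ∀ α → (ℕ ⊎ K α) ≼ K α
    ℕ⊎K≼K α = ≼-trans (tag , λ {x} {y} → tag-inj {x} {y}) (square α)
      where
      tag : ℕ ⊎ K α → K α × K α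
      tag (inj₁ n) = inj₁ 0 , inj₁ n
      tag (inj₂ u) = inj₁ 1 , u
      tag-inj : Injective _≡_ _≡_ tag
      tag-inj {inj₁ _} {inj₁ _} refl = refl
      tag-inj {inj₂ _} {inj₂ _} refl = refl

    -- The length is stored beside the iterated pairing, since the code of `[]` may also be the
    -- pairing code of a nonempty list.
    List≼K : ∀ α → List (K α) ≼ K α
    List≼K α = ≼-trans (code , code-inj) (square α)
      where
      ⟪_⟫ : K α × K α → K α
      ⟪_⟫ = proj₁ (square α)
      enc : List (K α) → K α
      enc []      = inj₁ 0
      enc (u ∷ l) = ⟪ u , enc l ⟫
      code : List (K α) → K α × K α
      code l = inj₁ (length l) , enc l
      enc-inj : ∀ k l → length k ≡ length l → enc k ≡ enc l → k ≡ l
      enc-inj []      []      _ _ = refl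
      enc-inj (u ∷ k) (v ∷ l) len eq with proj₂ (square α) eq
      ... | eq′ = cong₂ _∷_ (cong proj₁ eq′) (enc-inj k l (ℕ.suc-injective len) (cong proj₂ eq′))
      code-inj : Injective _≡_ _≡_ code
      code-inj {k} {l} eq = enc-inj k l (inj₁-inj (cong proj₁ eq)) (cong proj₂ eq)
        where
        inj₁-inj : ∀ {m n} → inj₁ {B = El (_< α)} m ≡ inj₁ n → m ≡ n
        inj₁-inj refl = refl

  private
    -- Over the one-point order `K tt` amounts to ℕ, which makes the codings of pairs and lists of
    -- natural numbers instances of the general ones.
    trivial : WellOrder ⊤
    trivial = record { _<_ = λ _ _ → ⊥ ; wf = λ _ → acc λ () ; connex = λ _ _ ≢ → ⊥-elim (≢ refl) ; <-trans = λ () }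

    K⊤≼ℕ : Squares.K trivial tt ≼ ℕ
    K⊤≼ℕ = [ id , (λ u → ⊥-elim (member u)) ]′ , λ {x} {y} → inj {x} {y}
      where
      inj : Injective _≡_ _≡_ [ id , (λ u → ⊥-elim (member u)) ]′
      inj {inj₁ _} {inj₁ _} refl = refl
      inj {inj₂ u} _ = ⊥-elim (member u)
      inj {inj₁ _} {inj₂ u} _ = ⊥-elim (member u)

    ℕ≼K⊤ : ℕ ≼ Squares.K trivial tt
    ℕ≼K⊤ = inj₁ , λ { refl → refl }

  ℕ×ℕ≼ℕ : (ℕ × ℕ) ≼ ℕ
  ℕ×ℕ≼ℕ = ≼-trans (ℕ≼K⊤ ≼-× ℕ≼K⊤) (≼-trans (Squares.square trivial tt) K⊤≼ℕ)

  List≼ℕ : A ≼ ℕ → List A ≼ ℕ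
  List≼ℕ A≼ℕ = ≼-trans (≼-List (≼-trans A≼ℕ ℕ≼K⊤)) (≼-trans (Squares.List≼K trivial tt) K⊤≼ℕ)

  -- Well-orders with small initial segments

  minimal : {W : Set} {_<_ : W → W → Set} → WellFounded _<_ → (P : W → Set) → ∃ P →
    ∃ λ w → P w × (∀ v → v < w → ¬ P v)
  minimal {_<_ = _<_} wf P (w , p) = go w (wf w) p
    where
    go : ∀ w → Acc _<_ w → P w → ∃ λ w → P w × (∀ v → v < w → ¬ P v)
    go w (acc rs) p with em (∃ λ v → v < w × P v)
    ... | yes (v , v<w , pv) = go v (rs v<w) pv
    ... | no none = w , p , λ v v<w pv → none (v , v<w , pv)

  -- If some `K β` receives X, take the least such β and pull the order of `Y` back along the
  -- embedding: each segment then sits in some `K γ` with γ < β, which does not receive X, and lists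
  -- over it still fit into `K γ`. If no `K β` receives X, the original well-order has the property.
  initialWellOrder : (X : Set) → ¬ X ≼ ℕ → ∃ λ (wo : WellOrder X) →
    let open WellOrder wo in ∀ x → ¬ X ≼ List (ℕ ⊎ El (_< x))
  initialWellOrder X X⋠ℕ with em (∃ λ β → X ≼ K β)
    where open Squares (wellOrdering classical X)
  ... | no none = wo , λ x X≼ → none (x , ≼-trans X≼ (List≼K x))
    where
    wo = wellOrdering classical X
    open Squares wo
  ... | yes ex = wo′ , small
    where
    wo = wellOrdering classical X
    open WellOrder wo using (_<_; wf)
    open Squares wo
    least = minimal wf (λ β → X ≼ K β) ex
    β = proj₁ least
    f : X → Y
    f = ι ∘ proj₁ (proj₁ (proj₂ least))
    f-inj : Injective _≡_ _≡_ f
    f-inj = proj₂ (proj₁ (proj₂ least)) ∘ ι-inj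
    X⋠ : ∀ γ → γ < β → ¬ X ≼ K γ
    X⋠ = proj₂ (proj₂ least)

    wo′ : WellOrder X
    wo′ = record
      { _<_ = λ x y → f x <Y f y
      ; wf = On.wellFounded f <Y-wf
      ; connex = λ x y x≢y → <Y-connex (f x) (f y) (x≢y ∘ f-inj)
      ; <-trans = <Y-trans
      }

    -- Points that f sends into ℕ have finite segments, and these too must be placed in some `K γ`
    -- with γ < β. If nothing were below β, then `K β` would be ℕ and X countable.
    γ₀ : ∃ λ γ → γ < β
    γ₀ = ¬¬-elim λ none → X⋠ℕ (≼-trans (proj₁ (proj₂ least)) (bottom none))
      where
      bottom : ¬ ∃ (λ γ → γ < β) → K β ≼ ℕ
      bottom none = [ id , (λ u → ⊥-elim (none (val u , member u))) ]′ , λ {x} {y} → inj {x} {y}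
        where
        inj : Injective _≡_ _≡_ [ id , (λ u → ⊥-elim (none (val u , member u))) ]′
        inj {inj₁ _} {inj₁ _} refl = refl
        inj {inj₂ u} _ = ⊥-elim (none (val u , member u))
        inj {inj₁ _} {inj₂ u} _ = ⊥-elim (none (val u , member u))

    below : ∀ y γ → (∀ z → z <Y y → (∃ λ n → z ≡ inj₁ n) ⊎ ∃ λ δ → z ≡ inj₂ δ × δ < γ) →
      El (λ x → f x <Y y) ≼ K γ
    below y γ split = (λ u → proj₁ (image (f (val u)) (member u))) ,
      λ {u} {v} eq → el-≡ (f-inj (trans (sym (proj₂ (image _ (member u)))) (trans (cong ι eq) (proj₂ (image _ (member v))))))
      where
      image : ∀ z → z <Y y → ∃ λ (k : K γ) → ι k ≡ z
      image z z<y with split z z<y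
      ... | inj₁ (n , refl)       = inj₁ n , refl
      ... | inj₂ (δ , refl , δ<γ) = inj₂ (el δ δ<γ) , refl

    segment : ∀ y → (∀ {γ} → y ≡ inj₂ γ → γ < β) → ∃ λ γ → γ < β × El (λ x → f x <Y y) ≼ K γ
    segment (inj₁ n) _ = proj₁ γ₀ , proj₂ γ₀ , below (inj₁ n) _ λ { (inj₁ m) (₁∼₁ _) → inj₁ (m , refl) }
    segment (inj₂ γ) h = γ , h refl , below (inj₂ γ) γ λ
      { (inj₁ m) _        → inj₁ (m , refl)
      ; (inj₂ δ) (₂∼₂ lt) → inj₂ (δ , refl , lt) }

    f< : ∀ x {γ} → f x ≡ inj₂ γ → γ < β
    f< x eq with proj₁ (proj₁ (proj₂ least)) x
    f< x refl | inj₂ u = member u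

    small : ∀ x → ¬ X ≼ List (ℕ ⊎ El (λ y → f y <Y f x))
    small x X≼ with segment (f x) (f< x)
    ... | γ , γ<β , seg≼ = X⋠ γ γ<β (≼-trans X≼ (≼-trans
      (≼-List (≼-trans (≼-refl {ℕ} ≼-⊎ seg≼) (ℕ⊎K≼K γ))) (List≼K γ)))

  -- Cantor's theorem, coding by reals, and the Cantor-Bernstein theorem

  cantor : ¬ (ℕ → Bool) ≼ ℕ
  cantor (f , f-inj) = diagonal (em (∃ λ A → f A ≡ f D × A (f D) ≡ false))
    where
    D : ℕ → Bool
    D n = ⟦ ∃ (λ A → f A ≡ n × A n ≡ false) ⟧
    diagonal : Dec (∃ λ A → f A ≡ f D × A (f D) ≡ false) → ⊥
    diagonal (yes (A , eq , h)) with f-inj eq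
    ... | refl with trans (sym (⟦⟧-intro (A , refl , h))) h
    ...   | ()
    diagonal (no none) = none (D , refl , ¬-not λ h → none (⟦⟧-elim h))

  -- A binary function is recovered from its graph, stored as a set of codes of triples.
  graph-≼ : (ℕ → ℕ → ℕ) ≼ (ℕ → Bool)
  graph-≼ = (λ g n → ⟦ ∃ (λ i → ∃ λ j → e (i , e (j , g i j)) ≡ n) ⟧) , λ {g} {h} eq →
    extensionality λ i → extensionality λ j →
      let i′ , j′ , eq′ = ⟦⟧-elim {P = ∃ λ i′ → ∃ λ j′ → e (i′ , e (j′ , h i′ j′)) ≡ e (i , e (j , g i j))}
            (trans (sym (cong (λ G → G (e (i , e (j , g i j)))) eq)) (⟦⟧-intro (i , j , refl)))
          p = proj₂ ℕ×ℕ≼ℕ eq′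
          q = proj₂ ℕ×ℕ≼ℕ (cong proj₂ p)
      in lookup {h = h} (cong proj₁ p) (cong proj₁ q) (cong proj₂ q)
    where
    e : ℕ × ℕ → ℕ
    e = proj₁ ℕ×ℕ≼ℕ
    lookup : ∀ {h : ℕ → ℕ → ℕ} {i i′ j j′ k} → i′ ≡ i → j′ ≡ j → h i′ j′ ≡ k → k ≡ h i j
    lookup refl refl refl = refl

  module CantorBernstein {A B : Set} (f : A → B) (g : B → A)
    (f-inj : Injective _≡_ _≡_ f) (g-inj : Injective _≡_ _≡_ g) where

    -- The points whose backward path under g and f stops in A, outside the range of g. There h
    -- follows f; elsewhere it inverts g.
    data Chain : A → Set where
      start : ∀ {a} → (∀ b → g b ≢ a) → Chain a
      next  : ∀ {a} → Chain a → Chain (g (f a))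

    back : ∀ a → ¬ Chain a → ∃ λ b → g b ≡ a
    back a ¬c = ¬¬-elim λ none → ¬c (start λ b eq → none (b , eq))

    h : A → B
    h a with em (Chain a)
    ... | yes _ = f a
    ... | no ¬c = proj₁ (back a ¬c)

    h-chain : ∀ {a} → Chain a → h a ≡ f a
    h-chain {a} c with em (Chain a)
    ... | yes _ = refl
    ... | no ¬c = ⊥-elim (¬c c)

    h-nochain : ∀ {a} → ¬ Chain a → g (h a) ≡ a
    h-nochain {a} ¬c with em (Chain a)
    ... | yes c  = ⊥-elim (¬c c)
    ... | no ¬c′ = proj₂ (back a ¬c′)

    mixed : ∀ {a a′} → Chain a → ¬ Chain a′ → h a ≢ h a′
    mixed c ¬c eq = ¬c (subst Chain (trans (cong g (trans (sym (h-chain c)) eq)) (h-nochain ¬c)) (next c))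

    h-inj : Injective _≡_ _≡_ h
    h-inj {a} {a′} eq = cases (em (Chain a)) (em (Chain a′))
      where
      cases : Dec (Chain a) → Dec (Chain a′) → a ≡ a′
      cases (yes c) (yes c′) = f-inj (trans (sym (h-chain c)) (trans eq (h-chain c′)))
      cases (no ¬c) (no ¬c′) = trans (sym (h-nochain ¬c)) (trans (cong g eq) (h-nochain ¬c′))
      cases (yes c) (no ¬c′) = ⊥-elim (mixed c ¬c′ eq)
      cases (no ¬c) (yes c′) = ⊥-elim (mixed c′ ¬c (sym eq))

    image : ∀ {a b} → Chain a → a ≡ g b → ∃ λ a′ → h a′ ≡ b
    image (start none) eq = ⊥-elim (none _ (sym eq))
    image (next {a} c) eq = a , trans (h-chain c) (g-inj eq)

    h-surj : ∀ b → ∃ λ a → h a ≡ b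
    h-surj b with em (Chain (g b))
    ... | yes c = image c refl
    ... | no ¬c = g b , g-inj (h-nochain ¬c)

import Data.Integer as ℤ
import Data.Integer.Properties as ℤ
open import Data.List.Relation.Unary.All as All using (All; []; _∷_; reduce)
open import Data.List.Relation.Unary.AllPairs using ([]; _∷_)
open import Data.List.Relation.Unary.Any as Any using (Any; here; there)
import Data.List.Relation.Unary.Any.Properties as Any
open import Data.List.Relation.Unary.Unique.Propositional using (Unique)
open import Data.Nat.Tactic.RingSolver using (solve-∀)
open import Data.Rational hiding (truncate; _⊔_)
import Data.Rational.Properties as ℚ
open import Data.Rational.Solver using (module +-*-Solver)
import Data.Rational.Unnormalised as ℚᵘ
import Data.Rational.Unnormalised.Properties as ℚᵘ

open +-*-Solver using (solve; _:=_; _:+_; _:*_; _:-_; :-_; con)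

-- Rational arithmetic

0≤∸ : ∀ {p q} → p ≤ q → 0ℚ ≤ q - p
0≤∸ {p} {q} p≤q = subst (_≤ q - p) (ℚ.+-inverseʳ p) (ℚ.+-monoˡ-≤ (- p) p≤q)

0<∸ : ∀ {p q} → p < q → 0ℚ < q - p
0<∸ {p} {q} p<q = subst (_< q - p) (ℚ.+-inverseʳ p) (ℚ.+-monoˡ-< (- p) p<q)

0≤+ : ∀ {p q} → 0ℚ ≤ p → 0ℚ ≤ q → 0ℚ ≤ p + q
0≤+ {p} {q} 0≤p 0≤q = subst (_≤ p + q) (ℚ.+-identityˡ 0ℚ) (ℚ.+-mono-≤ 0≤p 0≤q)

0<+ : ∀ {p q} → 0ℚ < p → 0ℚ ≤ q → 0ℚ < p + q
0<+ {p} {q} 0<p 0≤q = subst (_< p + q) (ℚ.+-identityˡ 0ℚ) (ℚ.+-mono-<-≤ 0<p 0≤q)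

0≤* : ∀ {p q} → 0ℚ ≤ p → 0ℚ ≤ q → 0ℚ ≤ p * q
0≤* {p} {q} 0≤p 0≤q = subst (_≤ p * q) (ℚ.*-zeroʳ p) (ℚ.*-monoˡ-≤-nonNeg p {{nonNegative 0≤p}} 0≤q)

0<* : ∀ {p q} → 0ℚ < p → 0ℚ < q → 0ℚ < p * q
0<* {p} {q} 0<p 0<q = subst (_< p * q) (ℚ.*-zeroʳ p) (ℚ.*-monoʳ-<-pos p {{positive 0<p}} 0<q)

0≤1 : 0ℚ ≤ 1ℚ
0≤1 = ℚ.nonNegative⁻¹ 1ℚ

0<½ : 0ℚ < ½
0<½ = ℚ.positive⁻¹ ½

0≤½ : 0ℚ ≤ ½
0≤½ = ℚ.<⇒≤ 0<½

-- Linear arithmetic: p ≤ q is proved by exhibiting q as p + r with r ≥ 0.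
≤-by : ∀ {p q} r → 0ℚ ≤ r → p + r ≡ q → p ≤ q
≤-by {p} {q} r 0≤r eq = subst₂ _≤_ (ℚ.+-identityʳ p) eq (ℚ.+-monoʳ-≤ p 0≤r)

<-by : ∀ {p q} r → 0ℚ < r → p + r ≡ q → p < q
<-by {p} {q} r 0<r eq = subst₂ _<_ (ℚ.+-identityʳ p) eq (ℚ.+-monoʳ-< p 0<r)

halves : ∀ p → ½ * p + ½ * p ≡ p
halves = solve 1 (λ p → con ½ :* p :+ con ½ :* p := p) refl

∣p∣≤ : ∀ {p q} → p ≤ q → - p ≤ q → ∣ p ∣ ≤ q
∣p∣≤ {p} {q} p≤q -p≤q with ℚ.∣p∣≡p∨∣p∣≡-p p
... | inj₁ eq = subst (_≤ q) (sym eq) p≤q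
... | inj₂ eq = subst (_≤ q) (sym eq) -p≤q

p≤∣p∣ : ∀ p → p ≤ ∣ p ∣
p≤∣p∣ p with ℚ.≤-total 0ℚ p
... | inj₁ 0≤p = ℚ.≤-reflexive (sym (ℚ.0≤p⇒∣p∣≡p 0≤p))
... | inj₂ p≤0 = ℚ.≤-trans p≤0 (ℚ.0≤∣p∣ p)

-p≤∣p∣ : ∀ p → - p ≤ ∣ p ∣
-p≤∣p∣ p = subst (- p ≤_) (ℚ.∣-p∣≡∣p∣ p) (p≤∣p∣ (- p))

fromℕ : ℕ → ℚ
fromℕ zero    = 0ℚ
fromℕ (suc n) = 1ℚ + fromℕ n

0≤fromℕ : ∀ n → 0ℚ ≤ fromℕ n
0≤fromℕ zero    = ℚ.≤-refl
0≤fromℕ (suc n) = 0≤+ 0≤1 (0≤fromℕ n)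

fromℕ-+ : ∀ m n → fromℕ (m ℕ.+ n) ≡ fromℕ m + fromℕ n
fromℕ-+ zero    n = sym (ℚ.+-identityˡ (fromℕ n))
fromℕ-+ (suc m) n = trans (cong (1ℚ +_) (fromℕ-+ m n)) (sym (ℚ.+-assoc 1ℚ (fromℕ m) (fromℕ n)))

fromℕ-mono : ∀ {m n} → m ℕ.≤ n → fromℕ m ≤ fromℕ n
fromℕ-mono {n = n} ℕ.z≤n = 0≤fromℕ n
fromℕ-mono (ℕ.s≤s m≤n) = ℚ.+-monoʳ-≤ 1ℚ (fromℕ-mono m≤n)

toℚᵘ-fromℕ : ∀ n → toℚᵘ (fromℕ n) ℚᵘ.≃ ℚᵘ.mkℚᵘ (ℤ.+ n) 0
toℚᵘ-fromℕ zero    = ℚᵘ.≃-refl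
toℚᵘ-fromℕ (suc n) = ℚᵘ.≃-trans (ℚ.toℚᵘ-homo-+ 1ℚ (fromℕ n))
  (ℚᵘ.≃-trans (ℚᵘ.+-congʳ ℚᵘ.1ℚᵘ (toℚᵘ-fromℕ n))
    (ℚᵘ.*≡* (cong (ℤ._* ℤ.+ 1) (trans (cong₂ ℤ._+_ {ℤ.+ 1} refl (ℤ.*-identityʳ (ℤ.+ n))) refl))))

/-fromℕ : ∀ m n → (ℤ.+ m / suc n) * fromℕ (suc n) ≡ fromℕ m
/-fromℕ m n = ℚ.toℚᵘ-injective (ℚᵘ.≃-trans (ℚ.toℚᵘ-homo-* (ℤ.+ m / suc n) (fromℕ (suc n)))
  (ℚᵘ.≃-trans (ℚᵘ.*-cong (ℚ.toℚᵘ-fromℚᵘ (ℚᵘ.mkℚᵘ (ℤ.+ m) n)) (toℚᵘ-fromℕ (suc n)))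
    (ℚᵘ.≃-trans (ℚᵘ.*≡* (trans (ℤ.*-identityʳ _) (cong (ℤ.+ m ℤ.*_) (cong (λ z → ℤ.+ suc z) (sym (ℕ.*-identityʳ n))))))
      (ℚᵘ.≃-sym (toℚᵘ-fromℕ m)))))

abstract
  -- The denominator is at least 1, so the absolute value of the numerator is a bound.
  archimedean : ∀ p → ∃ λ n → p ≤ fromℕ n
  archimedean p@(mkℚ _ _ _) = n , ℚ.toℚᵘ-cancel-≤ (ℚᵘ.≤-respʳ-≃ (ℚᵘ.≃-sym (toℚᵘ-fromℕ n)) (ℚᵘ.*≤* (begin
    ↥ p ℤ.* ℤ.+ 1          ≡⟨ ℤ.*-identityʳ (↥ p) ⟩
    ↥ p                    ≤⟨ i≤∣i∣ (↥ p) ⟩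
    ℤ.+ n                  ≡⟨ sym (ℤ.*-identityʳ (ℤ.+ n)) ⟩
    ℤ.+ n ℤ.* ℤ.+ 1        ≤⟨ ℤ.*-monoˡ-≤-nonNeg (ℤ.+ n) (ℤ.+≤+ (ℕ.s≤s ℕ.z≤n)) ⟩
    ℤ.+ n ℤ.* ↧ p          ∎)))
    where
    open ℤ.≤-Reasoning
    n : ℕ
    n = ℤ.∣ ↥ p ∣
    i≤∣i∣ : ∀ i → i ℤ.≤ ℤ.+ ℤ.∣ i ∣
    i≤∣i∣ (ℤ.+ _)    = ℤ.≤-refl
    i≤∣i∣ ℤ.-[1+ _ ] = ℤ.-≤+

-- Abstract, so that the normalising division on ℚ is never unfolded.
abstract
  inv : ℕ → ℚ
  inv n = ℤ.+ 1 / suc n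

  inv-fromℕ : ∀ n → inv n * fromℕ (suc n) ≡ 1ℚ
  inv-fromℕ n = /-fromℕ 1 n

  0<inv : ∀ n → 0ℚ < inv n
  0<inv n = ℚ.positive⁻¹ (inv n) {{ℚ.normalize-pos 1 (suc n)}}

/≡*inv : ∀ m n → ℤ.+ m / suc n ≡ fromℕ m * inv n
/≡*inv m n = begin
  ℤ.+ m / suc n                               ≡⟨ sym (ℚ.*-identityʳ _) ⟩
  (ℤ.+ m / suc n) * 1ℚ                        ≡⟨ cong ((ℤ.+ m / suc n) *_) (sym (inv-fromℕ n)) ⟩
  (ℤ.+ m / suc n) * (inv n * fromℕ (suc n))   ≡⟨ swap (ℤ.+ m / suc n) (inv n) (fromℕ (suc n)) ⟩
  (ℤ.+ m / suc n) * fromℕ (suc n) * inv n     ≡⟨ cong (_* inv n) (/-fromℕ m n) ⟩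
  fromℕ m * inv n                             ∎
  where
  open ≡-Reasoning
  swap : ∀ x y z → x * (y * z) ≡ x * z * y
  swap = solve 3 (λ x y z → x :* (y :* z) := x :* z :* y) refl

abstract
  inv-anti : ∀ {m n} → m ℕ.≤ n → inv n ≤ inv m
  inv-anti {m} {n} m≤n = ≤-by (inv m * inv n * (fromℕ (suc n) - fromℕ (suc m)))
    (0≤* (0≤* (ℚ.<⇒≤ (0<inv m)) (ℚ.<⇒≤ (0<inv n))) (0≤∸ (fromℕ-mono (ℕ.s≤s m≤n))))
    (trans (expand (inv m) (inv n) (fromℕ (suc m)) (fromℕ (suc n)))
      (trans (cong₂ (λ u v → inv n + inv m * u - inv n * v) (inv-fromℕ n) (inv-fromℕ m)) (close (inv m) (inv n))))
    where
    expand : ∀ a b c d → b + a * b * (d - c) ≡ b + a * (b * d) - b * (a * c)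
    expand = solve 4 (λ a b c d → b :+ a :* b :* (d :- c) := b :+ a :* (b :* d) :- b :* (a :* c)) refl
    close : ∀ a b → b + a * 1ℚ - b * 1ℚ ≡ a
    close = solve 2 (λ a b → b :+ a :* con 1ℚ :- b :* con 1ℚ := a) refl

  reciprocal : ∀ ε → 0ℚ < ε → ∃ λ r → ε * r ≡ 1ℚ
  reciprocal ε 0<ε = (1/ ε) {{ℚ.pos⇒nonZero ε {{positive 0<ε}}}} , ℚ.*-inverseʳ ε {{ℚ.pos⇒nonZero ε {{positive 0<ε}}}}

  inv-small : ∀ K ε → 0ℚ < ε → ∃ λ n → K * inv n < ε
  inv-small K ε 0<ε = let r , εr≡1 = reciprocal ε 0<ε ; n , Kr≤n = archimedean (K * r) in n , bound r n εr≡1 Kr≤n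
    where
    bound : ∀ r n → ε * r ≡ 1ℚ → K * r ≤ fromℕ n → K * inv n < ε
    bound r n εr≡1 Kr≤n = <-by (inv n * (ε * (fromℕ (suc n) - K * r)))
      (0<* (0<inv n) (0<* 0<ε (0<∸ (<-by (1ℚ + (fromℕ n - K * r)) (0<+ (ℚ.positive⁻¹ 1ℚ) (0≤∸ Kr≤n))
        (solve 2 (λ x n → x :+ (con 1ℚ :+ (n :- x)) := con 1ℚ :+ n) refl (K * r) (fromℕ n))))))
      (trans (solve 5 (λ K i e r n → K :* i :+ i :* (e :* (n :- K :* r)) := K :* i :+ e :* (i :* n) :- i :* K :* (e :* r)) refl
                K (inv n) ε r (fromℕ (suc n)))
       (trans (cong₂ (λ u v → K * inv n + ε * u - inv n * K * v) (inv-fromℕ n) εr≡1)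
         (solve 3 (λ K i e → K :* i :+ e :* con 1ℚ :- i :* K :* con 1ℚ := e) refl K (inv n) ε)))

-- Limits of rational sequences

Null : (ℕ → ℚ) → Set
Null z = ∀ ε → 0ℚ < ε → ∃ λ N → ∀ n → N ℕ.≤ n → ∣ z n ∣ < ε

-- The records let Agda infer the sequences from the type.
infix 4 _~_
record _~_ (p q : ℕ → ℚ) : Set where
  constructor mk~
  field
    null : Null (λ n → p n - q n)
open _~_ public

record EventuallyBounded (x : ℕ → ℚ) : Set where
  constructor mkBounded
  field
    bounds : ∃ λ N → ∃ λ B → 0ℚ < B × (∀ n → N ℕ.≤ n → ∣ x n ∣ ≤ B)

record Convergent (x : ℕ → ℚ) : Set where
  constructor mkConvergent
  field
    cauchy : IsCauchy x
open Convergent public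

abstract
  convergent⇒bounded : ∀ {x} → Convergent x → EventuallyBounded x
  convergent⇒bounded {x} c = mkBounded (eventuallyBounded x (cauchy c))

  null-resp : ∀ {y z} → (∀ n → y n ≡ z n) → Null y → Null z
  null-resp eq y→0 ε 0<ε = proj₁ (y→0 ε 0<ε) , λ n N≤n → subst (λ t → ∣ t ∣ < ε) (eq n) (proj₂ (y→0 ε 0<ε) n N≤n)

  null-≤ : ∀ {y z} → (∀ n → ∣ z n ∣ ≤ ∣ y n ∣) → Null y → Null z
  null-≤ z≤y y→0 ε 0<ε = proj₁ (y→0 ε 0<ε) , λ n N≤n → ℚ.≤-<-trans (z≤y n) (proj₂ (y→0 ε 0<ε) n N≤n)

  null-0 : Null (λ _ → 0ℚ)
  null-0 ε 0<ε = 0 , λ _ _ → 0<ε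

  null-+ : ∀ {y z} → Null y → Null z → Null (λ n → y n + z n)
  null-+ {y} {z} y→0 z→0 ε 0<ε with y→0 (½ * ε) (0<* 0<½ 0<ε) | z→0 (½ * ε) (0<* 0<½ 0<ε)
  ... | M , y< | N , z< = M ℕ.⊔ N , λ n le → ℚ.≤-<-trans (ℚ.∣p+q∣≤∣p∣+∣q∣ (y n) (z n))
    (subst (∣ y n ∣ + ∣ z n ∣ <_) (halves ε)
      (ℚ.+-mono-< (y< n (ℕ.m⊔n≤o⇒m≤o M N le)) (z< n (ℕ.m⊔n≤o⇒n≤o M N le))))

  null-neg : ∀ {z} → Null z → Null (λ n → - z n)
  null-neg {z} = null-≤ λ n → ℚ.≤-reflexive (ℚ.∣-p∣≡∣p∣ (z n))

  null-* : ∀ {b z} → EventuallyBounded b → Null z → Null (λ n → b n * z n)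
  null-* {b} {z} (mkBounded (M , B , 0<B , b≤B)) z→0 ε 0<ε = scaled (shrink B B ε 0<B 0<B 0<ε)
    where
    scaled : (∃ λ δ → 0ℚ < δ × B * δ + δ * B ≡ ε) → ∃ λ N → ∀ n → N ℕ.≤ n → ∣ b n * z n ∣ < ε
    scaled (δ , 0<δ , eq) with z→0 δ 0<δ
    ... | N , z< = M ℕ.⊔ N , λ n le → ℚ.≤-<-trans
      (subst (_≤ B * δ) (sym (ℚ.∣p*q∣≡∣p∣*∣q∣ (b n) (z n)))
        (ℚ.≤-trans (ℚ.*-monoʳ-≤-nonNeg ∣ z n ∣ {{ℚ.∣-∣-nonNeg (z n)}} (b≤B n (ℕ.m⊔n≤o⇒m≤o M N le)))
          (ℚ.*-monoˡ-≤-nonNeg B {{nonNegative (ℚ.<⇒≤ 0<B)}} (ℚ.<⇒≤ (z< n (ℕ.m⊔n≤o⇒n≤o M N le))))))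
      (<-by (δ * B) (0<* 0<δ 0<B) eq)

  ~-refl : ∀ {p} → p ~ p
  ~-refl {p} = mk~ (null-resp (λ n → sym (ℚ.+-inverseʳ (p n))) null-0)

  ~-reflexive : ∀ {p q} → (∀ n → p n ≡ q n) → p ~ q
  ~-reflexive {p} {q} eq = mk~ (null-resp (λ n → trans (sym (ℚ.+-inverseʳ (p n))) (cong (λ t → p n - t) (eq n))) null-0)

  ~-sym : ∀ {p q} → p ~ q → q ~ p
  ~-sym {p} {q} h = mk~ (null-resp (λ n → solve 2 (λ p q → :- (p :- q) := q :- p) refl (p n) (q n)) (null-neg (null h)))

  ~-trans : ∀ {p q r} → p ~ q → q ~ r → p ~ r
  ~-trans {p} {q} {r} h k = mk~ (null-resp
    (λ n → solve 3 (λ p q r → (p :- q) :+ (q :- r) := p :- r) refl (p n) (q n) (r n)) (null-+ (null h) (null k)))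

  ~-* : ∀ {p p′ q q′} → EventuallyBounded p′ → EventuallyBounded q → p ~ p′ → q ~ q′ → (λ n → p n * q n) ~ (λ n → p′ n * q′ n)
  ~-* {p} {p′} {q} {q′} b c h k = mk~ (null-resp
    (λ n → solve 4 (λ p p′ q q′ → q :* (p :- p′) :+ p′ :* (q :- q′) := p :* q :- p′ :* q′) refl (p n) (p′ n) (q n) (q′ n))
    (null-+ (null-* c (null h)) (null-* b (null k))))

  const-convergent : ∀ q → Convergent (λ _ → q)
  const-convergent q = mkConvergent (isCauchy (fromℚ q))

  third : ∀ ε → ½ * (½ * ε) + ½ * ε + ½ * (½ * ε) ≡ ε
  third = solve 1 (λ e → con ½ :* (con ½ :* e) :+ con ½ :* e :+ con ½ :* (con ½ :* e) := e) refl

  convergent-resp-~ : ∀ {p q} → p ~ q → Convergent q → Convergent p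
  convergent-resp-~ {p} {q} p~q cq = mkConvergent bound
    where
    bound : IsCauchy p
    bound ε 0<ε with null p~q (½ * (½ * ε)) (0<* 0<½ (0<* 0<½ 0<ε)) | cauchy cq (½ * ε) (0<* 0<½ 0<ε)
    ... | M , p≈q | N , q≈q = M ℕ.⊔ N , λ m n le₁ le₂ → subst₂ _<_
      (cong ∣_∣ (solve 4 (λ a b c d → (a :- c) :+ (c :- d) :+ (:- (b :- d)) := a :- b) refl (p m) (p n) (q m) (q n))) (third ε)
      (ℚ.≤-<-trans (ℚ.≤-trans (ℚ.∣p+q∣≤∣p∣+∣q∣ ((p m - q m) + (q m - q n)) (- (p n - q n)))
          (ℚ.+-monoˡ-≤ ∣ - (p n - q n) ∣ (ℚ.∣p+q∣≤∣p∣+∣q∣ (p m - q m) (q m - q n))))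
        (ℚ.+-mono-< (ℚ.+-mono-< (p≈q m (ℕ.m⊔n≤o⇒m≤o M N le₁)) (q≈q m n (ℕ.m⊔n≤o⇒n≤o M N le₁) (ℕ.m⊔n≤o⇒n≤o M N le₂)))
          (subst (_< ½ * (½ * ε)) (sym (ℚ.∣-p∣≡∣p∣ (p n - q n))) (p≈q n (ℕ.m⊔n≤o⇒m≤o M N le₂)))))

  convergent-+ : ∀ {p q} → Convergent p → Convergent q → Convergent (λ n → p n + q n)
  convergent-+ {p} {q} cp cq = mkConvergent bound
    where
    bound : IsCauchy (λ n → p n + q n)
    bound ε 0<ε with cauchy cp (½ * ε) (0<* 0<½ 0<ε) | cauchy cq (½ * ε) (0<* 0<½ 0<ε)
    ... | M , p≈ | N , q≈ = M ℕ.⊔ N , λ m n le₁ le₂ → subst₂ _<_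
      (cong ∣_∣ (solve 4 (λ a b c d → (a :- b) :+ (c :- d) := (a :+ c) :- (b :+ d)) refl (p m) (p n) (q m) (q n))) (halves ε)
      (ℚ.≤-<-trans (ℚ.∣p+q∣≤∣p∣+∣q∣ (p m - p n) (q m - q n))
        (ℚ.+-mono-< (p≈ m n (ℕ.m⊔n≤o⇒m≤o M N le₁) (ℕ.m⊔n≤o⇒m≤o M N le₂)) (q≈ m n (ℕ.m⊔n≤o⇒n≤o M N le₁) (ℕ.m⊔n≤o⇒n≤o M N le₂))))

  convergent-* : ∀ {p q} → Convergent p → Convergent q → Convergent (λ n → p n * q n)
  convergent-* {p} {q} cp cq = mkConvergent (*-isCauchy p q (cauchy cp) (cauchy cq))

  ∣-∣<⇒ : ∀ p q ε → ∣ p - q ∣ < ε → p - ε < q × q < p + ε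
  ∣-∣<⇒ p q ε h =
    <-by (ε - (p - q)) (0<∸ (ℚ.≤-<-trans (p≤∣p∣ (p - q)) h)) (solve 3 (λ p q e → (p :- e) :+ (e :- (p :- q)) := q) refl p q ε) ,
    <-by (ε - - (p - q)) (0<∸ (ℚ.≤-<-trans (-p≤∣p∣ (p - q)) h)) (solve 3 (λ p q e → q :+ (e :- (:- (p :- q))) := p :+ e) refl p q ε)

  -- A quarter of ε is spent on q against x and a quarter on the Cauchy property of x; the remaining
  -- half is the gap that the strict order of the reals demands.
  ~⇒⟶ : ∀ {q} x → q ~ seq x → q ⟶ x
  ~⇒⟶ {q} x q~x ε 0<ε with null q~x (½ * (½ * ε)) (0<* 0<½ (0<* 0<½ 0<ε)) | isCauchy x (½ * (½ * ε)) (0<* 0<½ (0<* 0<½ 0<ε))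
  ... | M , q≈x | N , x≈x = M ℕ.⊔ N , λ n le →
    let q≈ = ∣-∣<⇒ (q n) (seq x n) δ (q≈x n (ℕ.m⊔n≤o⇒m≤o M N le))
        N≤n = ℕ.m⊔n≤o⇒n≤o M N le
    in (½ * ε , 0<* 0<½ 0<ε , N , λ m N≤m → lower (q n) (seq x n) (seq x m) (proj₁ q≈) (proj₁ (∣-∣<⇒ (seq x n) (seq x m) δ (x≈x n m N≤n N≤m))))
     , (½ * ε , 0<* 0<½ 0<ε , N , λ m N≤m → upper (q n) (seq x n) (seq x m) (proj₂ q≈) (proj₂ (∣-∣<⇒ (seq x n) (seq x m) δ (x≈x n m N≤n N≤m))))
    where
    δ : ℚ
    δ = ½ * (½ * ε)
    lower : ∀ a b c → a - δ < b → b - δ < c → (a - ε) + ½ * ε ≤ c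
    lower a b c h k = ≤-by ((b - (a - δ)) + (c - (b - δ))) (0≤+ (0≤∸ (ℚ.<⇒≤ h)) (0≤∸ (ℚ.<⇒≤ k)))
      (solve 4 (λ a b c e → (a :- e :+ con ½ :* e) :+ ((b :- (a :- con ½ :* (con ½ :* e))) :+ (c :- (b :- con ½ :* (con ½ :* e)))) := c) refl a b c ε)
    upper : ∀ a b c → b < a + δ → c < b + δ → c + ½ * ε ≤ a + ε
    upper a b c h k = ≤-by ((a + δ - b) + (b + δ - c)) (0≤+ (0≤∸ (ℚ.<⇒≤ h)) (0≤∸ (ℚ.<⇒≤ k)))
      (solve 4 (λ a b c e → (c :+ con ½ :* e) :+ ((a :+ con ½ :* (con ½ :* e) :- b) :+ (b :+ con ½ :* (con ½ :* e) :- c)) := a :+ e) refl a b c ε)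

  ⟶⇒~ : ∀ {q} x → q ⟶ x → q ~ seq x
  ⟶⇒~ {q} x q⟶x = mk~ bound
    where
    bound : Null (λ n → q n - seq x n)
    bound ε 0<ε with q⟶x (½ * (½ * ε)) (0<* 0<½ (0<* 0<½ 0<ε)) | isCauchy x (½ * (½ * ε)) (0<* 0<½ (0<* 0<½ 0<ε))
    ... | M , near | N , x≈x = M ℕ.⊔ N , λ n le → close n (near n (ℕ.m⊔n≤o⇒m≤o M N le)) (ℕ.m⊔n≤o⇒n≤o M N le)
      where
      δ : ℚ
      δ = ½ * (½ * ε)
      close : ∀ n → fromℚ (q n - δ) <ℝ x × x <ℝ fromℚ (q n + δ) → N ℕ.≤ n → ∣ q n - seq x n ∣ < ε
      close n ((η , 0<η , K , lo) , (θ , 0<θ , L , hi)) N≤n = ℚ.≤-<-trans (∣p∣≤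
          (≤-by ((xm - (q n - δ + η)) + η + (xn + δ - xm)) (0≤+ (0≤+ (0≤∸ (lo m K≤m)) (ℚ.<⇒≤ 0<η)) (0≤∸ (ℚ.<⇒≤ (proj₂ (∣-∣<⇒ (seq x n) (seq x m) δ (x≈x n m N≤n N≤m))))))
            (solve 5 (λ q m n e h → (q :- n) :+ ((m :- (q :- con ½ :* (con ½ :* e) :+ h)) :+ h :+ (n :+ con ½ :* (con ½ :* e) :- m)) := con ½ :* e) refl (q n) xm xn ε η))
          (≤-by ((q n + δ - (xm + θ)) + θ + (xm - (xn - δ))) (0≤+ (0≤+ (0≤∸ (hi m L≤m)) (ℚ.<⇒≤ 0<θ)) (0≤∸ (ℚ.<⇒≤ (proj₁ (∣-∣<⇒ (seq x n) (seq x m) δ (x≈x n m N≤n N≤m))))))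
            (solve 5 (λ q m n e h → (:- (q :- n)) :+ ((q :+ con ½ :* (con ½ :* e) :- (m :+ h)) :+ h :+ (m :- (n :- con ½ :* (con ½ :* e)))) := con ½ :* e) refl (q n) xm xn ε θ)))
          (<-by (½ * ε) (0<* 0<½ 0<ε) (halves ε))
        where
        -- An index late enough for both strict inequalities and for the Cauchy estimate.
        m : ℕ
        m = K ℕ.⊔ L ℕ.⊔ N
        K≤m : K ℕ.≤ m
        K≤m = ℕ.≤-trans (ℕ.m≤m⊔n K L) (ℕ.m≤m⊔n (K ℕ.⊔ L) N)
        L≤m : L ℕ.≤ m
        L≤m = ℕ.≤-trans (ℕ.m≤n⊔m K L) (ℕ.m≤m⊔n (K ℕ.⊔ L) N)
        N≤m : N ℕ.≤ m
        N≤m = ℕ.m≤n⊔m (K ℕ.⊔ L) N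
        xm xn : ℚ
        xm = seq x m
        xn = seq x n

-- Asymptotic density

bit : Bool → ℕ
bit b = if b then 1 else 0

abstract
  density : 2^ω → ℕ → ℚ
  density A n = ℤ.+ count A (suc n) / suc n

  density-def : ∀ A n → ℤ.+ count A (suc n) / suc n ≡ density A n
  density-def A n = refl

density≡ : ∀ A n → density A n ≡ fromℕ (count A (suc n)) * inv n
density≡ A n = trans (sym (density-def A n)) (/≡*inv (count A (suc n)) n)

hasDensity-intro : ∀ {A} x → density A ~ seq x → A HasDensity x
hasDensity-intro {A} x h = ~⇒⟶ {λ n → ℤ.+ count A (suc n) / suc n} x (~-trans (~-reflexive (density-def A)) h)

hasDensity-elim : ∀ {A x} → A HasDensity x → density A ~ seq x
hasDensity-elim {A} {x} h = ~-trans (~-reflexive λ n → sym (density-def A n)) (⟶⇒~ {λ n → ℤ.+ count A (suc n) / suc n} x h)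

count-additive : ∀ {A B C D} → (∀ i → bit (A i) ℕ.+ bit (B i) ≡ bit (C i) ℕ.+ bit (D i)) →
  ∀ n → count A n ℕ.+ count B n ≡ count C n ℕ.+ count D n
count-additive h zero = refl
count-additive {A} {B} {C} {D} h (suc n) = begin
  (count A n ℕ.+ bit (A n)) ℕ.+ (count B n ℕ.+ bit (B n))  ≡⟨ interchange (count A n) (bit (A n)) (count B n) (bit (B n)) ⟩
  (count A n ℕ.+ count B n) ℕ.+ (bit (A n) ℕ.+ bit (B n))  ≡⟨ cong₂ ℕ._+_ (count-additive {A} {B} {C} {D} h n) (h n) ⟩
  (count C n ℕ.+ count D n) ℕ.+ (bit (C n) ℕ.+ bit (D n))  ≡⟨ interchange (count C n) (count D n) (bit (C n)) (bit (D n)) ⟩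
  (count C n ℕ.+ bit (C n)) ℕ.+ (count D n ℕ.+ bit (D n))  ∎
  where
  open ≡-Reasoning
  interchange : ∀ a b c d → (a ℕ.+ b) ℕ.+ (c ℕ.+ d) ≡ (a ℕ.+ c) ℕ.+ (b ℕ.+ d)
  interchange = solve-∀

density-additive : ∀ {A B C D} → (∀ i → bit (A i) ℕ.+ bit (B i) ≡ bit (C i) ℕ.+ bit (D i)) →
  ∀ n → density A n + density B n ≡ density C n + density D n
density-additive {A} {B} {C} {D} h n = begin
  density A n + density B n                              ≡⟨ collect A B ⟩
  fromℕ (count A (suc n) ℕ.+ count B (suc n)) * inv n    ≡⟨ cong (λ k → fromℕ k * inv n) (count-additive {A} {B} {C} {D} h (suc n)) ⟩
  fromℕ (count C (suc n) ℕ.+ count D (suc n)) * inv n    ≡⟨ sym (collect C D) ⟩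
  density C n + density D n                              ∎
  where
  open ≡-Reasoning
  collect : ∀ A B → density A n + density B n ≡ fromℕ (count A (suc n) ℕ.+ count B (suc n)) * inv n
  collect A B = trans (cong₂ _+_ (density≡ A n) (density≡ B n))
    (trans (sym (ℚ.*-distribʳ-+ (inv n) (fromℕ (count A (suc n))) (fromℕ (count B (suc n)))))
      (cong (_* inv n) (sym (fromℕ-+ (count A (suc n)) (count B (suc n))))))

density-ω : ∀ n → density ω n ≡ 1ℚ
density-ω n = trans (density≡ ω n)
  (trans (cong (λ k → fromℕ k * inv n) (count-ω (suc n))) (trans (ℚ.*-comm (fromℕ (suc n)) (inv n)) (inv-fromℕ n)))
  where
  count-ω : ∀ n → count ω n ≡ n
  count-ω zero    = refl
  count-ω (suc n) = trans (cong (ℕ._+ 1) (count-ω n)) (ℕ.+-comm n 1)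

density-∅ : ∀ n → density ∅ω n ≡ 0ℚ
density-∅ n = trans (density≡ ∅ω n) (trans (cong (λ k → fromℕ k * inv n) (count-∅ (suc n))) (ℚ.*-zeroˡ (inv n)))
  where
  count-∅ : ∀ n → count ∅ω n ≡ 0
  count-∅ zero    = refl
  count-∅ (suc n) = trans (ℕ.+-identityʳ _) (count-∅ n)

-- Beyond N the two counts differ by the constant `c`, which division by n + 1 sends to 0.
density-finite-change : ∀ {A B} N → (∀ i → N ℕ.≤ i → A i ≡ B i) → density A ~ density B
density-finite-change {A} {B} N agree = mk~ λ ε 0<ε → bound ε (inv-small (1ℚ + K) ε 0<ε)
  where
  c : ℚ
  c = fromℕ (count A N) - fromℕ (count B N)
  K : ℚ
  K = ∣ c ∣

  shifted : ∀ k → count A (k ℕ.+ N) ℕ.+ count B N ≡ count B (k ℕ.+ N) ℕ.+ count A N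
  shifted zero    = ℕ.+-comm (count A N) (count B N)
  shifted (suc k) = begin
    (count A (k ℕ.+ N) ℕ.+ bit (A (k ℕ.+ N))) ℕ.+ count B N  ≡⟨ move (count A (k ℕ.+ N)) _ _ ⟩
    (count A (k ℕ.+ N) ℕ.+ count B N) ℕ.+ bit (A (k ℕ.+ N))  ≡⟨ cong₂ ℕ._+_ (shifted k) (cong bit (agree (k ℕ.+ N) (ℕ.m≤n+m N k))) ⟩
    (count B (k ℕ.+ N) ℕ.+ count A N) ℕ.+ bit (B (k ℕ.+ N))  ≡⟨ move (count B (k ℕ.+ N)) _ _ ⟩
    (count B (k ℕ.+ N) ℕ.+ bit (B (k ℕ.+ N))) ℕ.+ count A N  ∎
    where
    open ≡-Reasoning
    move : ∀ a b c → (a ℕ.+ b) ℕ.+ c ≡ (a ℕ.+ c) ℕ.+ b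
    move = solve-∀

  shifted′ : ∀ n → N ℕ.≤ n → count A n ℕ.+ count B N ≡ count B n ℕ.+ count A N
  shifted′ n N≤n = subst (λ m → count A m ℕ.+ count B N ≡ count B m ℕ.+ count A N) (ℕ.m∸n+n≡m N≤n) (shifted (n ℕ.∸ N))

  difference : ∀ n → N ℕ.≤ n → fromℕ (count A n) - fromℕ (count B n) ≡ c
  difference n N≤n = begin
    a - b                      ≡⟨ solve 3 (λ a b k → a :- b := (a :+ k) :- b :- k) refl a b k ⟩
    (a + k) - b - k            ≡⟨ cong (λ t → t - b - k) (trans (sym (fromℕ-+ (count A n) (count B N)))
                                    (trans (cong fromℕ (shifted′ n N≤n)) (fromℕ-+ (count B n) (count A N)))) ⟩
    (b + l) - b - k            ≡⟨ solve 3 (λ b k l → (b :+ l) :- b :- k := l :- k) refl b k l ⟩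
    c                          ∎
    where
    open ≡-Reasoning
    a = fromℕ (count A n)
    b = fromℕ (count B n)
    k = fromℕ (count B N)
    l = fromℕ (count A N)

  bound : ∀ ε → (∃ λ n → (1ℚ + K) * inv n < ε) → ∃ λ M → ∀ n → M ℕ.≤ n → ∣ density A n - density B n ∣ < ε
  bound ε (M , small) = M ℕ.⊔ N , λ n le → subst (_< ε) (sym (eq n (ℕ.m⊔n≤o⇒n≤o M N le)))
    (ℚ.≤-<-trans (ℚ.≤-trans (≤-by (inv n) (ℚ.<⇒≤ (0<inv n)) (solve 2 (λ k i → k :* i :+ i := (con 1ℚ :+ k) :* i) refl K (inv n)))
      (ℚ.*-monoˡ-≤-nonNeg (1ℚ + K) {{nonNegative (0≤+ 0≤1 (ℚ.0≤∣p∣ c))}} (inv-anti (ℕ.m⊔n≤o⇒m≤o M N le)))) small)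
    where
    eq : ∀ n → N ℕ.≤ n → ∣ density A n - density B n ∣ ≡ K * inv n
    eq n N≤n = trans (cong ∣_∣ (trans (cong₂ _-_ (density≡ A n) (density≡ B n))
        (trans (solve 3 (λ a b i → a :* i :- b :* i := (a :- b) :* i) refl (fromℕ (count A (suc n))) (fromℕ (count B (suc n))) (inv n))
          (cong (_* inv n) (difference (suc n) (ℕ.m≤n⇒m≤1+n N≤n))))))
      (trans (ℚ.∣p*q∣≡∣p∣*∣q∣ c (inv n)) (cong (K *_) (ℚ.0≤p⇒∣p∣≡p (ℚ.<⇒≤ (0<inv n)))))

-- Independence expressed through the sequences ∣ A ∩ n ∣ / n, without
-- choosing real limits.

densityProduct : List 2^ω → ℕ → ℚ
densityProduct F n = foldr (λ A r → density A n * r) 1ℚ F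

record Independent (𝒜 : Pred 2^ω 0ℓ) : Set where
  field
    bounded    : ∀ {A} → A ∈ 𝒜 → ∃ λ ε → 0ℚ < ε × ∃ λ N → ∀ n → N ℕ.≤ n → ε ≤ density A n × density A n + ε ≤ 1ℚ
    convergent : ∀ {A} → A ∈ ⟨ 𝒜 ⟩ → Convergent (density A)
    product    : ∀ F → Unique F → All 𝒜 F → density (⋂ω F) ~ densityProduct F

open Independent

⟨⟩-mono : ∀ {𝒜 ℬ : Pred 2^ω 0ℓ} → 𝒜 ⊆ ℬ → ⟨ 𝒜 ⟩ ⊆ ⟨ ℬ ⟩
⟨⟩-mono 𝒜⊆ℬ (gen A∈)     = gen (𝒜⊆ℬ A∈)
⟨⟩-mono 𝒜⊆ℬ empty        = empty
⟨⟩-mono 𝒜⊆ℬ (comp A∈)    = comp (⟨⟩-mono 𝒜⊆ℬ A∈)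
⟨⟩-mono 𝒜⊆ℬ (union A∈ B∈) = union (⟨⟩-mono 𝒜⊆ℬ A∈) (⟨⟩-mono 𝒜⊆ℬ B∈)

independent-⊆ : ∀ {𝒜 ℬ : Pred 2^ω 0ℓ} → 𝒜 ⊆ ℬ → Independent ℬ → Independent 𝒜
independent-⊆ 𝒜⊆ℬ ind = record
  { bounded    = λ A∈ → bounded ind (𝒜⊆ℬ A∈)
  ; convergent = λ A∈ → convergent ind (⟨⟩-mono 𝒜⊆ℬ A∈)
  ; product    = λ F u F⊆ → product ind F u (All.map 𝒜⊆ℬ F⊆)
  }

-- The density of A is represented by the sequence of quotients itself, so the real product of
-- densities agrees with `densityProduct` term by term.
independent⇒dIndependent : ∀ {𝒜 : Pred 2^ω 0ℓ} → Satisfiable 𝒜 → Independent 𝒜 → DIndependent 𝒜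
independent⇒dIndependent {𝒜} sat ind = record
  { nonempty     = sat
  ; ⊆𝒟           = λ A∈ → has-density (gen A∈)
  ; d∈⟨0,1⟩      = λ A∈ → let ε , 0<ε , N , bnd = bounded ind A∈ in
      (ε , 0<ε , N , λ n N≤n → subst (_≤ _) (sym (ℚ.+-identityˡ ε)) (proj₁ (bnd n N≤n))) ,
      (ε , 0<ε , N , λ n N≤n → proj₂ (bnd n N≤n))
  ; field⊆𝒟      = has-density
  ; independence = λ F _ u F⊆ → hasDensity-intro {⋂ω F} (limit F⊆) (~-trans (product ind F u F⊆) (~-reflexive λ n → sym (seq-∏ F⊆ n)))
  }
  where
  has-density : ∀ {A} → A ∈ ⟨ 𝒜 ⟩ → A ∈ 𝒟
  has-density {A} A∈ = let x = mkℝ (density A) (cauchy (convergent ind A∈)) in x , hasDensity-intro {A} x (~-refl {density A})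
  limit : ∀ {F} → All 𝒜 F → ℝ
  limit F⊆ = ∏ (reduce (λ {A} A∈ → d {A} (has-density (gen A∈))) F⊆)
  seq-∏ : ∀ {F} (F⊆ : All 𝒜 F) n → seq (limit F⊆) n ≡ densityProduct F n
  seq-∏ []               n = refl
  seq-∏ (_∷_ {x = A} _ F⊆) n = cong (density A n *_) (seq-∏ F⊆ n)

dIndependent⇒independent : ∀ {𝒜 : Pred 2^ω 0ℓ} → DIndependent 𝒜 → Independent 𝒜
dIndependent⇒independent {𝒜} ind = record
  { bounded    = bnd
  ; convergent = λ A∈ → conv (field⊆𝒟 A∈)
  ; product    = prod
  }
  where
  open DIndependent ind
  conv : ∀ {A} → A ∈ 𝒟 → Convergent (density A)
  conv {A} (x , A⟶x) = convergent-resp-~ (hasDensity-elim {A} {x} A⟶x) (mkConvergent (isCauchy x))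

  bnd : ∀ {A} → A ∈ 𝒜 → ∃ λ ε → 0ℚ < ε × ∃ λ N → ∀ n → N ℕ.≤ n → ε ≤ density A n × density A n + ε ≤ 1ℚ
  bnd {A} A∈ with ⊆𝒟 A∈ | d∈⟨0,1⟩ A∈
  ... | x , A⟶x | (ε , 0<ε , N , lo) , (η , 0<η , M , hi) =
    -- Half of the margin of the limit pays for replacing the limit by the n-th quotient; the other
    -- half is left as the margin.
    ½ * (ε ⊓ η) , 0<* 0<½ 0<δ , L ℕ.⊔ (N ℕ.⊔ M) , λ n le →
      let near = ∣-∣<⇒ (density A n) (seq x n) (½ * δ) (proj₂ (null A~x (½ * δ) (0<* 0<½ 0<δ)) n (ℕ.m⊔n≤o⇒m≤o L _ le))
          NM≤n = ℕ.m⊔n≤o⇒n≤o L _ le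
      in ≤-by ((density A n + ½ * δ - seq x n) + (seq x n - (0ℚ + ε)) + (ε - δ))
           (0≤+ (0≤+ (0≤∸ (ℚ.<⇒≤ (proj₂ near))) (0≤∸ (lo n (ℕ.m⊔n≤o⇒m≤o N M NM≤n)))) (0≤∸ (ℚ.p⊓q≤p ε η)))
           (solve 4 (λ a x e d → con ½ :* d :+ ((a :+ con ½ :* d :- x) :+ (x :- (con 0ℚ :+ e)) :+ (e :- d)) := a) refl (density A n) (seq x n) ε δ)
       , ≤-by ((seq x n - (density A n - ½ * δ)) + (1ℚ - (seq x n + η)) + (η - δ))
           (0≤+ (0≤+ (0≤∸ (ℚ.<⇒≤ (proj₁ near))) (0≤∸ (hi n (ℕ.m⊔n≤o⇒n≤o N M NM≤n)))) (0≤∸ (ℚ.p⊓q≤q ε η)))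
           (solve 4 (λ a x e d → (a :+ con ½ :* d) :+ ((x :- (a :- con ½ :* d)) :+ (con 1ℚ :- (x :+ e)) :+ (e :- d)) := con 1ℚ) refl (density A n) (seq x n) η δ)
    where
    A~x = hasDensity-elim {A} {x} A⟶x
    δ = ε ⊓ η
    0<δ : 0ℚ < δ
    0<δ with ℚ.≤-total ε η
    ... | inj₁ ε≤η = subst (0ℚ <_) (sym (ℚ.p≤q⇒p⊓q≡p ε≤η)) 0<ε
    ... | inj₂ η≤ε = subst (0ℚ <_) (sym (ℚ.p≥q⇒p⊓q≡q η≤ε)) 0<η
    L = proj₁ (null A~x (½ * δ) (0<* 0<½ 0<δ))

  limit : ∀ {F} → All 𝒜 F → ℝ
  limit F⊆ = ∏ (reduce (λ A∈ → d (⊆𝒟 A∈)) F⊆)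

  ∏~ : ∀ {F} (F⊆ : All 𝒜 F) → seq (limit F⊆) ~ densityProduct F × Convergent (densityProduct F)
  ∏~ []       = ~-refl , const-convergent 1ℚ
  ∏~ (_∷_ {x = A} A∈ F⊆) = let r~ , cr = ∏~ F⊆ in
    ~-* (convergent⇒bounded (conv (⊆𝒟 A∈))) (convergent⇒bounded (mkConvergent (isCauchy (limit F⊆))))
      (~-sym (hasDensity-elim {A} {proj₁ (⊆𝒟 A∈)} (proj₂ (⊆𝒟 A∈)))) r~ ,
    convergent-* (conv (⊆𝒟 A∈)) cr

  prod : ∀ F → Unique F → All 𝒜 F → density (⋂ω F) ~ densityProduct F
  prod []      _ _  = ~-reflexive density-ω
  prod (A ∷ F) u F⊆ = ~-trans (hasDensity-elim {⋂ω (A ∷ F)} {limit F⊆} (independence (A ∷ F) (λ ()) u F⊆)) (proj₁ (∏~ F⊆))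

-- Each clause mentions finitely many members, which directedness collects in a single `𝔽 k`. The
-- index i₀ serves ∅ and the empty list.
independent-⋃ : {I : Set} (𝔽 : I → Pred 2^ω 0ℓ) → I →
  (∀ i j → ∃ λ k → 𝔽 i ⊆ 𝔽 k × 𝔽 j ⊆ 𝔽 k) → (∀ i → Independent (𝔽 i)) → Independent (⋃ I 𝔽)
independent-⋃ {I} 𝔽 i₀ directed ind = record
  { bounded    = λ { (i , A∈) → bounded (ind i) A∈ }
  ; convergent = λ A∈ → let i , A∈i = field-member A∈ in convergent (ind i) A∈i
  ; product    = λ F u F⊆ → let i , F⊆i = list-member F⊆ in product (ind i) F u F⊆i
  }
  where
  field-member : ∀ {A} → A ∈ ⟨ ⋃ I 𝔽 ⟩ → ∃ λ i → A ∈ ⟨ 𝔽 i ⟩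
  field-member (gen (i , A∈)) = i , gen A∈
  field-member empty = i₀ , empty
  field-member (comp A∈) = let i , A∈i = field-member A∈ in i , comp A∈i
  field-member (union A∈ B∈) = let i , A∈i = field-member A∈ ; j , B∈j = field-member B∈ ; k , i⊆k , j⊆k = directed i j
    in k , union (⟨⟩-mono i⊆k A∈i) (⟨⟩-mono j⊆k B∈j)
  list-member : ∀ {F} → All (⋃ I 𝔽) F → ∃ λ i → All (𝔽 i) F
  list-member [] = i₀ , []
  list-member ((i , A∈) ∷ F⊆) = let j , F⊆j = list-member F⊆ ; k , i⊆k , j⊆k = directed i j
    in k , i⊆k A∈ ∷ All.map j⊆k F⊆j

-- Adjoining a set that halves every member of the field

infixl 6 _⊕_
_⊕_ : Pred 2^ω 0ℓ → 2^ω → Pred 2^ω 0ℓ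
(𝒜 ⊕ x) A = A ∈ 𝒜 ⊎ A ≡ x

Random : Pred 2^ω 0ℓ → 2^ω → Set
Random 𝒜 x = ∀ {B} → B ∈ ⟨ 𝒜 ⟩ → density (x ∩ω B) ~ (λ n → ½ * density B n)

module Extend (classical : Classical) where
  open Classical classical using (extensionality)
  open Logic classical

  ∩-member : ∀ {𝒜 : Pred 2^ω 0ℓ} {A B} → A ∈ ⟨ 𝒜 ⟩ → B ∈ ⟨ 𝒜 ⟩ → (A ∩ω B) ∈ ⟨ 𝒜 ⟩
  ∩-member {𝒜} {A} {B} A∈ B∈ = subst (_∈ ⟨ 𝒜 ⟩) (extensionality λ n → de-morgan (A n) (B n)) (comp (union (comp A∈) (comp B∈)))
    where
    de-morgan : ∀ a b → not (not a ∨ not b) ≡ a ∧ b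
    de-morgan true  true  = refl
    de-morgan true  false = refl
    de-morgan false _     = refl

  ω-member : ∀ {𝒜 : Pred 2^ω 0ℓ} → ω ∈ ⟨ 𝒜 ⟩
  ω-member = comp empty

  ⋂-member : ∀ {𝒜 : Pred 2^ω 0ℓ} {F} → All 𝒜 F → ⋂ω F ∈ ⟨ 𝒜 ⟩
  ⋂-member []         = ω-member
  ⋂-member (A∈ ∷ F⊆) = ∩-member (gen A∈) (⋂-member F⊆)

  independent-∅ : ∀ {𝒜 : Pred 2^ω 0ℓ} → (∀ {A} → ¬ A ∈ 𝒜) → Independent 𝒜
  independent-∅ {𝒜} none = record
    { bounded    = λ A∈ → ⊥-elim (none A∈)
    ; convergent = λ A∈ → conv (trivial A∈)
    ; product    = λ { [] _ _ → ~-reflexive density-ω ; (_ ∷ _) _ (A∈ ∷ _) → ⊥-elim (none A∈) }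
    }
    where
    trivial : ∀ {A} → A ∈ ⟨ 𝒜 ⟩ → A ≡ ∅ω ⊎ A ≡ ω
    trivial (gen A∈) = ⊥-elim (none A∈)
    trivial empty = inj₁ refl
    trivial (comp A∈) with trivial A∈
    ... | inj₁ refl = inj₂ refl
    ... | inj₂ refl = inj₁ refl
    trivial (union A∈ B∈) with trivial A∈ | trivial B∈
    ... | inj₁ refl | inj₁ refl = inj₁ refl
    ... | inj₁ refl | inj₂ refl = inj₂ refl
    ... | inj₂ refl | _         = inj₂ refl
    conv : ∀ {A} → A ≡ ∅ω ⊎ A ≡ ω → Convergent (density A)
    conv (inj₁ refl) = convergent-resp-~ (~-reflexive density-∅) (const-convergent 0ℚ)
    conv (inj₂ refl) = convergent-resp-~ (~-reflexive density-ω) (const-convergent 1ℚ)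

  module _ {𝒜 : Pred 2^ω 0ℓ} (ind : Independent 𝒜) {x : 2^ω} (random : Random 𝒜 x) where

    random-density : density x ~ (λ _ → ½)
    random-density = ~-trans (~-reflexive λ n → cong (λ A → density A n) (extensionality λ i → sym (∧-true (x i))))
      (~-trans (random ω-member) (~-reflexive λ n → trans (cong (½ *_) (density-ω n)) (ℚ.*-identityʳ ½)))
      where
      ∧-true : ∀ b → b ∧ true ≡ b
      ∧-true true  = refl
      ∧-true false = refl

    -- If x also halved itself, its density would be both ½ and ¼. This later makes the transfinite
    -- sequence injective.
    random-fresh : ¬ x ∈ 𝒜
    random-fresh x∈ = absurd (~-trans (~-sym ½~) ¼~)
      where
      ∧-idem : ∀ b → b ∧ b ≡ b
      ∧-idem true  = refl
      ∧-idem false = refl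
      ½~ : density x ~ (λ _ → ½)
      ½~ = random-density
      ¼~ : density x ~ (λ _ → ½ * ½)
      ¼~ = ~-trans (~-reflexive λ n → cong (λ A → density A n) (extensionality λ i → sym (∧-idem (x i))))
        (~-trans (random (gen x∈)) (~-* (mkBounded (0 , ½ , 0<½ , λ _ _ → ℚ.≤-refl)) (convergent⇒bounded (convergent-resp-~ ½~ (const-convergent ½))) (~-refl {λ _ → ½}) ½~))
      absurd : ¬ (λ _ → ½) ~ (λ _ → ½ * ½)
      absurd h with null h (½ * ½) (0<* 0<½ 0<½)
      ... | N , lt = ℚ.<-irrefl refl (lt N ℕ.≤-refl)

    mix : 2^ω → 2^ω → 2^ω
    mix B C n = if x n then B n else C n

    -- The field operations act separately on x and off x, so the sets of the form `mix B C` are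
    -- closed under them, and they include the generators.
    mix-member : ∀ {A} → A ∈ ⟨ 𝒜 ⊕ x ⟩ → ∃ λ B → ∃ λ C → B ∈ ⟨ 𝒜 ⟩ × C ∈ ⟨ 𝒜 ⟩ × A ≡ mix B C
    mix-member {A} (gen (inj₁ A∈)) = A , A , gen A∈ , gen A∈ , extensionality λ n → same (x n) (A n)
      where
      same : ∀ b c → c ≡ (if b then c else c)
      same true  _ = refl
      same false _ = refl
    mix-member (gen (inj₂ refl)) = ω , ∅ω , ω-member , empty , extensionality λ n → select (x n)
      where
      select : ∀ b → b ≡ (if b then true else false)
      select true  = refl
      select false = refl
    mix-member empty = ∅ω , ∅ω , empty , empty , extensionality λ n → same (x n)
      where
      same : ∀ b → false ≡ (if b then false else false)
      same true  = refl
      same false = refl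
    mix-member (comp A∈) with mix-member A∈
    ... | B , C , B∈ , C∈ , refl = compl B , compl C , comp B∈ , comp C∈ , extensionality λ n → push (x n) (B n) (C n)
      where
      push : ∀ a b c → not (if a then b else c) ≡ (if a then not b else not c)
      push true  _ _ = refl
      push false _ _ = refl
    mix-member (union A∈ A′∈) with mix-member A∈ | mix-member A′∈
    ... | B , C , B∈ , C∈ , refl | B′ , C′ , B′∈ , C′∈ , refl =
      B ∪ω B′ , C ∪ω C′ , union B∈ B′∈ , union C∈ C′∈ , extensionality λ n → push (x n) (B n) (C n) (B′ n) (C′ n)
      where
      push : ∀ a b c b′ c′ → (if a then b else c) ∨ (if a then b′ else c′) ≡ (if a then b ∨ b′ else c ∨ c′)
      push true  _ _ _ _ = refl
      push false _ _ _ _ = refl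

    ∩-convergent : ∀ {B} → B ∈ ⟨ 𝒜 ⟩ → Convergent (density (x ∩ω B))
    ∩-convergent B∈ = convergent-resp-~ (random B∈) (convergent-* (const-convergent ½) (convergent ind B∈))

    -- Halving controls only the intersections with x, so the part of C off x is reached by
    -- subtraction: `mix B C` counts as x ∩ B plus C minus x ∩ C.
    mix-convergent : ∀ {B C} → B ∈ ⟨ 𝒜 ⟩ → C ∈ ⟨ 𝒜 ⟩ → Convergent (density (mix B C))
    mix-convergent {B} {C} B∈ C∈ = convergent-resp-~ (~-reflexive split)
      (convergent-+ (convergent-+ (∩-convergent B∈) (convergent ind C∈)) (convergent-* (const-convergent (- 1ℚ)) (∩-convergent C∈)))
      where
      bits : ∀ a b c → bit (if a then b else c) ℕ.+ bit (a ∧ c) ≡ bit (a ∧ b) ℕ.+ bit c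
      bits true  _ _ = refl
      bits false _ c = ℕ.+-identityʳ (bit c)
      split : ∀ n → density (mix B C) n ≡ density (x ∩ω B) n + density C n + (- 1ℚ) * density (x ∩ω C) n
      split n = trans (solve 2 (λ m e → m := (m :+ e) :+ con (- 1ℚ) :* e) refl (density (mix B C) n) (density (x ∩ω C) n))
        (cong (_+ (- 1ℚ) * density (x ∩ω C) n)
          (density-additive {mix B C} {x ∩ω C} {x ∩ω B} {C} (λ i → bits (x i) (B i) (C i)) n))

    -- The result of taking the single occurrence of x out of F. The field `keep` preserves
    -- uniqueness when the removal is carried past another entry.
    record Removal (F : List 2^ω) : Set where
      field
        rest    : List 2^ω
        keep    : ∀ {A} → All (A ≢_) F → All (A ≢_) rest
        unique  : Unique rest
        rest⊆   : All 𝒜 rest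
        meet    : ⋂ω F ≡ x ∩ω ⋂ω rest
        factor  : ∀ n → densityProduct F n ≡ density x n * densityProduct rest n

    remove-here : ∀ {F} → All (x ≢_) F → Unique F → All (𝒜 ⊕ x) F → Removal (x ∷ F)
    remove-here {F} x∉F u F⊆ = record
      { rest = F ; keep = λ { (_ ∷ ps) → ps } ; unique = u ; rest⊆ = without x∉F F⊆ ; meet = refl ; factor = λ _ → refl }
      where
      without : ∀ {F} → All (x ≢_) F → All (𝒜 ⊕ x) F → All 𝒜 F
      without [] [] = []
      without (_ ∷ ≢s) (inj₁ A∈ ∷ F⊆) = A∈ ∷ without ≢s F⊆
      without (≢ ∷ ≢s) (inj₂ eq ∷ F⊆) = ⊥-elim (≢ (sym eq))

    remove-there : ∀ {A F} → All (A ≢_) F → A ∈ 𝒜 → Removal F → Removal (A ∷ F)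
    remove-there {A} A∉F A∈ r = record
      { rest = A ∷ rest ; keep = λ { (p ∷ ps) → p ∷ keep ps } ; unique = keep A∉F ∷ unique ; rest⊆ = A∈ ∷ rest⊆
      ; meet = trans (cong (A ∩ω_) meet) (extensionality λ n → swap (A n) (x n) (⋂ω rest n))
      ; factor = λ n → trans (cong (density A n *_) (factor n)) (exchange (density A n) (density x n) (densityProduct rest n)) }
      where
      open Removal r
      swap : ∀ a b c → a ∧ (b ∧ c) ≡ b ∧ (a ∧ c)
      swap true  true  _ = refl
      swap true  false _ = refl
      swap false true  _ = refl
      swap false false _ = refl
      exchange : ∀ a b c → a * (b * c) ≡ b * (a * c)
      exchange = solve 3 (λ a b c → a :* (b :* c) := b :* (a :* c)) refl

    remove : ∀ F → Unique F → All (𝒜 ⊕ x) F → All 𝒜 F ⊎ Removal F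
    remove []      _         _                   = inj₁ []
    remove (_ ∷ F) (A∉F ∷ u) (inj₂ refl ∷ F⊆) = inj₂ (remove-here A∉F u F⊆)
    remove (_ ∷ F) (A∉F ∷ u) (inj₁ A∈ ∷ F⊆)   with remove F u F⊆
    ... | inj₁ F⊆𝒜 = inj₁ (A∈ ∷ F⊆𝒜)
    ... | inj₂ r    = inj₂ (remove-there A∉F A∈ r)

    extend-convergent : ∀ {A} → A ∈ ⟨ 𝒜 ⊕ x ⟩ → Convergent (density A)
    extend-convergent A∈ with mix-member A∈
    ... | B , C , B∈ , C∈ , refl = mix-convergent B∈ C∈

    removal-product : ∀ {F} → Removal F → density (⋂ω F) ~ densityProduct F
    removal-product {F} r = ~-trans {q = density (x ∩ω ⋂ω rest)} (~-reflexive λ n → cong (λ A → density A n) meet)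
      (~-trans {q = λ n → ½ * density (⋂ω rest) n} (random (⋂-member rest⊆))
      (~-trans {q = λ n → density x n * densityProduct rest n}
        (~-* (convergent⇒bounded (convergent-resp-~ random-density (const-convergent ½))) (convergent⇒bounded (convergent ind (⋂-member rest⊆)))
          (~-sym random-density) (product ind rest unique rest⊆))
        (~-reflexive λ n → sym (factor n))))
      where open Removal r

    extend-product : ∀ F → Unique F → All (𝒜 ⊕ x) F → density (⋂ω F) ~ densityProduct F
    extend-product F u F⊆ = [ product ind F u , removal-product ]′ (remove F u F⊆)

    near-½-bounded : ∀ a → ∣ a - ½ ∣ < ½ * ½ → ½ * ½ ≤ a × a + ½ * ½ ≤ 1ℚ
    near-½-bounded a near =
      ≤-by (a + ½ * ½ - ½) (0≤∸ (ℚ.<⇒≤ (proj₂ (∣-∣<⇒ a ½ (½ * ½) near))))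
        (solve 1 (λ a → con (½ * ½) :+ (a :+ con (½ * ½) :- con ½) := a) refl a) ,
      ≤-by (½ - (a - ½ * ½)) (0≤∸ (ℚ.<⇒≤ (proj₁ (∣-∣<⇒ a ½ (½ * ½) near))))
        (solve 1 (λ a → a :+ con (½ * ½) :+ (con ½ :- (a :- con (½ * ½))) := con 1ℚ) refl a)

    random-bounded : ∃ λ ε → 0ℚ < ε × ∃ λ N → ∀ n → N ℕ.≤ n → ε ≤ density x n × density x n + ε ≤ 1ℚ
    random-bounded = ½ * ½ , 0<* 0<½ 0<½ , proj₁ near , λ n le → near-½-bounded (density x n) (proj₂ near n le)
      where
      near : ∃ λ N → ∀ n → N ℕ.≤ n → ∣ density x n - ½ ∣ < ½ * ½
      near = null random-density (½ * ½) (0<* 0<½ 0<½)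

    extend : Independent (𝒜 ⊕ x)
    extend = record
      { bounded    = λ { (inj₁ A∈) → bounded ind A∈ ; (inj₂ refl) → random-bounded }
      ; convergent = extend-convergent
      ; product    = extend-product
      }

  -- For a between ε and 1 - ε, the difference a - a² = a(1 - a) is at least ε².
  ¬idempotent : ∀ {a} → a ~ (λ n → a n * a n) → ¬ ∃ λ ε → 0ℚ < ε × ∃ λ N → ∀ n → N ℕ.≤ n → ε ≤ a n × a n + ε ≤ 1ℚ
  ¬idempotent {a} square (ε , 0<ε , M , bnd) with null square (ε * ε) (0<* 0<ε 0<ε)
  ... | L , close = ℚ.<-irrefl refl (ℚ.<-≤-trans (proj₁ (∣-∣<⇒ (a n) (a n * a n) (ε * ε) (close n (ℕ.m≤n⊔m M L))))
      (gap (a n) (proj₁ (bnd n (ℕ.m≤m⊔n M L))) (proj₂ (bnd n (ℕ.m≤m⊔n M L)))))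
    where
    n : ℕ
    n = M ℕ.⊔ L
    gap : ∀ a → ε ≤ a → a + ε ≤ 1ℚ → a * a ≤ a - ε * ε
    gap a ε≤a a+ε≤1 = ≤-by ((a - ε) * ((1ℚ - (a + ε)) + ε) + ε * (1ℚ - (a + ε)))
      (0≤+ (0≤* (0≤∸ ε≤a) (0≤+ (0≤∸ a+ε≤1) (ℚ.<⇒≤ 0<ε))) (0≤* (ℚ.<⇒≤ 0<ε) (0≤∸ a+ε≤1)))
      (solve 2 (λ a e → a :* a :+ ((a :- e) :* ((con 1ℚ :- (a :+ e)) :+ e) :+ e :* (con 1ℚ :- (a :+ e))) := a :- e :* e) refl a ε)

  -- The set x ∩ y differs from x in finitely many places and so has the density of x, while
  -- independence of two distinct members of equal density makes it the square.
  no-finite-change : ∀ {𝒜 : Pred 2^ω 0ℓ} → Independent 𝒜 → ∀ {x y} N → (∀ i → N ℕ.≤ i → x i ≡ y i) → x ≢ y →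
    x ∈ 𝒜 → ¬ y ∈ 𝒜
  no-finite-change ind {x} {y} N agree x≢y x∈ y∈ = ¬idempotent {density x} square (bounded ind x∈)
    where
    ∧-idem : ∀ b → b ≡ b ∧ (b ∧ true)
    ∧-idem true  = refl
    ∧-idem false = refl
    y~x : density y ~ density x
    y~x = density-finite-change N λ i le → sym (agree i le)
    meet~x : density x ~ density (⋂ω (x ∷ y ∷ []))
    meet~x = density-finite-change N λ i le → trans (∧-idem (x i)) (cong (λ b → x i ∧ (b ∧ true)) (agree i le))
    product~ : densityProduct (x ∷ y ∷ []) ~ (λ n → density x n * density x n)
    product~ = ~-* (convergent⇒bounded (convergent ind (gen x∈)))
      (convergent⇒bounded (convergent-* (convergent ind (gen y∈)) (const-convergent 1ℚ)))
      (~-refl {density x}) (~-trans {q = density y} (~-reflexive λ n → ℚ.*-identityʳ (density y n)) y~x)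
    square : density x ~ (λ n → density x n * density x n)
    square = ~-trans meet~x (~-trans (product ind (x ∷ y ∷ []) ((x≢y ∷ []) ∷ [] ∷ []) (x∈ ∷ y∈ ∷ [])) product~)

-- Outer measure

partialSum-cong : ∀ {f g} → (∀ n → f n ≡ g n) → ∀ n → partialSum f n ≡ partialSum g n
partialSum-cong eq zero    = refl
partialSum-cong eq (suc n) = cong₂ _+_ (partialSum-cong eq n) (eq n)

partialSum-+ : ∀ f g n → partialSum (λ k → f k + g k) n ≡ partialSum f n + partialSum g n
partialSum-+ f g zero    = refl
partialSum-+ f g (suc n) = trans (cong (_+ (f n + g n)) (partialSum-+ f g n))
  (solve 4 (λ a b c d → (a :+ b) :+ (c :+ d) := (a :+ c) :+ (b :+ d)) refl (partialSum f n) (partialSum g n) (f n) (g n))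

partialSum-head : ∀ f n → partialSum f (suc n) ≡ f 0 + partialSum (f ∘ suc) n
partialSum-head f zero    = trans (ℚ.+-identityˡ (f 0)) (sym (ℚ.+-identityʳ (f 0)))
partialSum-head f (suc n) = trans (cong (_+ f (suc n)) (partialSum-head f n)) (ℚ.+-assoc (f 0) _ (f (suc n)))

½^ : ℕ → ℚ
½^ zero    = 1ℚ
½^ (suc n) = ½ * ½^ n

0<½^ : ∀ n → 0ℚ < ½^ n
0<½^ zero    = ℚ.positive⁻¹ 1ℚ
0<½^ (suc n) = 0<* 0<½ (0<½^ n)

partialSum-½^ : ∀ c n → partialSum (λ k → c * ½^ (suc k)) n ≡ c - c * ½^ n
partialSum-½^ c zero    = solve 1 (λ c → con 0ℚ := c :- c :* con 1ℚ) refl c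
partialSum-½^ c (suc n) = trans (cong (_+ c * ½^ (suc n)) (partialSum-½^ c n))
  (solve 2 (λ c h → c :- c :* h :+ c :* (con ½ :* h) := c :- c :* (con ½ :* h)) refl c (½^ n))

partialSum-½^-≤ : ∀ {c} → 0ℚ ≤ c → ∀ n → partialSum (λ k → c * ½^ (suc k)) n ≤ c
partialSum-½^-≤ {c} 0≤c n = ≤-by (c * ½^ n) (0≤* 0≤c (ℚ.<⇒≤ (0<½^ n)))
  (trans (cong (_+ c * ½^ n) (partialSum-½^ c n)) (solve 2 (λ c t → c :- t :+ t := c) refl c (c * ½^ n)))

½^≤inv : ∀ n → ½^ n ≤ inv n
½^≤inv n = ≤-by (inv n * (1ℚ - ½^ n * fromℕ (suc n))) (0≤* (ℚ.<⇒≤ (0<inv n)) (0≤∸ (bound n)))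
  (trans (solve 3 (λ h i f → h :+ i :* (con 1ℚ :- h :* f) := h :+ i :- h :* (i :* f)) refl (½^ n) (inv n) (fromℕ (suc n)))
    (trans (cong (λ t → ½^ n + inv n - ½^ n * t) (inv-fromℕ n)) (solve 2 (λ h i → h :+ i :- h :* con 1ℚ := i) refl (½^ n) (inv n))))
  where
  bound : ∀ n → ½^ n * fromℕ (suc n) ≤ 1ℚ
  bound zero    = ℚ.≤-refl
  bound (suc n) = ≤-by ((1ℚ - ½^ n * fromℕ (suc n)) + ½ * (½^ n * fromℕ n))
    (0≤+ (0≤∸ (bound n)) (0≤* 0≤½ (0≤* (ℚ.<⇒≤ (0<½^ n)) (0≤fromℕ n))))
    (solve 2 (λ h f → con ½ :* h :* (con 1ℚ :+ (con 1ℚ :+ f)) :+ ((con 1ℚ :- h :* (con 1ℚ :+ f)) :+ con ½ :* (h :* f)) := con 1ℚ) refl (½^ n) (fromℕ n))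

½^-small : ∀ ε → 0ℚ < ε → ∃ λ n → ½^ n ≤ ε
½^-small ε 0<ε with inv-small 1ℚ ε 0<ε
... | n , lt = n , ℚ.≤-trans (½^≤inv n) (ℚ.<⇒≤ (subst (_< ε) (ℚ.*-identityˡ (inv n)) lt))

0<μ : ∀ s → 0ℚ < μ s
0<μ []      = ℚ.positive⁻¹ 1ℚ
0<μ (_ ∷ s) = 0<* 0<½ (0<μ s)

mass : List (List Bool) → ℚ
mass = foldr (λ s r → μ s + r) 0ℚ

0≤mass : ∀ l → 0ℚ ≤ mass l
0≤mass []      = ℚ.≤-refl
0≤mass (s ∷ l) = 0≤+ (ℚ.<⇒≤ (0<μ s)) (0≤mass l)

mass-++ : ∀ k l → mass (k ++ l) ≡ mass k + mass l
mass-++ []      l = sym (ℚ.+-identityˡ (mass l))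
mass-++ (s ∷ k) l = trans (cong (μ s +_) (mass-++ k l)) (sym (ℚ.+-assoc (μ s) (mass k) (mass l)))

mass-cons : ∀ b l → mass (map (b ∷_) l) ≡ ½ * mass l
mass-cons b []      = refl
mass-cons b (s ∷ l) = trans (cong (½ * μ s +_) (mass-cons b l)) (sym (ℚ.*-distribˡ-+ ½ (μ s) (mass l)))

Hits : 2^ω → List (List Bool) → Set
Hits x = Any (λ s → x ∈ [ s ])

-- Outer measure at most δ, through covers arranged in finite levels.
record Small (E : Pred 2^ω 0ℓ) (δ : ℚ) : Set where
  field
    level  : ℕ → List (List Bool)
    covers : ∀ {x} → x ∈ E → ∃ λ n → Hits x (level n)
    total  : ∀ n → partialSum (mass ∘ level) n ≤ δ
open Small

small-mono : ∀ {E F δ δ′} → E ⊆ F → δ ≤ δ′ → Small F δ → Small E δ′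
small-mono E⊆F δ≤δ′ F-small = record
  { level = level F-small ; covers = covers F-small ∘ E⊆F ; total = λ n → ℚ.≤-trans (total F-small n) δ≤δ′ }

small-∅ : ∀ {E δ} → (∀ {x} → x ∈ E → ⊥) → 0ℚ ≤ δ → Small E δ
small-∅ {δ = δ} none 0≤δ = record { level = λ _ → [] ; covers = λ x∈ → ⊥-elim (none x∈) ; total = λ n → ℚ.≤-trans (ℚ.≤-reflexive (zeros n)) 0≤δ }
  where
  zeros : ∀ n → partialSum (λ _ → 0ℚ) n ≡ 0ℚ
  zeros zero    = refl
  zeros (suc n) = trans (ℚ.+-identityʳ _) (zeros n)

small-∪ : ∀ {E F δ δ′} → Small E δ → Small F δ′ → Small (E ∪ F) (δ + δ′)
small-∪ {E} {F} {δ} {δ′} p q = record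
  { level  = λ n → level p n ++ level q n
  ; covers = cov
  ; total  = λ n → subst (_≤ δ + δ′)
      (sym (trans (partialSum-cong (λ k → mass-++ (level p k) (level q k)) n) (partialSum-+ _ _ n)))
      (ℚ.+-mono-≤ (total p n) (total q n))
  }
  where
  cov : ∀ {x} → x ∈ (E ∪ F) → ∃ λ n → Hits x (level p n ++ level q n)
  cov (inj₁ x∈E) = let n , h = covers p x∈E in n , Any.++⁺ˡ h
  cov (inj₂ x∈F) = let n , h = covers q x∈F in n , Any.++⁺ʳ (level p n) h

-- Cauchy's arrangement of a double series: level n joins the f i j with i + j = n.
antidiagonal : (ℕ → ℕ → List (List Bool)) → ℕ → List (List Bool)
antidiagonal f zero    = f 0 0
antidiagonal f (suc n) = f 0 (suc n) ++ antidiagonal (f ∘ suc) n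

antidiagonal-hits : ∀ f {x} i j → Hits x (f i j) → Hits x (antidiagonal f (i ℕ.+ j))
antidiagonal-hits f zero    zero    h = h
antidiagonal-hits f zero    (suc j) h = Any.++⁺ˡ h
antidiagonal-hits f (suc i) j       h = Any.++⁺ʳ (f 0 (suc (i ℕ.+ j))) (antidiagonal-hits (f ∘ suc) i j h)

-- The first n antidiagonals meet only the first n rows.
antidiagonal-total : ∀ f δ → (∀ i n → partialSum (mass ∘ f i) n ≤ δ i) →
  ∀ n → partialSum (mass ∘ antidiagonal f) n ≤ partialSum δ n
antidiagonal-total f δ bnd zero    = ℚ.≤-refl
antidiagonal-total f δ bnd (suc n) = subst₂ _≤_ (sym (split n)) (sym (partialSum-head δ n))
  (ℚ.+-mono-≤ (bnd 0 (suc n)) (antidiagonal-total (f ∘ suc) (δ ∘ suc) (λ i → bnd (suc i)) n))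
  where
  split : ∀ n → partialSum (mass ∘ antidiagonal f) (suc n) ≡ partialSum (mass ∘ f 0) (suc n) + partialSum (mass ∘ antidiagonal (f ∘ suc)) n
  split zero    = sym (ℚ.+-identityʳ _)
  split (suc n) = trans (cong₂ _+_ (split n) (mass-++ (f 0 (suc n)) _))
    (solve 4 (λ a b c d → (a :+ b) :+ (c :+ d) := (a :+ c) :+ (b :+ d)) refl
      (partialSum (mass ∘ f 0) (suc n)) (partialSum (mass ∘ antidiagonal (f ∘ suc)) n) (mass (f 0 (suc n))) (mass (antidiagonal (f ∘ suc) n)))

small-⋃ : ∀ {E : ℕ → Pred 2^ω 0ℓ} {δ : ℕ → ℚ} {δ′} → (∀ i → Small (E i) (δ i)) → (∀ n → partialSum δ n ≤ δ′) → Small (⋃ ℕ E) δ′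
small-⋃ {E} {δ} {δ′} p bnd = record
  { level  = antidiagonal (λ i → level (p i))
  ; covers = λ { (i , x∈) → let j , h = covers (p i) x∈ in i ℕ.+ j , antidiagonal-hits (λ i → level (p i)) i j h }
  ; total  = λ n → ℚ.≤-trans (antidiagonal-total (λ i → level (p i)) δ (λ i → total (p i)) n) (bnd n)
  }

Negligible : Pred 2^ω 0ℓ → Set
Negligible E = ∀ ε → 0ℚ < ε → Small E ε

negligible-⋃ : ∀ {E : ℕ → Pred 2^ω 0ℓ} → (∀ i → Negligible (E i)) → Negligible (⋃ ℕ E)
negligible-⋃ negl ε 0<ε = small-⋃ {δ = λ i → ε * ½^ (suc i)} (λ i → negl i _ (0<* 0<ε (0<½^ (suc i)))) (partialSum-½^-≤ (ℚ.<⇒≤ 0<ε))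

small-cover : ∀ (s : ℕ → List Bool) {ε} → (∀ n → partialSum (μ ∘ s) n ≤ ε) → Small (⋃ ℕ (λ i → [ s i ])) ε
small-cover s {ε} bnd = record
  { level  = λ n → s n ∷ []
  ; covers = λ { (n , h) → n , here h }
  ; total  = λ n → subst (_≤ ε) (partialSum-cong (λ k → sym (ℚ.+-identityʳ (μ (s k)))) n) (bnd n)
  }

𝒩⇒negligible : ∀ {E} → E ∈ 𝒩 → Negligible E
𝒩⇒negligible E∈𝒩 ε 0<ε = let s , E⊆ , bnd = E∈𝒩 ε 0<ε in small-mono E⊆ ℚ.≤-refl (small-cover s bnd)

-- Every cylinder has positive measure, so each level receives an extra tiny
-- cylinder to make it nonempty before the levels are concatenated.
module Flatten (L : ℕ → List (List Bool)) (tiny : ℕ → List Bool) where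

  -- s is emitted next, l is the rest of its level, and n is the level to be opened after that.
  flatten : List Bool → List (List Bool) → ℕ → ℕ → List Bool
  flatten s l       n zero    = s
  flatten s (t ∷ l) n (suc k) = flatten t l n k
  flatten s []      n (suc k) = flatten (tiny n) (L n) (suc n) k

  levels : ℕ → ℕ → ℚ
  levels n zero    = 0ℚ
  levels n (suc k) = mass (tiny n ∷ L n) + levels (suc n) k

  0≤levels : ∀ n k → 0ℚ ≤ levels n k
  0≤levels n zero    = ℚ.≤-refl
  0≤levels n (suc k) = 0≤+ (0≤mass (tiny n ∷ L n)) (0≤levels (suc n) k)

  levels-mono : ∀ n k → levels n k ≤ levels n (suc k)
  levels-mono n zero    = 0≤levels n 1
  levels-mono n (suc k) = ℚ.+-monoʳ-≤ (mass (tiny n ∷ L n)) (levels-mono (suc n) k)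

  -- Padded levels are nonempty, so k steps reach at most k levels beyond the current one.
  flatten-total : ∀ s l n k → partialSum (μ ∘ flatten s l n) k ≤ mass (s ∷ l) + levels n k
  flatten-total s l n zero = 0≤+ (0≤mass (s ∷ l)) ℚ.≤-refl
  flatten-total s (t ∷ l) n (suc k) = subst (_≤ mass (s ∷ t ∷ l) + levels n (suc k))
    (sym (partialSum-head (μ ∘ flatten s (t ∷ l) n) k))
    (ℚ.≤-trans (ℚ.+-monoʳ-≤ (μ s) (ℚ.≤-trans (flatten-total t l n k) (ℚ.+-monoʳ-≤ (mass (t ∷ l)) (levels-mono n k))))
      (ℚ.≤-reflexive (sym (ℚ.+-assoc (μ s) (mass (t ∷ l)) (levels n (suc k))))))
  flatten-total s [] n (suc k) = subst (_≤ mass (s ∷ []) + levels n (suc k))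
    (sym (partialSum-head (μ ∘ flatten s [] n) k))
    (ℚ.≤-trans (ℚ.+-monoʳ-≤ (μ s) (flatten-total (tiny n) (L n) (suc n) k))
      (ℚ.≤-reflexive (cong (_+ levels n (suc k)) (sym (ℚ.+-identityʳ (μ s))))))

  flatten-within : ∀ {x} s l n → Hits x (s ∷ l) → ∃ λ k → x ∈ [ flatten s l n k ]
  flatten-within s l n (here h) = 0 , h
  flatten-within s (t ∷ l) n (there h) = let k , h′ = flatten-within t l n h in suc k , h′

  flatten-skip : ∀ s l n → ∃ λ k → ∀ j → flatten s l n (k ℕ.+ j) ≡ flatten (tiny n) (L n) (suc n) j
  flatten-skip s []      n = 1 , λ j → refl
  flatten-skip s (t ∷ l) n = let k , eq = flatten-skip t l n in suc k , eq

  flatten-hits : ∀ {x} s l n m → Hits x (L (m ℕ.+ n)) → ∃ λ k → x ∈ [ flatten s l n k ]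
  flatten-hits {x} s l n m h with flatten-skip s l n
  flatten-hits {x} s l n zero h | k , eq =
    let j , h′ = flatten-within (tiny n) (L n) (suc n) (there h) in k ℕ.+ j , subst (λ u → x ∈ [ u ]) (sym (eq j)) h′
  flatten-hits {x} s l n (suc m) h | k , eq =
    let j , h′ = flatten-hits (tiny n) (L n) (suc n) m (subst (Hits x ∘ L) (sym (ℕ.+-suc m n)) h)
    in k ℕ.+ j , subst (λ u → x ∈ [ u ]) (sym (eq j)) h′

small⇒cover : ∀ {E δ ε} m → ½^ m + δ ≤ ε → Small E δ → ∃ λ (s : ℕ → List Bool) →
  E ⊆ ⋃ ℕ (λ i → [ s i ]) × (∀ n → partialSum (μ ∘ s) n ≤ ε)
small⇒cover {E} {δ} {ε} m ½^m+δ≤ε p = flatten (tiny 0) (L 0) 1 , cov , bnd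
  where
  L : ℕ → List (List Bool)
  L = level p
  -- The lengths n + 1 + m keep the total cost of the padding below 2^-m.
  tiny : ℕ → List Bool
  tiny n = replicate (suc n ℕ.+ m) false
  open Flatten L tiny

  μ-tiny : ∀ n → μ (tiny n) ≡ ½^ m * ½^ (suc n)
  μ-tiny zero    = trans (cong (½ *_) (μ-replicate m)) (solve 1 (λ h → con ½ :* h := h :* (con ½ :* con 1ℚ)) refl (½^ m))
    where
    μ-replicate : ∀ k → μ (replicate k false) ≡ ½^ k
    μ-replicate zero    = refl
    μ-replicate (suc k) = cong (½ *_) (μ-replicate k)
  μ-tiny (suc n) = trans (cong (½ *_) (μ-tiny n)) (solve 2 (λ h t → con ½ :* (h :* t) := h :* (con ½ :* t)) refl (½^ m) (½^ (suc n)))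

  K : ℕ → ℚ
  K n = mass (tiny n ∷ L n)

  levels≡ : ∀ n k → levels n k ≡ partialSum (λ j → K (j ℕ.+ n)) k
  levels≡ n zero    = refl
  levels≡ n (suc k) = trans (cong (K n +_) (trans (levels≡ (suc n) k) (partialSum-cong (λ j → cong K (ℕ.+-suc j n)) k)))
    (sym (partialSum-head (λ j → K (j ℕ.+ n)) k))

  K-total : ∀ n → partialSum K n ≤ ε
  K-total n = subst (_≤ ε) (sym (partialSum-+ (μ ∘ tiny) (mass ∘ L) n))
    (ℚ.≤-trans (ℚ.+-mono-≤ (ℚ.≤-trans (ℚ.≤-reflexive (partialSum-cong μ-tiny n)) (partialSum-½^-≤ (ℚ.<⇒≤ (0<½^ m)) n)) (total p n)) ½^m+δ≤ε)

  bnd : ∀ k → partialSum (μ ∘ flatten (tiny 0) (L 0) 1) k ≤ ε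
  bnd k = ℚ.≤-trans (flatten-total (tiny 0) (L 0) 1 k) (subst (_≤ ε) (sym (trans (levels≡ 0 (suc k))
    (partialSum-cong (λ j → cong K (ℕ.+-identityʳ j)) (suc k)))) (K-total (suc k)))

  cov : E ⊆ ⋃ ℕ (λ i → [ flatten (tiny 0) (L 0) 1 i ])
  cov {x} x∈ with covers p x∈
  ... | zero  , h = flatten-within (tiny 0) (L 0) 1 (there h)
  ... | suc n , h = flatten-hits (tiny 0) (L 0) 1 n (subst (λ k → Hits x (L k)) (ℕ.+-comm 1 n) h)

negligible⇒𝒩 : ∀ {E} → Negligible E → E ∈ 𝒩
negligible⇒𝒩 {E} negl ε 0<ε = convert (½^-small (½ * ε) (0<* 0<½ 0<ε))
  where
  convert : (∃ λ m → ½^ m ≤ ½ * ε) → ∃ λ (s : ℕ → List Bool) → E ⊆ ⋃ ℕ (λ i → [ s i ]) × (∀ n → partialSum (μ ∘ s) n ≤ ε)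
  convert (m , ½^m≤) = small⇒cover m (ℚ.≤-trans (ℚ.+-monoˡ-≤ (½ * ε) ½^m≤) (ℚ.≤-reflexive (halves ε))) (negl (½ * ε) (0<* 0<½ 0<ε))

-- Expectation of functions of finitely many coordinates

cons : Bool → 2^ω → 2^ω
cons b x zero    = b
cons b x (suc n) = x n

DependsBelow : ∀ {A : Set} → ℕ → (2^ω → A) → Set
DependsBelow n F = ∀ {x y} → (∀ i → i ℕ.< n → x i ≡ y i) → F x ≡ F y

-- The average over the first n coordinates, with all later ones set to false. This is the true
-- expectation for functions that depend below n, and linearity and monotonicity hold for all
-- functions.
𝔼 : ℕ → (2^ω → ℚ) → ℚ
𝔼 zero    F = F ∅ω
𝔼 (suc n) F = ½ * (𝔼 n (F ∘ cons true) + 𝔼 n (F ∘ cons false))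

𝔼-cong : ∀ n {F G} → (∀ x → F x ≡ G x) → 𝔼 n F ≡ 𝔼 n G
𝔼-cong zero    eq = eq ∅ω
𝔼-cong (suc n) eq = cong (½ *_) (cong₂ _+_ (𝔼-cong n (eq ∘ cons true)) (𝔼-cong n (eq ∘ cons false)))

𝔼-mono : ∀ n {F G} → (∀ x → F x ≤ G x) → 𝔼 n F ≤ 𝔼 n G
𝔼-mono zero    le = le ∅ω
𝔼-mono (suc n) le = ℚ.*-monoˡ-≤-nonNeg ½ (ℚ.+-mono-≤ (𝔼-mono n (le ∘ cons true)) (𝔼-mono n (le ∘ cons false)))

𝔼-+ : ∀ n F G → 𝔼 n (λ x → F x + G x) ≡ 𝔼 n F + 𝔼 n G
𝔼-+ zero    F G = refl
𝔼-+ (suc n) F G = trans (cong (½ *_) (cong₂ _+_ (𝔼-+ n (F ∘ cons true) (G ∘ cons true)) (𝔼-+ n (F ∘ cons false) (G ∘ cons false))))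
  (solve 4 (λ a b c d → con ½ :* ((a :+ b) :+ (c :+ d)) := con ½ :* (a :+ c) :+ con ½ :* (b :+ d)) refl
    (𝔼 n (F ∘ cons true)) (𝔼 n (G ∘ cons true)) (𝔼 n (F ∘ cons false)) (𝔼 n (G ∘ cons false)))

𝔼-* : ∀ n c F → 𝔼 n (λ x → c * F x) ≡ c * 𝔼 n F
𝔼-* zero    c F = refl
𝔼-* (suc n) c F = trans (cong (½ *_) (cong₂ _+_ (𝔼-* n c (F ∘ cons true)) (𝔼-* n c (F ∘ cons false))))
  (solve 3 (λ c a b → con ½ :* (c :* a :+ c :* b) := c :* (con ½ :* (a :+ b))) refl c (𝔼 n (F ∘ cons true)) (𝔼 n (F ∘ cons false)))

𝔼-const : ∀ n c → 𝔼 n (λ _ → c) ≡ c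
𝔼-const zero    c = refl
𝔼-const (suc n) c = trans (cong (½ *_) (cong₂ _+_ (𝔼-const n c) (𝔼-const n c)))
  (solve 1 (λ c → con ½ :* (c :+ c) := c) refl c)

dependsBelow-cons : ∀ {A : Set} {n} {F : 2^ω → A} b → DependsBelow (suc n) F → DependsBelow n (F ∘ cons b)
dependsBelow-cons b dep agree = dep λ { zero _ → refl ; (suc i) (ℕ.s≤s i<n) → agree i i<n }

𝔼-lift : ∀ {m n F} → m ℕ.≤ n → DependsBelow m F → 𝔼 n F ≡ 𝔼 m F
𝔼-lift {zero} {n} ℕ.z≤n dep = trans (𝔼-cong n (λ x → dep {x} {∅ω} λ _ ())) (𝔼-const n _)
𝔼-lift (ℕ.s≤s m≤n) dep = cong (½ *_) (cong₂ _+_ (𝔼-lift m≤n (dependsBelow-cons true dep)) (𝔼-lift m≤n (dependsBelow-cons false dep)))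

indicator : Bool → ℚ
indicator b = if b then 1ℚ else 0ℚ

strings : ℕ → (2^ω → Bool) → List (List Bool)
strings zero    C = if C ∅ω then [] ∷ [] else []
strings (suc n) C = map (true ∷_) (strings n (C ∘ cons true)) ++ map (false ∷_) (strings n (C ∘ cons false))

mass-strings : ∀ n C → mass (strings n C) ≡ 𝔼 n (indicator ∘ C)
mass-strings zero C with C ∅ω
... | true  = refl
... | false = refl
mass-strings (suc n) C = trans (mass-++ (map (true ∷_) (strings n (C ∘ cons true))) (map (false ∷_) (strings n (C ∘ cons false))))
  (trans (cong₂ _+_ (trans (mass-cons true (strings n (C ∘ cons true))) (cong (½ *_) (mass-strings n (C ∘ cons true))))
                    (trans (mass-cons false (strings n (C ∘ cons false))) (cong (½ *_) (mass-strings n (C ∘ cons false)))))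
    (sym (ℚ.*-distribˡ-+ ½ (𝔼 n (indicator ∘ C ∘ cons true)) (𝔼 n (indicator ∘ C ∘ cons false)))))

strings-hits : ∀ n {C} → DependsBelow n C → ∀ {x} → C x ≡ true → Hits x (strings n C)
strings-hits zero {C} dep {x} Cx rewrite trans (dep {∅ω} {x} λ _ ()) Cx = here tt
strings-hits (suc n) {C} dep {x} Cx = go (x 0) refl
  where
  shift : ∀ b → x 0 ≡ b → C (cons b (x ∘ suc)) ≡ true
  shift b eq = trans (dep λ { zero _ → sym eq ; (suc i) _ → refl }) Cx
  go : ∀ b → x 0 ≡ b → Hits x (strings (suc n) C)
  go true  eq = Any.++⁺ˡ (Any.map⁺ (Any.map (eq ,_) (strings-hits n (dependsBelow-cons true dep) (shift true eq))))
  go false eq = Any.++⁺ʳ (map (true ∷_) (strings n (C ∘ cons true)))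
    (Any.map⁺ (Any.map (eq ,_) (strings-hits n (dependsBelow-cons false dep) (shift false eq))))

-- Coordinate flips preserve outer measure

flip : ℕ → 2^ω → 2^ω
flip zero    x zero    = not (x zero)
flip zero    x (suc i) = x (suc i)
flip (suc n) x zero    = x zero
flip (suc n) x (suc i) = flip n (x ∘ suc) i

flipString : ℕ → List Bool → List Bool
flipString n       []      = []
flipString zero    (b ∷ s) = not b ∷ s
flipString (suc n) (b ∷ s) = b ∷ flipString n s

μ-flipString : ∀ n s → μ (flipString n s) ≡ μ s
μ-flipString n       []      = refl
μ-flipString zero    (b ∷ s) = refl
μ-flipString (suc n) (b ∷ s) = cong (½ *_) (μ-flipString n s)

flip-cylinder : ∀ n s x → flip n x ∈ [ s ] → x ∈ [ flipString n s ]
flip-cylinder n       []      x _ = tt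
flip-cylinder zero    (b ∷ s) x (eq , h) = trans (sym (not-involutive (x 0))) (cong not eq) , h
  where
  not-involutive : ∀ b → not (not b) ≡ b
  not-involutive true  = refl
  not-involutive false = refl
flip-cylinder (suc n) (b ∷ s) x (eq , h) = eq , flip-cylinder n s (x ∘ suc) h

small-flip : ∀ {E δ} n → Small E δ → Small (λ x → flip n x ∈ E) δ
small-flip {E} {δ} n p = record
  { level  = λ k → map (flipString n) (level p k)
  ; covers = λ {x} x∈ → let k , h = covers p x∈ in k , Any.map⁺ (Any.map (λ {s} → flip-cylinder n s x) h)
  ; total  = λ k → subst (_≤ δ) (partialSum-cong (λ j → sym (mass-map (level p j))) k) (total p k)
  }
  where
  mass-map : ∀ l → mass (map (flipString n) l) ≡ mass l
  mass-map []      = refl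
  mass-map (s ∷ l) = cong₂ _+_ (μ-flipString n s) (mass-map l)

flip-below : ∀ n x i → i ℕ.< n → flip n x i ≡ x i
flip-below (suc n) x zero    _           = refl
flip-below (suc n) x (suc i) (ℕ.s≤s i<n) = flip-below n (x ∘ suc) i i<n

flip-above : ∀ n x i → n ℕ.< i → x i ≡ flip n x i
flip-above zero    x (suc i) _           = refl
flip-above (suc n) x (suc i) (ℕ.s≤s n<i) = flip-above n (x ∘ suc) i n<i

flip-≢ : ∀ n x → x ≢ flip n x
flip-≢ n x eq = go n x (cong (λ y → y n) eq)
  where
  go : ∀ n x → x n ≡ flip n x n → ⊥
  go zero x h with x 0
  go zero x () | true
  go zero x () | false
  go (suc n) x h = go n (x ∘ suc) h

-- The strong law of large numbers

-- Twice the deviation of count (x ∩ω A) n from its mean.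
sign : Bool → Bool → ℚ
sign a b = if a then (if b then 1ℚ else - 1ℚ) else 0ℚ

-- The recursion splits off the first coordinate, unlike that of `count`, in order to match the
-- recursion of `𝔼`.
deviation : 2^ω → 2^ω → ℕ → ℚ
deviation A x zero    = 0ℚ
deviation A x (suc n) = sign (A 0) (x 0) + deviation (A ∘ suc) (x ∘ suc) n

sq : ℚ → ℚ
sq q = q * q

0≤sq : ∀ q → 0ℚ ≤ sq q
0≤sq q = subst (0ℚ ≤_) (trans (sym (ℚ.∣p*q∣≡∣p∣*∣q∣ q q)) (trans (ℚ.∣p*q∣≡∣p∣*∣q∣ q q) (∣q∣² q))) (0≤* (ℚ.0≤∣p∣ q) (ℚ.0≤∣p∣ q))
  where
  ∣q∣² : ∀ q → ∣ q ∣ * ∣ q ∣ ≡ q * q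
  ∣q∣² q with ℚ.∣p∣≡p∨∣p∣≡-p q
  ... | inj₁ eq = cong₂ _*_ eq eq
  ... | inj₂ eq = trans (cong₂ _*_ eq eq) (solve 1 (λ q → (:- q) :* (:- q) := q :* q) refl q)

count-head : ∀ A n → count A (suc n) ≡ bit (A 0) ℕ.+ count (A ∘ suc) n
count-head A zero    = sym (ℕ.+-identityʳ (bit (A 0)))
count-head A (suc n) = trans (cong (ℕ._+ bit (A (suc n))) (count-head A n)) (ℕ.+-assoc (bit (A 0)) _ _)

deviation-count : ∀ A x n → deviation A x n ≡ fromℕ (count (x ∩ω A) n) + fromℕ (count (x ∩ω A) n) - fromℕ (count A n)
deviation-count A x zero    = refl
deviation-count A x (suc n) = trans (cong (sign (A 0) (x 0) +_) (deviation-count (A ∘ suc) (x ∘ suc) n))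
  (trans (step (A 0) (x 0) (fromℕ (count ((x ∘ suc) ∩ω (A ∘ suc)) n)) (fromℕ (count (A ∘ suc) n)))
    (cong₂ (λ u v → u + u - v)
      (trans (sym (fromℕ-+ (bit (x 0 ∧ A 0)) _)) (cong fromℕ (sym (count-head (x ∩ω A) n))))
      (trans (sym (fromℕ-+ (bit (A 0)) _)) (cong fromℕ (sym (count-head A n))))))
  where
  step : ∀ a b c d → sign a b + (c + c - d) ≡ (fromℕ (bit (b ∧ a)) + c) + (fromℕ (bit (b ∧ a)) + c) - (fromℕ (bit a) + d)
  step true  true  = solve 2 (λ c d → con 1ℚ :+ (c :+ c :- d) := (con 1ℚ :+ c) :+ (con 1ℚ :+ c) :- (con 1ℚ :+ d)) refl
  step true  false = solve 2 (λ c d → con (- 1ℚ) :+ (c :+ c :- d) := (con 0ℚ :+ c) :+ (con 0ℚ :+ c) :- (con 1ℚ :+ d)) refl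
  step false true  = solve 2 (λ c d → con 0ℚ :+ (c :+ c :- d) := (con 0ℚ :+ c) :+ (con 0ℚ :+ c) :- (con 0ℚ :+ d)) refl
  step false false = solve 2 (λ c d → con 0ℚ :+ (c :+ c :- d) := (con 0ℚ :+ c) :+ (con 0ℚ :+ c) :- (con 0ℚ :+ d)) refl

deviation-dependsBelow : ∀ A n → DependsBelow n (λ x → deviation A x n)
deviation-dependsBelow A zero    agree = refl
deviation-dependsBelow A (suc n) agree = cong₂ _+_ (cong (sign (A 0)) (agree 0 (ℕ.s≤s ℕ.z≤n)))
  (deviation-dependsBelow (A ∘ suc) n λ i i<n → agree (suc i) (ℕ.s≤s i<n))

𝔼-average : ∀ n F G → ½ * (𝔼 n F + 𝔼 n G) ≡ 𝔼 n (λ x → ½ * (F x + G x))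
𝔼-average n F G = trans (cong (½ *_) (sym (𝔼-+ n F G))) (sym (𝔼-* n ½ (λ x → F x + G x)))

𝔼-deviation : ∀ (P : ℚ → ℚ) A n → 𝔼 (suc n) (λ x → P (deviation A x (suc n))) ≡
  𝔼 n (λ x → ½ * (P (sign (A 0) true + deviation (A ∘ suc) x n) + P (sign (A 0) false + deviation (A ∘ suc) x n)))
𝔼-deviation P A n = 𝔼-average n (λ x → P (sign (A 0) true + deviation (A ∘ suc) x n)) (λ x → P (sign (A 0) false + deviation (A ∘ suc) x n))

-- The cross terms of the two signs of the first coordinate cancel: (d + 1)² and (d - 1)² average to
-- 1 + d².
second-moment : ∀ A n → 𝔼 n (λ x → sq (deviation A x n)) ≤ fromℕ n
second-moment A zero    = ℚ.≤-refl
second-moment A (suc n) = subst (_≤ fromℕ (suc n)) (sym (𝔼-deviation sq A n)) (bound (A 0))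
  where
  D : 2^ω → ℚ
  D x = deviation (A ∘ suc) x n
  average : ∀ a d → ½ * (sq (sign a true + d) + sq (sign a false + d)) ≤ 1ℚ + sq d
  average true  d = ℚ.≤-reflexive (solve 1 (λ d → con ½ :* ((con 1ℚ :+ d) :* (con 1ℚ :+ d) :+ (con (- 1ℚ) :+ d) :* (con (- 1ℚ) :+ d)) := con 1ℚ :+ d :* d) refl d)
  average false d = ≤-by 1ℚ 0≤1 (solve 1 (λ d → con ½ :* ((con 0ℚ :+ d) :* (con 0ℚ :+ d) :+ (con 0ℚ :+ d) :* (con 0ℚ :+ d)) :+ con 1ℚ := con 1ℚ :+ d :* d) refl d)
  bound : ∀ a → 𝔼 n (λ x → ½ * (sq (sign a true + D x) + sq (sign a false + D x))) ≤ 1ℚ + fromℕ n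
  bound a = ℚ.≤-trans (𝔼-mono n (λ x → average a (D x))) (ℚ.≤-trans (ℚ.≤-reflexive (trans (𝔼-+ n (λ _ → 1ℚ) (sq ∘ D)) (cong (_+ 𝔼 n (sq ∘ D)) (𝔼-const n 1ℚ))))
    (ℚ.+-monoʳ-≤ 1ℚ (second-moment (A ∘ suc) n)))

3ℚ 6ℚ : ℚ
3ℚ = fromℕ 3
6ℚ = fromℕ 6

-- Averaging over the first sign turns d⁴ into 1 + 6d² + d⁴. With second moment at most n the
-- induction needs 3n² + 6n + 1 ≤ 3(n + 1)²; the coefficient 3 is chosen to absorb the 6n.
fourth-moment : ∀ A n → 𝔼 n (λ x → sq (sq (deviation A x n))) ≤ 3ℚ * sq (fromℕ n)
fourth-moment A zero    = ℚ.≤-refl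
fourth-moment A (suc n) = subst (_≤ 3ℚ * sq (fromℕ (suc n))) (sym (𝔼-deviation (sq ∘ sq) A n)) (bound (A 0))
  where
  D : 2^ω → ℚ
  D x = deviation (A ∘ suc) x n
  average : ∀ a d → ½ * (sq (sq (sign a true + d)) + sq (sq (sign a false + d))) ≤ 1ℚ + (6ℚ * sq d + sq (sq d))
  average true  d = ℚ.≤-reflexive (solve 1 (λ d → let p = con 1ℚ :+ d ; m = con (- 1ℚ) :+ d in
    con ½ :* ((p :* p) :* (p :* p) :+ (m :* m) :* (m :* m)) := con 1ℚ :+ (con 6ℚ :* (d :* d) :+ (d :* d) :* (d :* d))) refl d)
  average false d = ≤-by (1ℚ + 6ℚ * sq d) (0≤+ 0≤1 (0≤* (0≤fromℕ 6) (0≤sq d))) (solve 1 (λ d → let p = con 0ℚ :+ d in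
    con ½ :* ((p :* p) :* (p :* p) :+ (p :* p) :* (p :* p)) :+ (con 1ℚ :+ con 6ℚ :* (d :* d)) := con 1ℚ :+ (con 6ℚ :* (d :* d) :+ (d :* d) :* (d :* d))) refl d)
  expectation : 𝔼 n (λ x → 1ℚ + (6ℚ * sq (D x) + sq (sq (D x)))) ≡ 1ℚ + (6ℚ * 𝔼 n (sq ∘ D) + 𝔼 n (sq ∘ sq ∘ D))
  expectation = trans (𝔼-+ n (λ _ → 1ℚ) (λ x → 6ℚ * sq (D x) + sq (sq (D x)))) (cong₂ _+_ (𝔼-const n 1ℚ)
    (trans (𝔼-+ n (λ x → 6ℚ * sq (D x)) (sq ∘ sq ∘ D)) (cong (_+ 𝔼 n (sq ∘ sq ∘ D)) (𝔼-* n 6ℚ (sq ∘ D)))))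
  bound : ∀ a → 𝔼 n (λ x → ½ * (sq (sq (sign a true + D x)) + sq (sq (sign a false + D x)))) ≤ 3ℚ * sq (1ℚ + fromℕ n)
  bound a = ℚ.≤-trans (𝔼-mono n (λ x → average a (D x))) (subst (_≤ 3ℚ * sq (1ℚ + fromℕ n)) (sym expectation)
    (≤-by (1ℚ + 1ℚ + 6ℚ * (fromℕ n - 𝔼 n (sq ∘ D)) + (3ℚ * sq (fromℕ n) - 𝔼 n (sq ∘ sq ∘ D)))
      (0≤+ (0≤+ (0≤+ 0≤1 0≤1) (0≤* (0≤fromℕ 6) (0≤∸ (second-moment (A ∘ suc) n)))) (0≤∸ (fourth-moment (A ∘ suc) n)))
      (solve 3 (λ f s q → (con 1ℚ :+ (con 6ℚ :* s :+ q)) :+ (con 1ℚ :+ con 1ℚ :+ con 6ℚ :* (f :- s) :+ (con 3ℚ :* (f :* f) :- q))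
        := con 3ℚ :* ((con 1ℚ :+ f) :* (con 1ℚ :+ f))) refl (fromℕ n) (𝔼 n (sq ∘ D)) (𝔼 n (sq ∘ sq ∘ D)))))

-- With C = 1/ε⁴ this says that the deviation is at least εn in absolute value; fourth powers match
-- the moment bound and need no roots.
large : ℚ → 2^ω → ℕ → 2^ω → Bool
large C A n x = does (sq (sq (fromℕ n)) ≤? C * sq (sq (deviation A x n)))

large-dependsBelow : ∀ C A n → DependsBelow n (large C A n)
large-dependsBelow C A n agree = cong (λ d → does (sq (sq (fromℕ n)) ≤? C * sq (sq d))) (deviation-dependsBelow A n agree)

-- Markov's inequality for the fourth moment: at most C · 3n² / n⁴, taken at n + 1.
large-rare : ∀ {C} → 0ℚ ≤ C → ∀ A n → 𝔼 (suc n) (indicator ∘ large C A (suc n)) ≤ (C * 3ℚ) * sq (inv n)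
large-rare {C} 0≤C A n = cancel (𝔼 (suc n) (indicator ∘ large C A (suc n))) (fromℕ (suc n)) (inv n) (inv-fromℕ n) (0≤sq (inv n)) markov
  where
  N : ℚ
  N = fromℕ (suc n)
  pointwise : ∀ x → sq (sq N) * indicator (large C A (suc n) x) ≤ C * sq (sq (deviation A x (suc n)))
  pointwise x = bound (sq (sq N) ≤? C * sq (sq (deviation A x (suc n)))) (0≤* 0≤C (0≤sq (sq (deviation A x (suc n)))))
    where
    bound : ∀ {p q} (p≤?q : Dec (p ≤ q)) → 0ℚ ≤ q → p * indicator (does p≤?q) ≤ q
    bound {p} {q} (yes p≤q) _   = subst (_≤ q) (sym (ℚ.*-identityʳ p)) p≤q
    bound {p} {q} (no _)    0≤q = subst (_≤ q) (sym (ℚ.*-zeroʳ p)) 0≤q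
  markov : sq (sq N) * 𝔼 (suc n) (indicator ∘ large C A (suc n)) ≤ C * (3ℚ * sq N)
  markov = subst (_≤ C * (3ℚ * sq N)) (𝔼-* (suc n) (sq (sq N)) (indicator ∘ large C A (suc n)))
    (ℚ.≤-trans (𝔼-mono (suc n) pointwise) (ℚ.≤-trans (ℚ.≤-reflexive (𝔼-* (suc n) C (λ x → sq (sq (deviation A x (suc n))))))
      (ℚ.*-monoˡ-≤-nonNeg C {{nonNegative 0≤C}} (fourth-moment A (suc n)))))
  cancel : ∀ e f i → i * f ≡ 1ℚ → 0ℚ ≤ sq i → sq (sq f) * e ≤ C * (3ℚ * sq f) → e ≤ (C * 3ℚ) * sq i
  cancel e f i if≡1 0≤i² le = ≤-by (sq i * sq i * (C * (3ℚ * sq f) - sq (sq f) * e)) (0≤* (0≤* 0≤i² 0≤i²) (0≤∸ le))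
    (trans (solve 5 (λ e f i C t → e :+ (i :* i) :* (i :* i) :* (C :* (t :* (f :* f)) :- (f :* f) :* (f :* f) :* e)
        := e :+ ((C :* t) :* (i :* i)) :* ((i :* f) :* (i :* f)) :- ((i :* f) :* (i :* f)) :* ((i :* f) :* (i :* f)) :* e) refl e f i C 3ℚ)
      (trans (cong (λ t → e + ((C * 3ℚ) * (i * i)) * (t * t) - (t * t) * (t * t) * e) if≡1)
        (solve 2 (λ e k → e :+ k :* (con 1ℚ :* con 1ℚ) :- (con 1ℚ :* con 1ℚ) :* (con 1ℚ :* con 1ℚ) :* e := k) refl e ((C * 3ℚ) * (i * i)))))

-- Bounds the series of inverse squares by a telescoping one.
inv-telescope : ∀ m → sq (inv (suc m)) ≤ inv m - inv (suc m)
inv-telescope m = ≤-by (inv (suc m) * (inv m - inv (suc m))) (0≤* (ℚ.<⇒≤ (0<inv (suc m))) (0≤∸ (inv-anti (ℕ.n≤1+n m))))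
  (difference (inv m) (inv (suc m)) (fromℕ (suc m)) (inv-fromℕ m) (inv-fromℕ (suc m)))
  where
  difference : ∀ p r f → p * f ≡ 1ℚ → r * (1ℚ + f) ≡ 1ℚ → r * r + r * (p - r) ≡ p - r
  difference p r f pf rf = trans (solve 3 (λ p r f → r :* r :+ r :* (p :- r) := p :* (r :* (con 1ℚ :+ f)) :- r :* (p :* f)) refl p r f)
    (trans (cong₂ (λ u v → p * u - r * v) rf pf) (solve 2 (λ p r → p :* con 1ℚ :- r :* con 1ℚ := p :- r) refl p r))

InfinitelyLarge : ℚ → 2^ω → Pred 2^ω 0ℓ
InfinitelyLarge C A x = ∀ N → ∃ λ n → N ℕ.≤ n × large C A (suc n) x ≡ true

-- The Borel-Cantelli argument: the events from any index on cover the set, and their measures sum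
-- to a small tail.
infinitelyLarge-negligible : ∀ {C} → 0ℚ ≤ C → ∀ A → Negligible (InfinitelyLarge C A)
infinitelyLarge-negligible {C} 0≤C A ε 0<ε = from (inv-small (C * 3ℚ) ε 0<ε)
  where
  from : (∃ λ N → (C * 3ℚ) * inv N < ε) → Small (InfinitelyLarge C A) ε
  from (N , lt) = record
    -- Starting at N + 2 bounds the j-th measure by 3C / (j + N + 2)², so that the telescoping sum
    -- is at most 3C / (N + 1).
    { level  = λ j → strings (suc (suc (j ℕ.+ N))) (large C A (suc (suc (j ℕ.+ N))))
    ; covers = cov
    ; total  = λ n → ℚ.≤-trans (tail n) (ℚ.≤-trans (drop n) (ℚ.<⇒≤ lt))
    }
    where
    0≤K : 0ℚ ≤ C * 3ℚ
    0≤K = 0≤* 0≤C (0≤fromℕ 3)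
    cov : ∀ {x} → x ∈ InfinitelyLarge C A → ∃ λ j → Hits x (strings (suc (suc (j ℕ.+ N))) (large C A (suc (suc (j ℕ.+ N)))))
    cov {x} inf with inf (suc N)
    ... | n , N<n , h = n ℕ.∸ suc N , strings-hits k {large C A k} (large-dependsBelow C A k)
      (subst (λ k → large C A (suc k) x ≡ true) (sym (trans (sym (ℕ.+-suc (n ℕ.∸ suc N) N)) (ℕ.m∸n+n≡m N<n))) h)
      where
      k : ℕ
      k = suc (suc (n ℕ.∸ suc N ℕ.+ N))
    tail : ∀ n → partialSum (λ j → mass (strings (suc (suc (j ℕ.+ N))) (large C A (suc (suc (j ℕ.+ N)))))) n
               ≤ (C * 3ℚ) * inv N - (C * 3ℚ) * inv (n ℕ.+ N)
    tail zero    = ℚ.≤-reflexive (sym (ℚ.+-inverseʳ ((C * 3ℚ) * inv N)))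
    tail (suc n) = ℚ.≤-trans (ℚ.+-mono-≤ (tail n) (subst (_≤ (C * 3ℚ) * (inv (n ℕ.+ N) - inv (suc (n ℕ.+ N))))
        (sym (mass-strings (suc (suc (n ℕ.+ N))) (large C A (suc (suc (n ℕ.+ N))))))
        (ℚ.≤-trans (large-rare 0≤C A (suc (n ℕ.+ N))) (ℚ.*-monoˡ-≤-nonNeg (C * 3ℚ) {{nonNegative 0≤K}} (inv-telescope (n ℕ.+ N))))))
      (ℚ.≤-reflexive (solve 4 (λ k a b c → (k :* a :- k :* b) :+ k :* (b :- c) := k :* a :- k :* c) refl
        (C * 3ℚ) (inv N) (inv (n ℕ.+ N)) (inv (suc (n ℕ.+ N)))))
    drop : ∀ n → (C * 3ℚ) * inv N - (C * 3ℚ) * inv (n ℕ.+ N) ≤ (C * 3ℚ) * inv N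
    drop n = ≤-by ((C * 3ℚ) * inv (n ℕ.+ N)) (0≤* 0≤K (ℚ.<⇒≤ (0<inv (n ℕ.+ N))))
      (solve 2 (λ a b → a :- b :+ b := a) refl ((C * 3ℚ) * inv N) ((C * 3ℚ) * inv (n ℕ.+ N)))

Biased : 2^ω → Pred 2^ω 0ℓ
Biased A x = ¬ density (x ∩ω A) ~ (λ n → ½ * density A n)

module StrongLaw (classical : Classical) where
  open Logic classical

  -- If C ≥ 1 / ε⁴, a deviation of at least ε n makes C · deviation⁴ ≥ n⁴.
  biased⊆ : ∀ A → Biased A ⊆ ⋃ ℕ (λ c → InfinitelyLarge (fromℕ c) A)
  biased⊆ A {x} biased = ¬¬-elim λ none → biased (mk~ λ ε 0<ε → near none ε 0<ε (reciprocal (sq (sq ε)) (0<* (0<* 0<ε 0<ε) (0<* 0<ε 0<ε))))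
    where
    D : ℕ → ℚ
    D n = deviation A x (suc n)
    half : ∀ n → density (x ∩ω A) n - ½ * density A n ≡ ½ * (D n * inv n)
    half n = trans (cong₂ (λ u v → u - ½ * v) (density≡ (x ∩ω A) n) (density≡ A n))
      (trans (solve 3 (λ c a i → c :* i :- con ½ :* (a :* i) := con ½ :* ((c :+ c :- a) :* i)) refl
        (fromℕ (count (x ∩ω A) (suc n))) (fromℕ (count A (suc n))) (inv n))
        (cong (λ t → ½ * (t * inv n)) (sym (deviation-count A x (suc n)))))
    near : ¬ (∃ λ c → x ∈ InfinitelyLarge (fromℕ c) A) → ∀ ε → 0ℚ < ε → (∃ λ r → sq (sq ε) * r ≡ 1ℚ) →
      ∃ λ N → ∀ n → N ℕ.≤ n → ∣ density (x ∩ω A) n - ½ * density A n ∣ < ε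
    near none ε 0<ε (r , ε⁴r≡1) = from (¬∀⇒∃¬ λ inf → none (c , inf))
      where
      c : ℕ
      c = proj₁ (archimedean r)
      C : ℚ
      C = fromℕ c
      from : (∃ λ N → ¬ ∃ λ n → N ℕ.≤ n × large C A (suc n) x ≡ true) → ∃ λ N → ∀ n → N ℕ.≤ n → ∣ density (x ∩ω A) n - ½ * density A n ∣ < ε
      from (N , small) = N , λ n N≤n → subst (_< ε) (cong ∣_∣ (sym (half n))) (bound n (ℚ.≰⇒> λ ε≤ → small (n , N≤n , is-large n ε≤)))
        where
        bound : ∀ n → ∣ D n * inv n ∣ < ε → ∣ ½ * (D n * inv n) ∣ < ε
        bound n lt = ℚ.≤-<-trans (subst (_≤ ∣ D n * inv n ∣) (sym (ℚ.∣p*q∣≡∣p∣*∣q∣ ½ (D n * inv n)))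
          (≤-by (½ * ∣ D n * inv n ∣) (0≤* 0≤½ (ℚ.0≤∣p∣ (D n * inv n))) (halves ∣ D n * inv n ∣))) lt
        ∣sq∣ : ∀ q → sq ∣ q ∣ ≡ sq q
        ∣sq∣ q = trans (sym (ℚ.∣p*q∣≡∣p∣*∣q∣ q q)) (ℚ.0≤p⇒∣p∣≡p (0≤sq q))
        sq-mono : ∀ {p q} → 0ℚ ≤ p → p ≤ q → sq p ≤ sq q
        sq-mono {p} {q} 0≤p p≤q = ≤-by ((q - p) * (q + p)) (0≤* (0≤∸ p≤q) (0≤+ (ℚ.≤-trans 0≤p p≤q) 0≤p))
          (solve 2 (λ p q → p :* p :+ (q :- p) :* (q :+ p) := q :* q) refl p q)
        fourth : ∀ n → ε ≤ ∣ D n * inv n ∣ → sq (sq ε) ≤ sq (sq (D n * inv n))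
        fourth n ε≤ = sq-mono (0≤sq ε) (subst (sq ε ≤_) (∣sq∣ (D n * inv n)) (sq-mono (ℚ.<⇒≤ 0<ε) ε≤))
        is-large : ∀ n → ε ≤ ∣ D n * inv n ∣ → large C A (suc n) x ≡ true
        is-large n ε≤ = dec-true (sq (sq (fromℕ (suc n))) ≤? C * sq (sq (D n)))
          (scale (fromℕ (suc n)) (inv n) (D n) C (inv-fromℕ n) (0≤fromℕ c) (proj₂ (archimedean r)) (fourth n ε≤))
          where
          scale : ∀ f i d C → i * f ≡ 1ℚ → 0ℚ ≤ C → r ≤ C → sq (sq ε) ≤ sq (sq (d * i)) → sq (sq f) ≤ C * sq (sq d)
          scale f i d C if≡1 0≤C r≤C le = ≤-by
            (sq (sq f) * (sq (sq ε) * (C - r)) + sq (sq f) * (C * (sq (sq (d * i)) - sq (sq ε))))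
            (0≤+ (0≤* (0≤sq (sq f)) (0≤* (0≤sq (sq ε)) (0≤∸ r≤C))) (0≤* (0≤sq (sq f)) (0≤* 0≤C (0≤∸ le))))
            (trans (solve 6 (λ f i d C e r → let p = λ t → (t :* t) :* (t :* t) in
                p f :+ (p f :* (p e :* (C :- r)) :+ p f :* (C :* (p (d :* i) :- p e)))
                := p f :- p f :* (p e :* r) :+ C :* p d :* p (i :* f)) refl f i d C ε r)
              (trans (cong₂ (λ u v → sq (sq f) - sq (sq f) * u + C * sq (sq d) * sq (sq v)) ε⁴r≡1 if≡1)
                (solve 2 (λ a b → a :- a :* con 1ℚ :+ b :* ((con 1ℚ :* con 1ℚ) :* (con 1ℚ :* con 1ℚ)) := b) refl (sq (sq f)) (C * sq (sq d)))))

  biased-negligible : ∀ A → Negligible (Biased A)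
  biased-negligible A ε 0<ε = small-mono (biased⊆ A) ℚ.≤-refl (negligible-⋃ (λ c → infinitelyLarge-negligible (0≤fromℕ c) A) ε 0<ε)

-- Approximation of Borel sets

record Clopen : Set where
  field
    set     : 2^ω → Bool
    depth   : ℕ
    depends : DependsBelow depth set
open Clopen

dependsBelow-mono : ∀ {A : Set} {m n} {F : 2^ω → A} → m ℕ.≤ n → DependsBelow m F → DependsBelow n F
dependsBelow-mono m≤n dep agree = dep λ i i<m → agree i (ℕ.≤-trans i<m m≤n)

Differ : Pred 2^ω 0ℓ → (2^ω → Bool) → Pred 2^ω 0ℓ
Differ B C x = (x ∈ B × C x ≡ false) ⊎ (x ∉ B × C x ≡ true)

module Approximation (classical : Classical) where
  open Logic classical

  -- If every value were exceeded by more than δ later on, the sequence would climb past 1.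
  bounded⇒small-tail : ∀ (M : ℕ → ℚ) → 0ℚ ≤ M 0 → (∀ n → M n ≤ 1ℚ) → ∀ δ → 0ℚ < δ → ∃ λ n → ∀ k → M (k ℕ.+ n) ≤ M n + δ
  bounded⇒small-tail M 0≤M₀ M≤1 δ 0<δ = ¬¬-elim λ none →
    let jump : ∀ n → ∃ λ k → M n + δ < M (k ℕ.+ n)
        jump n = let k , ≰ = ¬∀⇒∃¬ {P = λ k → M (k ℕ.+ n) ≤ M n + δ} (λ all → none (n , all)) in k , ℚ.≰⇒> ≰
        climb : ∀ j → ∃ λ n → fromℕ j * δ ≤ M n
        climb = climbing jump
    in contradiction climb (reciprocal δ 0<δ)
    where
    climbing : (∀ n → ∃ λ k → M n + δ < M (k ℕ.+ n)) → ∀ j → ∃ λ n → fromℕ j * δ ≤ M n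
    climbing jump zero    = 0 , subst (_≤ M 0) (sym (ℚ.*-zeroˡ δ)) 0≤M₀
    climbing jump (suc j) = let n , le = climbing jump j ; k , lt = jump n in k ℕ.+ n ,
      ℚ.≤-trans (ℚ.≤-trans (ℚ.≤-reflexive (solve 2 (λ j d → (con 1ℚ :+ j) :* d := j :* d :+ d) refl (fromℕ j) δ))
        (ℚ.+-monoˡ-≤ δ le)) (ℚ.<⇒≤ lt)
    contradiction : (∀ j → ∃ λ n → fromℕ j * δ ≤ M n) → (∃ λ r → δ * r ≡ 1ℚ) → ⊥
    contradiction climb (r , δr≡1) = ℚ.<-irrefl refl (ℚ.<-≤-trans 1< (ℚ.≤-trans (proj₂ (climb (suc c))) (M≤1 _)))
      where
      c : ℕ
      c = proj₁ (archimedean r)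
      1< : 1ℚ < fromℕ (suc c) * δ
      1< = <-by (δ + δ * (fromℕ c - r)) (0<+ 0<δ (0≤* (ℚ.<⇒≤ 0<δ) (0≤∸ (proj₂ (archimedean r)))))
        (trans (cong (_+ (δ + δ * (fromℕ c - r))) (sym δr≡1))
          (solve 3 (λ d r c → d :* r :+ (d :+ d :* (c :- r)) := (con 1ℚ :+ c) :* d) refl δ r (fromℕ c)))

  module Union (K : ℕ → Clopen) where

    U : ℕ → Clopen
    U zero    = K 0
    U (suc n) = record
      { set     = λ x → set (U n) x ∨ set (K (suc n)) x
      ; depth   = depth (U n) ℕ.⊔ depth (K (suc n))
      ; depends = λ agree → cong₂ _∨_ (dependsBelow-mono (ℕ.m≤m⊔n _ (depth (K (suc n)))) (depends (U n)) agree)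
                                      (dependsBelow-mono (ℕ.m≤n⊔m (depth (U n)) _) (depends (K (suc n))) agree)
      }

    D : ℕ → 2^ω → Bool
    D n x = not (set (U n) x) ∧ set (K (suc n)) x

    D-depends : ∀ n → DependsBelow (depth (U (suc n))) (D n)
    D-depends n agree = cong₂ (λ a b → not a ∧ b) (dependsBelow-mono (ℕ.m≤m⊔n _ (depth (K (suc n)))) (depends (U n)) agree)
      (dependsBelow-mono (ℕ.m≤n⊔m (depth (U n)) _) (depends (K (suc n))) agree)

    measureU measureD : ℕ → ℚ
    measureU n = 𝔼 (depth (U n)) (indicator ∘ set (U n))
    measureD n = 𝔼 (depth (U (suc n))) (indicator ∘ D n)

    measureU≥0 : ∀ n → 0ℚ ≤ measureU n
    measureU≥0 n = subst (_≤ measureU n) (𝔼-const (depth (U n)) 0ℚ) (𝔼-mono (depth (U n)) λ x → 0≤ (set (U n) x))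
      where
      0≤ : ∀ b → 0ℚ ≤ indicator b
      0≤ true  = 0≤1
      0≤ false = ℚ.≤-refl

    measureU≤1 : ∀ n → measureU n ≤ 1ℚ
    measureU≤1 n = subst (measureU n ≤_) (𝔼-const (depth (U n)) 1ℚ) (𝔼-mono (depth (U n)) λ x → ≤1 (set (U n) x))
      where
      ≤1 : ∀ b → indicator b ≤ 1ℚ
      ≤1 true  = ℚ.≤-refl
      ≤1 false = 0≤1

    measureU-suc : ∀ n → measureU (suc n) ≡ measureU n + measureD n
    measureU-suc n = trans (𝔼-cong (depth (U (suc n))) λ x → disjoint (set (U n) x) (set (K (suc n)) x))
      (trans (𝔼-+ (depth (U (suc n))) (indicator ∘ set (U n)) (indicator ∘ D n))
        (cong (_+ measureD n) (𝔼-lift {depth (U n)} {depth (U (suc n))} {indicator ∘ set (U n)} (ℕ.m≤m⊔n _ (depth (K (suc n)))) λ agree → cong indicator (depends (U n) agree))))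
      where
      disjoint : ∀ a b → indicator (a ∨ b) ≡ indicator a + indicator (not a ∧ b)
      disjoint true  _     = refl
      disjoint false true  = refl
      disjoint false false = refl

    measureU-tail : ∀ n k → measureU (k ℕ.+ n) ≡ measureU n + partialSum (λ j → measureD (j ℕ.+ n)) k
    measureU-tail n zero    = sym (ℚ.+-identityʳ (measureU n))
    measureU-tail n (suc k) = trans (measureU-suc (k ℕ.+ n)) (trans (cong (_+ measureD (k ℕ.+ n)) (measureU-tail n k))
      (ℚ.+-assoc (measureU n) (partialSum (λ j → measureD (j ℕ.+ n)) k) (measureD (k ℕ.+ n))))

    K⊆U : ∀ i {x} → set (K i) x ≡ true → set (U i) x ≡ true
    K⊆U zero        Kx = Kx
    K⊆U (suc i) {x} Kx = trans (cong (set (U i) x ∨_) Kx) (∨-zeroʳ (set (U i) x))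

    U⊆⋃K : ∀ n {x} → set (U n) x ≡ true → ∃ λ i → set (K i) x ≡ true
    U⊆⋃K zero        Ux = 0 , Ux
    U⊆⋃K (suc n) {x} Ux with set (U n) x in eq
    ... | true  = U⊆⋃K n eq
    ... | false = suc n , Ux

    U-mono : ∀ k n {x} → set (U n) x ≡ true → set (U (k ℕ.+ n)) x ≡ true
    U-mono zero    n     Ux = Ux
    U-mono (suc k) n {x} Ux = cong (_∨ set (K (suc (k ℕ.+ n))) x) (U-mono k n Ux)

    enters : ∀ n k {x} → set (U (k ℕ.+ n)) x ≡ true → set (U n) x ≡ false → ∃ λ j → D (j ℕ.+ n) x ≡ true
    enters n zero    {x} Ux ¬Ux with trans (sym Ux) ¬Ux
    ... | ()
    enters n (suc k) {x} Ux ¬Ux with set (U (k ℕ.+ n)) x in eq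
    ... | true  = enters n k eq ¬Ux
    ... | false = k , cong₂ (λ a b → not a ∧ b) eq Ux

    -- The measures of the disjoint pieces `D` add up to the growth of `measureU`, which is at most
    -- δ from some n on. This stands in for continuity of measure from below.
    tail-small : ∀ {δ} → 0ℚ < δ → ∃ λ n → Small (⋃ ℕ (λ j x → D (j ℕ.+ n) x ≡ true)) δ
    tail-small {δ} 0<δ = convert (bounded⇒small-tail measureU (measureU≥0 0) measureU≤1 δ 0<δ)
      where
      convert : (∃ λ n → ∀ k → measureU (k ℕ.+ n) ≤ measureU n + δ) → ∃ λ n → Small (⋃ ℕ (λ j x → D (j ℕ.+ n) x ≡ true)) δ
      convert (n , bnd) = n , record
        { level  = λ j → strings (depth (U (suc (j ℕ.+ n)))) (D (j ℕ.+ n))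
        ; covers = λ { {x} (j , h) → j , strings-hits (depth (U (suc (j ℕ.+ n)))) {D (j ℕ.+ n)} (D-depends (j ℕ.+ n)) h }
        ; total  = λ k → subst (_≤ δ) (partialSum-cong (λ j → sym (mass-strings (depth (U (suc (j ℕ.+ n)))) (D (j ℕ.+ n)))) k)
            (cancel (measureU n) (partialSum (λ j → measureD (j ℕ.+ n)) k) (subst (_≤ measureU n + δ) (measureU-tail n k) (bnd k)))
        }
        where
        cancel : ∀ a p → a + p ≤ a + δ → p ≤ δ
        cancel a p le = ≤-by ((a + δ) - (a + p)) (0≤∸ le) (solve 3 (λ a p d → p :+ ((a :+ d) :- (a :+ p)) := d) refl a p δ)

    -- A point of the union outside `U n` is either missed by the approximation `K i` of its own
    -- piece, or lies in `K i` and enters the unions after n.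
    differ⊆ : ∀ (B : ℕ → Pred 2^ω 0ℓ) n → Differ (⋃ ℕ B) (set (U n)) ⊆ ⋃ ℕ (λ i → Differ (B i) (set (K i))) ∪ ⋃ ℕ (λ j x → D (j ℕ.+ n) x ≡ true)
    differ⊆ B n {x} (inj₁ ((i , x∈) , ¬Ux)) = cases (set (K i) x) refl
      where
      cases : ∀ b → set (K i) x ≡ b → x ∈ (⋃ ℕ (λ i → Differ (B i) (set (K i))) ∪ ⋃ ℕ (λ j x → D (j ℕ.+ n) x ≡ true))
      cases false Kx = inj₁ (i , inj₁ (x∈ , Kx))
      cases true  Kx = inj₂ (enters n i (subst (λ k → set (U k) x ≡ true) (ℕ.+-comm n i) (U-mono n i (K⊆U i Kx))) ¬Ux)
    differ⊆ B n {x} (inj₂ (x∉ , Ux)) = let i , Kx = U⊆⋃K n Ux in inj₁ (i , inj₂ ((λ x∈ → x∉ (i , x∈)) , Kx))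

  -- Cylinders are clopen and complements keep the error. Only countable unions spend some: half of
  -- ε is shared among the pieces, half goes to the tail cut off to keep a finite union.
  borel-approximation : ∀ {B} → Borel B → ∀ ε → 0ℚ < ε → ∃ λ (C : Clopen) → Small (Differ B (set C)) ε
  borel-approximation (cylinder s) ε 0<ε = record { set = λ x → ⟦ x ∈ [ s ] ⟧ ; depth = length s ; depends = λ {x} {y} agree → dep {x} {y} agree }
    , small-∅ exact (ℚ.<⇒≤ 0<ε)
    where
    transfer : ∀ s {x y} → (∀ i → i ℕ.< length s → x i ≡ y i) → x ∈ [ s ] → y ∈ [ s ]
    transfer []      _     h        = h
    transfer (b ∷ s) agree (eq , h) = trans (sym (agree 0 (ℕ.s≤s ℕ.z≤n))) eq , transfer s (λ i i< → agree (suc i) (ℕ.s≤s i<)) h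
    same : ∀ p q → (p ≡ true → q ≡ true) → (q ≡ true → p ≡ true) → p ≡ q
    same true  q     p⇒q _   = sym (p⇒q refl)
    same false false _   _   = refl
    same false true  _   q⇒p with q⇒p refl
    ... | ()
    dep : DependsBelow (length s) (λ x → ⟦ x ∈ [ s ] ⟧)
    dep {x} {y} agree = same ⟦ x ∈ [ s ] ⟧ ⟦ y ∈ [ s ] ⟧
      (λ h → ⟦⟧-intro (transfer s agree (⟦⟧-elim h))) (λ h → ⟦⟧-intro (transfer s (λ i i< → sym (agree i i<)) (⟦⟧-elim h)))
    exact : ∀ {x} → x ∈ Differ [ s ] (λ x → ⟦ x ∈ [ s ] ⟧) → ⊥
    exact (inj₁ (x∈ , h)) with trans (sym (⟦⟧-intro x∈)) h
    ... | ()
    exact (inj₂ (x∉ , h)) = x∉ (⟦⟧-elim h)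
  borel-approximation (comp {B} b) ε 0<ε = complement (borel-approximation b ε 0<ε)
    where
    complement : (∃ λ (C : Clopen) → Small (Differ B (set C)) ε) → ∃ λ (C : Clopen) → Small (Differ (∁ B) (set C)) ε
    complement (C , small) = record { set = λ x → not (set C x) ; depth = depth C ; depends = λ agree → cong not (depends C agree) }
      , small-mono swap ℚ.≤-refl small
      where
      not-true : ∀ {b} → not b ≡ true → b ≡ false
      not-true {false} _ = refl
      not-false : ∀ {b} → not b ≡ false → b ≡ true
      not-false {true} _ = refl
      swap : Differ (∁ B) (λ x → not (set C x)) ⊆ Differ B (set C)
      swap (inj₁ (x∉ , h))  = inj₂ (x∉ , not-false h)
      swap (inj₂ (¬x∉ , h)) = inj₁ (¬¬-elim ¬x∉ , not-true h)
  borel-approximation (union {B} b) ε 0<ε = assemble (tail-small (0<* 0<½ 0<ε))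
    where
    weight : ℕ → ℚ
    weight i = ½ * ε * ½^ (suc i)
    approximation : ∀ i → ∃ λ (C : Clopen) → Small (Differ (B i) (set C)) (weight i)
    approximation i = borel-approximation (b i) (weight i) (0<* (0<* 0<½ 0<ε) (0<½^ (suc i)))
    open Union (λ i → proj₁ (approximation i))
    assemble : (∃ λ n → Small (⋃ ℕ (λ j x → D (j ℕ.+ n) x ≡ true)) (½ * ε)) → ∃ λ (C : Clopen) → Small (Differ (⋃ ℕ B) (set C)) ε
    assemble (n , tail) = U n , small-mono (differ⊆ B n) (ℚ.≤-reflexive (halves ε))
      (small-∪ (small-⋃ {λ i → Differ (B i) (set (proj₁ (approximation i)))} {weight} (λ i → proj₂ (approximation i)) (partialSum-½^-≤ (ℚ.<⇒≤ (0<* 0<½ 0<ε)))) tail)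

  -- A clopen approximation of 𝒜 is unchanged by flipping a coordinate beyond
  -- its depth, while x and its flip are never both in 𝒜.
  measurable⇒negligible : ∀ {𝒜} → Independent 𝒜 → LebesgueMeasurable 𝒜 → Negligible 𝒜
  measurable⇒negligible {𝒜} ind (B , b , null) ε 0<ε = bound (borel-approximation b η 0<η)
    where
    -- Four errors are added up: 𝒜 against B and B against C, each taken as it stands and once more
    -- flipped.
    η : ℚ
    η = ½ * (½ * ε)
    0<η : 0ℚ < η
    0<η = 0<* 0<½ (0<* 0<½ 0<ε)
    bound : (∃ λ (C : Clopen) → Small (Differ B (set C)) η) → Small 𝒜 ε
    bound (C , small) = small-mono 𝒜⊆ (ℚ.≤-reflexive (solve 1 (λ e → let h = con ½ :* (con ½ :* e) in (h :+ h) :+ (h :+ h) := e) refl ε))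
      (small-∪ W-small (small-flip (depth C) W-small))
      where
      W : Pred 2^ω 0ℓ
      W = ((𝒜 ∖ B) ∪ (B ∖ 𝒜)) ∪ Differ B (set C)
      W-small : Small W (η + η)
      W-small = small-∪ (𝒩⇒negligible null η 0<η) small
      𝒜⊆ : 𝒜 ⊆ W ∪ (λ x → flip (depth C) x ∈ W)
      𝒜⊆ {x} x∈ = cases (set C x) refl
        where
        y : 2^ω
        y = flip (depth C) x
        y∉ : y ∉ 𝒜
        y∉ = Extend.no-finite-change classical ind (suc (depth C)) (flip-above (depth C) x) (flip-≢ (depth C) x) x∈
        cases : ∀ c → set C x ≡ c → x ∈ (W ∪ (λ x → flip (depth C) x ∈ W))
        cases false Cx with em (x ∈ B)
        ... | yes x∈B = inj₁ (inj₂ (inj₁ (x∈B , Cx)))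
        ... | no x∉B  = inj₁ (inj₁ (inj₁ (x∈ , x∉B)))
        -- C ignores the flipped coordinate and so contains y as well; since y is not in 𝒜, it lies
        -- in W.
        cases true Cx with em (y ∈ B)
        ... | yes y∈B = inj₂ (inj₁ (inj₂ (y∈B , y∉)))
        ... | no y∉B  = inj₂ (inj₂ (inj₂ (y∉B , trans (depends C (flip-below (depth C) x)) Cx)))

-- The construction

Range : {I : Set} → (I → 2^ω) → Pred 2^ω 0ℓ
Range g A = ∃ λ i → g i ≡ A

-- A stack machine in postfix notation, whose programs enumerate the field
-- generated by a family.
module Stack {I : Set} (g : I → 2^ω) where

  exec : List (ℕ ⊎ I) → List 2^ω → List 2^ω
  exec []                     st           = st
  exec (inj₂ i ∷ p)           st           = exec p (g i ∷ st)
  exec (inj₁ 0 ∷ p)           st           = exec p (∅ω ∷ st)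
  exec (inj₁ 1 ∷ p)           (A ∷ st)     = exec p (compl A ∷ st)
  exec (inj₁ (suc (suc _)) ∷ p) (B ∷ A ∷ st) = exec p ((A ∪ω B) ∷ st)
  -- An operation lacking operands is skipped, which makes `exec` total; compiled programs never do
  -- this.
  exec (_ ∷ p)                st           = exec p st

  head : List 2^ω → 2^ω
  head []      = ∅ω
  head (A ∷ _) = A

  eval : List (ℕ ⊎ I) → 2^ω
  eval p = head (exec p [])

  -- The induction goes through because the remaining program and the stack are arbitrary. Postfix
  -- form keeps programs flat lists, which the cardinality bound on lists can count.
  compile : ∀ {A} → A ∈ ⟨ Range g ⟩ → ∃ λ p → ∀ q st → exec (p ++ q) st ≡ exec q (A ∷ st)
  compile (gen (i , refl)) = inj₂ i ∷ [] , λ _ _ → refl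
  compile empty            = inj₁ 0 ∷ [] , λ _ _ → refl
  compile (comp A∈) = let p , run = compile A∈ in p ++ inj₁ 1 ∷ [] , λ q st →
    trans (cong (λ r → exec r st) (List.++-assoc p (inj₁ 1 ∷ []) q)) (run (inj₁ 1 ∷ q) st)
  compile (union {A} A∈ B∈) = let p , run = compile A∈ ; p′ , run′ = compile B∈ in p ++ p′ ++ inj₁ 2 ∷ [] , λ q st →
    trans (cong (λ r → exec r st) (List.++-assoc p (p′ ++ inj₁ 2 ∷ []) q))
    (trans (run ((p′ ++ inj₁ 2 ∷ []) ++ q) st)
    (trans (cong (λ r → exec r (A ∷ st)) (List.++-assoc p′ (inj₁ 2 ∷ []) q)) (run′ (inj₁ 2 ∷ q) (A ∷ st))))

  eval-surjective : ∀ {A} → A ∈ ⟨ Range g ⟩ → ∃ λ p → eval p ≡ A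
  eval-surjective A∈ = let p , run = compile A∈ in p , cong head (trans (cong (λ r → exec r []) (sym (List.++-identityʳ p))) (run [] []))

-- The Gδ set coded by c, made empty unless c really codes a null set.
CodedNull : (ℕ → ℕ → List Bool) → Pred 2^ω 0ℓ
CodedNull c x = (∀ k n → partialSum (μ ∘ c k) n ≤ ½^ k) × (∀ k → ∃ λ i → x ∈ [ c k i ])

module Construction (classical : Classical) where
  open Logic classical
  open Cardinals classical
  open Extend classical
  open StrongLaw classical
  open Approximation classical
  open Classical classical using (extensionality)

  coded-negligible : ∀ c → Negligible (CodedNull c)
  coded-negligible c ε 0<ε = from (½^-small ε 0<ε)
    where
    from : (∃ λ k → ½^ k ≤ ε) → Small (CodedNull c) ε
    from (k , ½^k≤ε) = cases (em (∀ k n → partialSum (μ ∘ c k) n ≤ ½^ k))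
      where
      cases : Dec (∀ k n → partialSum (μ ∘ c k) n ≤ ½^ k) → Small (CodedNull c) ε
      cases (no invalid) = small-∅ (λ x∈ → invalid (proj₁ x∈)) (ℚ.<⇒≤ 0<ε)
      cases (yes valid)  = small-mono {F = ⋃ ℕ (λ i → [ c k i ])} (λ x∈ → proj₂ x∈ k) ½^k≤ε
        (small-cover (c k) (valid k))

  𝒩⊆coded : ∀ {E} → E ∈ 𝒩 → ∃ λ c → E ⊆ CodedNull c
  𝒩⊆coded E∈𝒩 = (λ k → proj₁ (cover k)) , λ x∈ → (λ k → proj₂ (proj₂ (cover k))) , λ k → proj₁ (proj₂ (cover k)) x∈
    where cover = λ k → E∈𝒩 (½^ k) (0<½^ k)

  -- Lets t in 2^ω serve both as a position in the well-order and as the code of a null set to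
  -- escape.
  code : (ℕ → ℕ → List Bool) ≼ 2^ω
  code = ≼-trans ((λ c i j → proj₁ List≼ (c i j)) ,
      λ eq → extensionality λ i → extensionality λ j → proj₂ List≼ (cong (λ h → h i j) eq)) graph-≼
    where
    bit-inj : Injective _≡_ _≡_ bit
    bit-inj {true}  {true}  _ = refl
    bit-inj {false} {false} _ = refl
    List≼ : List Bool ≼ ℕ
    List≼ = List≼ℕ (bit , bit-inj)

  decode : 2^ω → ℕ → ℕ → List Bool
  decode t with em (∃ λ c → proj₁ code c ≡ t)
  ... | yes (c , _) = c
  -- The default lists the whole space, of measure 1, at every level; it is not a valid code, so its
  -- coded set is empty.
  ... | no _        = λ _ _ → []

  decode-code : ∀ c → decode (proj₁ code c) ≡ c
  decode-code c with em (∃ λ c′ → proj₁ code c′ ≡ proj₁ code c)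
  ... | yes (c′ , eq) = proj₂ code eq
  ... | no none       = ⊥-elim (none (c , refl))

  -- Transfinite choice of the independent sequence

  wellOrder : WellOrder 2^ω
  wellOrder = proj₁ (initialWellOrder 2^ω cantor)

  open WellOrder wellOrder using (connex) renaming (_<_ to _≺_; wf to ≺-wf; <-trans to ≺-trans)

  Fresh : ∀ t → (El (_≺ t) → 2^ω) → 2^ω → Set
  Fresh t g x = x ∉ CodedNull (decode t) × Random (Range g) x

  -- Were no point fresh, the bad sets would form a null cover. The hypothesis injects 2^ω into this
  -- cover, hence into the programs naming its members, against the choice of the well-order.
  fresh-exists : Cov𝒩≡𝔠 → ∀ t g → ∃ (Fresh t g)
  fresh-exists cov t g = ¬¬-elim λ none → proj₂ (initialWellOrder 2^ω cantor) t (index none)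
    where
    Program : Set
    Program = List (ℕ ⊎ El (_≺ t))
    open Stack g

    -- The empty program is reserved for the task at t.
    bad : Program → Pred 2^ω 0ℓ
    bad []      = CodedNull (decode t)
    bad (_ ∷ p) = Biased (eval p)

    bad-negligible : ∀ p → Negligible (bad p)
    bad-negligible []      = coded-negligible (decode t)
    bad-negligible (_ ∷ p) = biased-negligible (eval p)

    𝒮 : Pred (Pred 2^ω 0ℓ) 0ℓ
    𝒮 S = ∃ λ p → S ≐ bad p

    𝒮⊆𝒩 : ∀ {S} → S ∈ 𝒮 → S ∈ 𝒩
    𝒮⊆𝒩 (p , S⊆ , _) = negligible⇒𝒩 λ ε 0<ε → small-mono S⊆ ℚ.≤-refl (bad-negligible p ε 0<ε)

    covered : ¬ ∃ (Fresh t g) → ∀ x → ∃ λ p → x ∈ bad p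
    covered none x with em (∃ λ p → x ∈ bad p)
    ... | yes ex   = ex
    ... | no avoid = ⊥-elim (none (x , (λ x∈ → avoid ([] , x∈)) , random))
      where
      random : Random (Range g) x
      random B∈ = ¬¬-elim λ biased → let p , eq = eval-surjective B∈
        -- The leading symbol is a dummy that `bad` discards.
        in avoid (inj₁ 0 ∷ p , subst (λ B → Biased B x) (sym eq) biased)

    index : ¬ ∃ (Fresh t g) → 2^ω ≼ Program
    index none = (λ x → proj₁ (proj₂ (to x))) , λ {x} {y} eq → injective (same (proj₂ (to x)) (proj₂ (to y)) eq)
      where
      injection : Injection 𝔠 (Members 𝒫2^ω 𝒮)
      injection = proj₂ cov 𝒮 (𝒮⊆𝒩 , λ x → let p , x∈ = covered none x in bad p , (p , id , id) , x∈)
      open Injection injection using (to; injective)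
      same : ∀ {S T} (S∈ : S ∈ 𝒮) (T∈ : T ∈ 𝒮) → proj₁ S∈ ≡ proj₁ T∈ → S ≐ T
      same (p , S⊆ , ⊆S) (.p , T⊆ , ⊆T) refl = ⊆T ∘ S⊆ , ⊆S ∘ T⊆

  module Sequence (f : 2^ω → 2^ω) (fresh : ∀ t → Fresh t (f ∘ val) (f t)) where

    Before : 2^ω → Pred 2^ω 0ℓ
    Before t = Range {El (_≺ t)} (f ∘ val)

    ⊕-mono : ∀ {s t} → s ≺ t → (Before s ⊕ f s) ⊆ (Before t ⊕ f t)
    ⊕-mono s≺t (inj₁ (u , eq)) = inj₁ (el (val u) (≺-trans (member u) s≺t) , eq)
    ⊕-mono {s} s≺t (inj₂ refl) = inj₁ (el s s≺t , refl)

    directed : ∀ s t → ∃ λ r → (r ≡ s ⊎ r ≡ t) × (Before s ⊕ f s) ⊆ (Before r ⊕ f r) × (Before t ⊕ f t) ⊆ (Before r ⊕ f r)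
    directed s t with em (s ≡ t)
    ... | yes refl = s , inj₁ refl , id , id
    ... | no s≢t with connex s t s≢t
    ...   | inj₁ s≺t = t , inj₂ refl , ⊕-mono s≺t , id
    ...   | inj₂ t≺s = s , inj₁ refl , id , ⊕-mono t≺s

    -- Each earlier f s lies in `Before s ⊕ f s`, which is independent by induction and the
    -- randomness of f s; connexity of ≺ makes these families directed. An empty segment offers no
    -- index for the union and is treated apart.
    independent-before : ∀ t → Acc _≺_ t → Independent (Before t)
    independent-before t (acc rs) = cases (em (El (_≺ t)))
      where
      cases : Dec (El (_≺ t)) → Independent (Before t)
      cases (no none) = independent-∅ λ { (u , _) → none u }
      cases (yes u₀)  = independent-⊆ (λ { (u , eq) → u , inj₂ (sym eq) })
        (independent-⋃ (λ u → Before (val u) ⊕ f (val u)) u₀ directed′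
          λ u → extend (independent-before (val u) (rs (member u))) (proj₂ (fresh (val u))))
        where
        directed′ : ∀ (u v : El (_≺ t)) → ∃ λ w → (Before (val u) ⊕ f (val u)) ⊆ (Before (val w) ⊕ f (val w))
                                                × (Before (val v) ⊕ f (val v)) ⊆ (Before (val w) ⊕ f (val w))
        directed′ u v with directed (val u) (val v)
        ... | _ , inj₁ refl , u⊆ , v⊆ = u , u⊆ , v⊆
        ... | _ , inj₂ refl , u⊆ , v⊆ = v , u⊆ , v⊆

    independent-range : Independent (Range f)
    independent-range = independent-⊆ (λ { (t , eq) → t , inj₂ (sym eq) })
      (independent-⋃ (λ t → Before t ⊕ f t) ∅ω (λ s t → let r , _ , s⊆ , t⊆ = directed s t in r , s⊆ , t⊆)
        λ t → extend (independent-before t (≺-wf t)) (proj₂ (fresh t)))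

    f-injective : Injective _≡_ _≡_ f
    f-injective {s} {t} eq with em (s ≡ t)
    ... | yes s≡t = s≡t
    ... | no s≢t with connex s t s≢t
    ...   | inj₁ s≺t = ⊥-elim (random-fresh (independent-before t (≺-wf t)) (proj₂ (fresh t)) (el s s≺t , eq))
    ...   | inj₂ t≺s = ⊥-elim (random-fresh (independent-before s (≺-wf s)) (proj₂ (fresh s)) (el t t≺s , sym eq))

    -- A null set containing the family would be covered by the coded set of some t, but f t was
    -- chosen outside that set.
    range-nonnegligible : ∀ {𝒜 : Pred 2^ω 0ℓ} → Range f ⊆ 𝒜 → ¬ Negligible 𝒜
    range-nonnegligible {𝒜} f⊆𝒜 negl = escape (𝒩⊆coded (negligible⇒𝒩 negl))
      where
      escape : ¬ ∃ λ c → 𝒜 ⊆ CodedNull c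
      escape (c , 𝒜⊆) = proj₁ (fresh t) (subst (λ c → f t ∈ CodedNull c) (sym (decode-code c)) (𝒜⊆ (f⊆𝒜 (t , refl))))
        where t = proj₁ code c

  -- Extension to a maximal family

  module Maximal (𝒜₀ : Pred 2^ω 0ℓ) (ind₀ : Independent 𝒜₀) where

    adjoin : (2^ω → Bool) → Pred 2^ω 0ℓ
    adjoin A x = x ∈ 𝒜₀ ⊎ A x ≡ true

    Addable : (2^ω → Bool) → 2^ω → Set
    Addable A x = A x ≡ false × Independent (adjoin A ⊕ x)

    pick : (2^ω → Bool) → Maybe 2^ω
    pick A with em (∃ (Addable A))
    ... | yes (x , _) = just x
    ... | no _        = nothing

    pick-addable : ∀ A {x} → pick A ≡ just x → Addable A x
    pick-addable A eq with em (∃ (Addable A))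
    pick-addable A refl | yes (_ , addable) = addable

    pick-just : ∀ A x → Addable A x → ∃ λ y → pick A ≡ just y
    pick-just A x addable with em (∃ (Addable A))
    ... | yes (y , _) = y , refl
    ... | no none     = ⊥-elim (none (x , addable))

    open Tower classical pick (λ A eq → proj₁ (pick-addable A eq))

    adjoin-mono : ∀ {A B} → A ⊆ᵇ B → adjoin A ⊆ adjoin B
    adjoin-mono A⊆B (inj₁ x∈) = inj₁ x∈
    adjoin-mono A⊆B {x} (inj₂ Ax) = inj₂ (A⊆B x Ax)

    independent-step : ∀ {A} → Independent (adjoin A) → Independent (adjoin (step A))
    independent-step {A} ind = cases (em (∃ λ c → pick A ≡ just c))
      where
      just-injective : ∀ {x y : 2^ω} → just x ≡ just y → x ≡ y
      just-injective refl = refl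
      cases : Dec (∃ λ c → pick A ≡ just c) → Independent (adjoin (step A))
      cases (yes (c , eq)) = independent-⊆ (λ
        { (inj₁ x∈) → inj₁ (inj₁ x∈)
        ; {x} (inj₂ h) → [ inj₁ ∘ inj₂ , (λ eq′ → inj₂ (just-injective (trans (sym eq′) eq))) ]′ (step-inv A x h) }) (proj₂ (pick-addable A eq))
      cases (no none) = independent-⊆ (λ
        { (inj₁ x∈) → inj₁ x∈
        ; {x} (inj₂ h) → [ inj₂ , (λ eq → ⊥-elim (none (x , eq))) ]′ (step-inv A x h) }) ind

    independent-sup : ∀ 𝒫 → (∀ A → 𝒫 A ≡ true → Independent (adjoin A)) →
      (∀ A B → 𝒫 A ≡ true → 𝒫 B ≡ true → A ⊆ᵇ B ⊎ B ⊆ᵇ A) → Independent (adjoin (⋃ᵇ 𝒫))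
    independent-sup 𝒫 ind chain = independent-⊆ into (independent-⋃ 𝔽 nothing directed ind′)
      where
      -- `nothing` stands for 𝒜₀ and provides an index even when 𝒫 is empty.
      Index : Set
      Index = Maybe (∃ λ A → 𝒫 A ≡ true)
      𝔽 : Index → Pred 2^ω 0ℓ
      𝔽 nothing        = 𝒜₀
      𝔽 (just (A , _)) = adjoin A
      ind′ : ∀ i → Independent (𝔽 i)
      ind′ nothing         = ind₀
      ind′ (just (A , 𝒫A)) = ind A 𝒫A
      directed : ∀ i j → ∃ λ k → 𝔽 i ⊆ 𝔽 k × 𝔽 j ⊆ 𝔽 k
      directed nothing nothing = nothing , id , id
      directed nothing (just j) = just j , inj₁ , id
      directed (just i) nothing = just i , id , inj₁
      directed (just (A , 𝒫A)) (just (B , 𝒫B)) with chain A B 𝒫A 𝒫B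
      ... | inj₁ A⊆B = just (B , 𝒫B) , adjoin-mono A⊆B , id
      ... | inj₂ B⊆A = just (A , 𝒫A) , id , adjoin-mono B⊆A
      into : adjoin (⋃ᵇ 𝒫) ⊆ ⋃ Index 𝔽
      into (inj₁ x∈) = nothing , x∈
      into (inj₂ h)  = let A , 𝒫A , Ax = ⟦⟧-elim h in just (A , 𝒫A) , inj₂ Ax

    maximal : Pred 2^ω 0ℓ
    maximal = adjoin top

    maximal-independent : Independent maximal
    maximal-independent = stage-induction (Independent ∘ adjoin) independent-step independent-sup stage-top

    maximal-saturated : ∀ {x} → x ∉ maximal → ¬ Independent (maximal ⊕ x)
    maximal-saturated {x} x∉ ind = let y , eq = pick-just top x (¬-not (x∉ ∘ inj₂) , ind) in pick-top y eq

    -- A proper independent extension ℬ would contain a point x outside `maximal`, and `maximal ⊕ x`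
    -- would be independent as a subfamily of ℬ.
    maximal-dIndependent : Satisfiable 𝒜₀ → MaximalDIndependent maximal
    maximal-dIndependent (A , A∈) = independent⇒dIndependent (A , inj₁ A∈) maximal-independent ,
      λ { (ℬ , ℬ-ind , 𝒜⊆ℬ , ℬ⊈𝒜) → ℬ⊈𝒜 λ {x} x∈ℬ → ¬¬-elim λ x∉ → maximal-saturated x∉
            (independent-⊆ (λ { (inj₁ y∈) → 𝒜⊆ℬ y∈ ; (inj₂ refl) → x∈ℬ }) (dIndependent⇒independent ℬ-ind)) }

  -- Cantor-Bernstein applies because 𝒜 lies between the range of an injection from 2^ω and 2^ω
  -- itself.
  cardinality𝔠 : ∀ {𝒜 : Pred 2^ω 0ℓ} (f : 2^ω → 2^ω) → Injective _≡_ _≡_ f → Range f ⊆ 𝒜 → HasCardinality𝔠 𝒜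
  cardinality𝔠 {𝒜} f f-inj f⊆𝒜 = record
    { to        = λ x → val (h x) , member (h x)
    ; cong      = cong (val ∘ h)
    ; bijective = (λ eq → h-inj (el-≡ eq)) , λ { (y , y∈) → let x , eq = h-surj (el y y∈) in x , λ { refl → cong val eq } }
    }
    where
    open CantorBernstein {2^ω} {El 𝒜} (λ x → el (f x) (f⊆𝒜 (x , refl))) val (λ eq → f-inj (cong val eq)) el-≡

theorem2p15 : Classical → Cov𝒩≡𝔠 →
    ∃ λ 𝒜 → MaximalDIndependent 𝒜 × HasCardinality𝔠 𝒜 × ¬ LebesgueMeasurable 𝒜
theorem2p15 classical cov = maximal , maximal-dIndependent (f ∅ω , ∅ω , refl) ,
    cardinality𝔠 f f-injective inj₁ ,
    λ measurable → range-nonnegligible inj₁ (measurable⇒negligible maximal-independent measurable)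
  where
  open Construction classical
  sequence : ∃ λ f → ∀ t → Fresh t (f ∘ val) (f t)
  sequence = Cardinals.transfinite classical (WellOrder.wf wellOrder) Fresh (fresh-exists cov)
  f : 2^ω → 2^ω
  f = proj₁ sequence
  open Sequence f (proj₂ sequence)
  open Maximal (Range f) independent-range
  open Approximation classical
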